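{- Let $t$ be a positive integer and $m\ge 2$ an integer. For sufficiently large $n$, the $3$-graph $\mathcal{G}(t,m,n)$ defined below contains no copy of $(t+1)\cdot\mathcal{F}_5^S(m)$ and has the maximum number of hyperedges among all $n$-vertex $3$-graphs containing no copy of $(t+1)\cdot\mathcal{F}_5^S(m)$; that is, $\mathrm{ex}_3(n,(t+1)\cdot\mathcal{F}_5^S(m))=e(\mathcal{G}(t,m,n))$.
   Context: All hypergraphs are $3$-uniform. $\mathrm{ex}_3(n,\mathcal{F})$ is the maximum number of hyperedges in an $n$-vertex $3$-graph with no copy of $\mathcal{F}$. $T_3(N,3)$ is the complete $3$-partite $3$-graph on $N$ vertices (hyperedges are triples with one vertex in each part) with part sizes $\lfloor N/3\rfloor$ or $\lceil N/3\rceil$. $\mathcal{F}_5^S(m)$ is the $3$-graph obtained from $T_3(3m,3)$ by adding one new vertex $v$ and one hyperedge consisting of $v$ and two vertices lying in the same part of $T_3(3m,3)$. $(t+1)\cdot\mathcal{F}_5^S(m)$ denotes $t+1$ vertex-disjoint copies of $\mathcal{F}_5^S(m)$. $\mathcal{G}(t,m,n)$ is the $n$-vertex $3$-graph obtained by taking a set $T$ of $t$ vertices and a disjoint copy of $T_3(n-t,3)$, and taking as hyperedges all hyperedges of $T_3(n-t,3)$ together with all triples of vertices that intersect $T$. -}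

module Defs where

open import Data.Nat using (ℕ; zero; suc; _+_; _*_; _∸_; _<ᵇ_; _≡ᵇ_)
open import Data.Nat.DivMod using (_%_; _/_; m%n<n)
open import Data.Bool using (Bool; true; false; _∧_; _∨_; not; if_then_else_)
open import Data.Fin using (Fin; toℕ; fromℕ<; _<_; _<?_)
open import Data.List using (List; map)
open import Data.Nat.ListAction using (sum)
open import Data.List.Base using (allFin)
open import Data.Product using (Σ; _×_)
open import Data.Sum using (_⊎_)
open import Relation.Nullary using (¬_; does)
open import Relation.Binary.PropositionalEquality using (_≡_)
open import Function.Definitions using (Injective)

-- A 3-graph on vertex set Fin n.  Convention: the hyperedges are exactly the
-- 3-sets {x,y,z} with x < y < z and H x y z ≡ true; values of H on triples
-- that are not strictly increasing are ignored.
Graph3 : ℕ → Set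
Graph3 n = Fin n → Fin n → Fin n → Bool

Inc : ∀ {n} → Graph3 n → Fin n → Fin n → Fin n → Set
Inc H x y z = (x < y) × (y < z) × (H x y z ≡ true)

IsEdge : ∀ {n} → Graph3 n → Fin n → Fin n → Fin n → Set
IsEdge H x y z =
  Inc H x y z ⊎ Inc H x z y ⊎ Inc H y x z ⊎ Inc H y z x ⊎ Inc H z x y ⊎ Inc H z y x

edges : ∀ {n} → Graph3 n → ℕ
edges {n} H =
  sum (map (λ i → sum (map (λ j → sum (map (λ k →
    if does (i <? j) ∧ does (j <? k) ∧ H i j k then 1 else 0)
      (allFin n))) (allFin n))) (allFin n))

Contains : ∀ {n a} → Graph3 n → Graph3 a → Set
Contains {n} {a} H F =
  Σ (Fin a → Fin n) λ f → Injective _≡_ _≡_ f ×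
    (∀ x y z → IsEdge F x y z → IsEdge H (f x) (f y) (f z))

distinct3 : ℕ → ℕ → ℕ → Bool
distinct3 p q r = not (p ≡ᵇ q) ∧ not (q ≡ᵇ r) ∧ not (p ≡ᵇ r)

-- T_3(N,3): vertex i of Fin N lies in part (i mod 3); part sizes are ⌊N/3⌋ or ⌈N/3⌉.
T3 : (N : ℕ) → Graph3 N
T3 N x y z = distinct3 (toℕ x % 3) (toℕ y % 3) (toℕ z % 3)

-- F_5^S(m) on Fin (3m+1): vertices 0..3m-1 form T_3(3m,3) (part = index mod 3),
-- vertex 3m is the new vertex v, and the extra hyperedge is {0, 3, v}
-- (0 and 3 both lie in part 0; note 3 < 3m since m ≥ 2).
F5S : (m : ℕ) → Graph3 (suc (3 * m))
F5S m x y z =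
  ((a <ᵇ 3 * m) ∧ (b <ᵇ 3 * m) ∧ (c <ᵇ 3 * m) ∧ distinct3 (a % 3) (b % 3) (c % 3))
  ∨ ((a ≡ᵇ 0) ∧ (b ≡ᵇ 3) ∧ (c ≡ᵇ 3 * m))
  where
  a = toℕ x
  b = toℕ y
  c = toℕ z

copies : (k s : ℕ) → Graph3 (suc s) → Graph3 (k * suc s)
copies k s F x y z =
  (blk x ≡ᵇ blk y) ∧ (blk y ≡ᵇ blk z) ∧ F (loc x) (loc y) (loc z)
  where
  blk : Fin (k * suc s) → ℕ
  blk i = toℕ i / suc s
  loc : Fin (k * suc s) → Fin (suc s)
  loc i = fromℕ< (m%n<n (toℕ i) (suc s))

manyF5S : (t m : ℕ) → Graph3 (suc t * suc (3 * m))
manyF5S t m = copies (suc t) (3 * m) (F5S m)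

-- G(t,m,n) on Fin n: T = vertices with index < t; the vertices with index ≥ t
-- form T_3(n-t,3) (vertex i in part ((i - t) mod 3)); hyperedges are all triples
-- meeting T together with all hyperedges of T_3(n-t,3).  (It does not depend on m.)
G : (t m n : ℕ) → Graph3 n
G t m n x y z =
  (a <ᵇ t) ∨ (b <ᵇ t) ∨ (c <ᵇ t)
  ∨ distinct3 ((a ∸ t) % 3) ((b ∸ t) % 3) ((c ∸ t) % 3)
  where
  a = toℕ x
  b = toℕ y
  c = toℕ z

{-# OPTIONS --safe #-}
-- Write F for F5S m, a subgraph of a blow-up of F₅ = {abc, abd, cde}.  Let E be
-- an F-free system on n vertices, n large, in which every non-isolated vertex
-- has degree at least (1/9 - o(1)) n².  By supersaturation E has few copies of
-- F₅ and of K₄⁻, so the common neighbourhood N(xy) of almost every pair xy spans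
-- few edges with two vertices in it.  Let V₁ = N(xy) be the largest such
-- neighbourhood, b a typical vertex of V₁ and V₂ ⊆ N(ba) the largest one meeting
-- the complement of V₁.  With k₁ = |V₁| ≥ k₂ = |V₂| and r = n - k₁ - k₂, the
-- degree of b is at most about k₂ r, and at most about (n - k₁) k₂ / 2; both
-- being at least n²/9 forces k₁, k₂, r ≈ n/3, and E is close to the complete
-- tripartite system.  If the link of a vertex had many pairs inside one part, or
-- many pairs of two of the three crossing types, then F could be embedded
-- through that vertex; so every vertex belongs to exactly one part, and an edge
-- with two vertices of the same part again yields F.  Hence E is 3-colourable.
--
-- The theorem follows by induction on t.  A vertex of low degree is deleted,
-- which is impossible more than n³ times (progressive induction), so all degrees
-- are large.  If H - v has no t disjoint copies of F for some v, then induction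
-- applies to H - v.  Otherwise no v lies on a copy of F avoiding t disjoint
-- copies in H - v; removing such copies leaves a 3-colourable system, in which v
-- has degree at most (1/9 + o(1)) n².  Removing a packing X of t copies therefore
-- costs only |X| (1/9 + o(1)) n² edges besides those of a 3-partite graph on
-- n - |X| vertices, about t (1/2 - 1/9) n² edges fewer than G t m n has.
module Submission where

open import Defs
open import Data.Nat using (ℕ; zero; suc; _+_; _*_; _∸_; _^_; _≤_; _≤?_; _≤ᵇ_; _<ᵇ_; _≡ᵇ_; z≤n; s≤s)
open import Data.Bool using (Bool; true; false; _∧_; _∨_; not; T)
open import Data.Fin using (Fin; zero; suc; toℕ)
open import Data.Product using (Σ; ∃-syntax; _×_; _,_; proj₁; proj₂)
open import Data.Sum using (_⊎_; inj₁; inj₂)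
open import Data.Empty using (⊥; ⊥-elim)
open import Data.Unit using (tt)
open import Function using (_∘_)
open import Relation.Nullary using (¬_; Dec; yes; no; does)
open import Relation.Binary.PropositionalEquality using (_≡_; _≢_; refl; sym; trans; cong; cong₂; subst)

-- Each o(1) is replaced by a multiple of 1/q for one natural number q, with denominators cleared,
-- and hyperedges are counted as ordered triples, six for each edge. The degree bound thus reads
-- `2 * q * (n * n) ≤ 9 * q * deg v + n * n`. Removing a packing means isolating its vertices. This
-- keeps the vertex set `Fin n`, and it is the reason why the stability argument has to tolerate
-- isolated vertices. All forbidden patterns are hosts of one kind, `Config`. Its vertex z is
-- subject to no condition but the edge xyz and may even occur in one of the three families, which
-- is why K₄⁻ serves as well as F₅. Whether H - v contains a packing is never decided. The bound to
-- be proved is an inequality of naturals, hence stable under double negation, and packings are used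
-- only while it is assumed to fail. The final count is tight to first order: isolating a vertex of
-- degree (1/9) n² costs as much as a balanced tripartite graph loses with one vertex. Only an error
-- |X| n²/q is left to be beaten by the surplus that the set T gives to `G t m n`, so q has to
-- exceed the number of vertices of a packing.

module Certificates where
  open import Data.Nat.Properties

  infixl 6 _⊕_
  infixr 7 _⊙_

  _⊕_ : ∀ {a b c d} → a ≤ b → c ≤ d → a + c ≤ b + d
  _⊕_ = +-mono-≤

  _⊙_ : ∀ c {a b} → a ≤ b → c * a ≤ c * b
  c ⊙ h = *-monoʳ-≤ c h

  -- L ≤ R is a combination of the hypotheses with natural coefficients and s the
  -- slack; the identity is a matter of the ring solver.
  lin : ∀ {a b L R} → L ≤ R → (s : ℕ) → a + R + s ≡ b + L → a ≤ b
  lin {a} {b} {L} {R} h s eq =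
    +-cancelʳ-≤ R a b (≤-trans (≤-trans (m≤m+n (a + R) s) (≤-reflexive eq)) (+-monoʳ-≤ b h))

-- Finite sums, cardinalities, and Boolean inequalities by truth table.

module Sums where
  open import Data.Nat.Properties
  open import Data.Bool.Properties using (T-∧)
  open import Data.Fin using (punchIn)
  open import Function.Bundles using (Equivalence)
  open import Relation.Binary.PropositionalEquality using (module ≡-Reasoning)
  open import Algebra.Properties.Semiring.Sum +-*-semiring using (sum; sum-cong-≗; sum-remove; ∑-distrib-+; ∑-comm; *-distribˡ-sum; *-distribʳ-sum)
  open Certificates

  abstract
    ∑ : ∀ {n} → (Fin n → ℕ) → ℕ
    ∑ = sum


    ∑-zero : (f : Fin 0 → ℕ) → ∑ f ≡ 0
    ∑-zero f = refl

    ∑-suc : ∀ {n} (f : Fin (suc n) → ℕ) → ∑ f ≡ f zero + ∑ (λ i → f (suc i))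
    ∑-suc f = refl

    ∑-cong : ∀ {n} {f g : Fin n → ℕ} → (∀ i → f i ≡ g i) → ∑ f ≡ ∑ g
    ∑-cong = sum-cong-≗

    ∑-mono : ∀ {n} {f g : Fin n → ℕ} → (∀ i → f i ≤ g i) → ∑ f ≤ ∑ g
    ∑-mono {zero} h = z≤n
    ∑-mono {suc n} h = h zero ⊕ ∑-mono (h ∘ suc)

    ∑-+ : ∀ {n} (f g : Fin n → ℕ) → ∑ (λ i → f i + g i) ≡ ∑ f + ∑ g
    ∑-+ = ∑-distrib-+

    ∑-swap : ∀ {m n} (f : Fin m → Fin n → ℕ) → ∑ (λ i → ∑ (λ j → f i j)) ≡ ∑ (λ j → ∑ (λ i → f i j))
    ∑-swap = ∑-comm

    ∑-*ˡ : ∀ {n} c (f : Fin n → ℕ) → ∑ (λ i → c * f i) ≡ c * ∑ f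
    ∑-*ˡ c f = sym (*-distribˡ-sum c f)

    ∑-*ʳ : ∀ {n} c (f : Fin n → ℕ) → ∑ (λ i → f i * c) ≡ ∑ f * c
    ∑-*ʳ c f = sym (*-distribʳ-sum c f)

    ∑-const : ∀ n c → ∑ {n} (λ _ → c) ≡ n * c
    ∑-const zero c = refl
    ∑-const (suc n) c = cong (c +_) (∑-const n c)

    ∑-bound : ∀ {n} {f : Fin n → ℕ} {c} → (∀ i → f i ≤ c) → ∑ f ≤ n * c
    ∑-bound {n} {f} {c} h = ≤-trans (∑-mono h) (≤-reflexive (∑-const n c))

    ∑-+-mono : ∀ {n} {f g h : Fin n → ℕ} → (∀ i → f i ≤ g i + h i) → ∑ f ≤ ∑ g + ∑ h
    ∑-+-mono {g = g} {h} p = ≤-trans (∑-mono p) (≤-reflexive (∑-+ g h))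

    ∑-term : ∀ {n} (f : Fin n → ℕ) i → f i ≤ ∑ f
    ∑-term f zero = m≤m+n _ _
    ∑-term f (suc i) = ≤-trans (∑-term (f ∘ suc) i) (m≤n+m _ _)

    ∑-product : ∀ {m n} (f : Fin m → ℕ) (g : Fin n → ℕ) → ∑ (λ i → ∑ (λ j → f i * g j)) ≡ ∑ f * ∑ g
    ∑-product f g = trans (∑-cong (λ i → ∑-*ˡ (f i) g)) (∑-*ʳ (∑ g) f)

    ∑-punchIn : ∀ {n} (f : Fin (suc n) → ℕ) i → ∑ f ≡ f i + ∑ (λ j → f (punchIn i j))
    ∑-punchIn f i = sum-remove {i = i} f

    argmax : ∀ {n} (f : Fin (suc n) → ℕ) → ∃[ i ] (∀ j → f j ≤ f i)
    argmax {zero} f = zero , λ { zero → ≤-refl }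
    argmax {suc n} f with argmax (f ∘ suc)
    ... | i , h with f zero ≤? f (suc i)
    ...   | yes p = suc i , λ { zero → p ; (suc j) → h j }
    ...   | no ¬p = zero , λ { zero → ≤-refl ; (suc j) → ≤-trans (h j) (<⇒≤ (≰⇒> ¬p)) }

    ∑-positive : ∀ {n} (f : Fin n → ℕ) → 1 ≤ ∑ f → ∃[ i ] 1 ≤ f i
    ∑-positive {zero} f ()
    ∑-positive {suc n} f h with f zero in eq
    ... | suc k = zero , subst (1 ≤_) (sym eq) (s≤s z≤n)
    ... | zero with ∑-positive (f ∘ suc) h
    ...   | i , p = suc i , p

  infix 8 ∑
  syntax ∑ (λ x → e) = ∑[ x ] e

  ⟦_⟧ : Bool → ℕ
  ⟦ true ⟧ = 1
  ⟦ false ⟧ = 0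

  ⟦⟧≤1 : ∀ b → ⟦ b ⟧ ≤ 1
  ⟦⟧≤1 true = ≤-refl
  ⟦⟧≤1 false = z≤n

  ⟦⟧-true : ∀ {b} → 1 ≤ ⟦ b ⟧ → b ≡ true
  ⟦⟧-true {true} _ = refl

  ⟦⟧-∧ : ∀ a b → ⟦ a ∧ b ⟧ ≡ ⟦ a ⟧ * ⟦ b ⟧
  ⟦⟧-∧ true b = sym (+-identityʳ _)
  ⟦⟧-∧ false b = refl

  ∧-left : ∀ {a b} → a ∧ b ≡ true → a ≡ true
  ∧-left {true} _ = refl

  ∧-right : ∀ {a b} → a ∧ b ≡ true → b ≡ true
  ∧-right {true} p = p

  card : ∀ {n} → (Fin n → Bool) → ℕ
  card S = ∑[ x ] ⟦ S x ⟧

  card≤ : ∀ {n} (S : Fin n → Bool) → card S ≤ n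
  card≤ {n} S = ≤-trans (∑-bound (⟦⟧≤1 ∘ S)) (≤-reflexive (*-identityʳ n))

  BoolFun : ℕ → Set
  BoolFun zero = ℕ
  BoolFun (suc k) = Bool → BoolFun k

  table : ∀ k → BoolFun k → BoolFun k → Bool
  table zero f g = f ≤ᵇ g
  table (suc k) f g = table k (f true) (g true) ∧ table k (f false) (g false)

  Below : ∀ k → BoolFun k → BoolFun k → Set
  Below zero f g = f ≤ g
  Below (suc k) f g = ∀ b → Below k (f b) (g b)

  -- Proof by exhaustion: the implicit argument evaluates all rows of the truth table, so case
  -- distinctions on class membership and adjacency are settled by computation.
  byTable : ∀ k (f g : BoolFun k) {_ : T (table k f g)} → Below k f g
  byTable zero f g {t} = ≤ᵇ⇒≤ f g t
  byTable (suc k) f g {t} true = byTable k (f true) (g true) {proj₁ (Equivalence.to T-∧ t)}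
  byTable (suc k) f g {t} false =
    byTable k (f false) (g false) {proj₂ (Equivalence.to (T-∧ {table k (f true) (g true)}) t)}

-- The integer inequalities behind the quantitative argument.

module Estimates where
  open import Data.Nat
  open import Data.Nat.Properties
  open import Data.List using ([]; _∷_)
  open import Data.Nat.Tactic.RingSolver using (solve)
  open Certificates

  dense-arith : ∀ q M p D S → 4 * q * M * p ≤ 2 * q * D → D ≤ p * M + 4 * q * M * S →
                2 * q * M * p ≤ 2 * q * M * (4 * q * S)
  dense-arith q M p D S h₁ h₂ = lin (h₁ ⊕ (2 * q) ⊙ h₂) 0 (solve (p ∷ D ∷ S ∷ q ∷ M ∷ []))

  many-arith : ∀ q n p S l → n * p ≤ q * S → 2 * q * S ≤ 2 * q * p * l + n * p → n * p ≤ 2 * q * l * p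
  many-arith q n p S l h₁ h₂ = lin (2 ⊙ h₁ ⊕ h₂) 0 (solve (n ∷ p ∷ S ∷ l ∷ q ∷ []))


  -- Markov's inequality for both kinds of bad pairs: there are at most q² J / n³ of the first and q
  -- K / n² of the second, and the factor 2 q⁴ in the supersaturation bounds makes each of these at
  -- most n² / (2 q²).
  bad-pairs : ∀ n q B J K → 1 ≤ n → 1 ≤ q → n * n * n * B ≤ q * q * J + q * n * K →
    2 * (q * q * q * q) * J ≤ n * (n * (n * (n * (n * 1)))) → 2 * (q * q * q * q) * K ≤ n * (n * (n * (n * 1))) →
    q * q * B ≤ n * n
  bad-pairs (suc n′) (suc q′) B J K n₀ q₀ h hJ hK = *-cancelˡ-≤ (2 * (q * q * n * n * n)) scaled
    where
    n = suc n′
    q = suc q′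
    arith : ∀ n q → 1 ≤ q → n * n * n * B ≤ q * q * J + q * n * K →
      2 * (q * q * q * q) * J ≤ n * (n * (n * (n * (n * 1)))) → 2 * (q * q * q * q) * K ≤ n * (n * (n * (n * 1))) →
      2 * (q * q * n * n * n) * (q * q * B) ≤ 2 * (q * q * n * n * n) * (n * n)
    arith n q q₀ h hJ hK = lin ((2 * (q * q * q * q)) ⊙ h ⊕ (q * q) ⊙ hJ ⊕ (q * n) ⊙ hK ⊕ (q * n * n * n * n * n) ⊙ q₀) 0
      (solve (n ∷ q ∷ B ∷ J ∷ K ∷ []))
    scaled = arith n q q₀ h hJ hK

  total-lower : ∀ n q T x → 2 * q * (n * n) * n ≤ 9 * q * T + n * (n * n) + 2 * q * (n * n) * x → q * x ≤ n →
    2 * q * (n * n * n) ≤ 9 * q * T + 3 * (n * n * n)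
  total-lower n q T x h hx = lin (h ⊕ (2 * n * n) ⊙ hx) 0 (solve (n ∷ q ∷ T ∷ x ∷ []))

  cube-contra : ∀ n a b → 1 ≤ n → b < a → a * (n * n * n) ≤ b * (n * n * n) → ⊥
  cube-contra (suc n) a b _ b<a h = <⇒≱ b<a (*-cancelʳ-≤ a b (suc n * suc n * suc n) h)

  square-contra : ∀ n a b → 1 ≤ n → b < a → a * (n * n) ≤ b * (n * n) → ⊥
  square-contra (suc n) a b _ b<a h = <⇒≱ b<a (*-cancelʳ-≤ a b (suc n * suc n) h)

  -- The ordered total is about 2n³/9, so a maximal codegree is about 2n/9 or more. Only 2n/q is
  -- kept, which is what the atypical vertices in `typical-exists` can number.
  max-codegree : ∀ n q T k B → 1 ≤ n → 100 ≤ q → 2 * q * (n * n * n) ≤ 9 * q * T + 3 * (n * n * n) →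
    T ≤ n * n * k + n * B → q * q * B ≤ n * n → 2 * n < q * k
  max-codegree n q T k B n₀ q₀ h₁ h₂ h₃ with 2 * n <? q * k
  ... | yes p = p
  ... | no ¬p = ⊥-elim (cube-contra n (2 * q) 30 n₀ (≤-trans (s≤s 30≤199) (*-monoʳ-≤ 2 q₀))
    (arith (≮⇒≥ ¬p) (≤-trans (s≤s z≤n) q₀)))
    where
    30≤199 : 30 ≤ 199
    30≤199 = ≤ᵇ⇒≤ 30 199 _
    arith : q * k ≤ 2 * n → 1 ≤ q → 2 * q * (n * n * n) ≤ 30 * (n * n * n)
    arith h₄ h₅ = lin (h₁ ⊕ (9 * q) ⊙ h₂ ⊕ (9 * n * n) ⊙ h₄ ⊕ (9 * n) ⊙ h₃ ⊕ (9 * n * q * B) ⊙ h₅) 0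
      (solve (n ∷ q ∷ T ∷ k ∷ B ∷ []))

  typical-exists : ∀ n q k o j B → 1 ≤ n → 2 * n < q * k → n * n * k ≤ n * n * o + q * j + n * q * B →
    q * q * j ≤ n * n * n → q * q * B ≤ n * n → 1 ≤ o
  typical-exists n q k (suc o) j B n₀ hk h₁ h₂ h₃ = s≤s z≤n
  typical-exists n@(suc n′) q k zero j B n₀ hk h₁ h₂ h₃ = ⊥-elim (<⇒≱ hk
    (*-cancelʳ-≤ (q * k) (2 * n) (n * n) (arith n h₁ h₂ h₃)))
    where
    arith : ∀ n → n * n * k ≤ n * n * 0 + q * j + n * q * B → q * q * j ≤ n * n * n → q * q * B ≤ n * n →
      q * k * (n * n) ≤ 2 * n * (n * n)
    arith n h₁ h₂ h₃ = lin (q ⊙ h₁ ⊕ h₂ ⊕ n ⊙ h₃) 0 (solve (n ∷ q ∷ k ∷ j ∷ B ∷ []))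

  -- 37 = 1 + 9 · 2 · 2: one from the degree condition, the rest from two errors of at most n²/q,
  -- each counted for both coordinates of a pair.
  link-lower : ∀ n q d e D b → 2 * q * (n * n) ≤ 9 * q * d + n * n → d ≤ e + 2 * (D + n * b) →
    q * D ≤ n * n → q * b ≤ n → 2 * q * (n * n) ≤ 9 * q * e + 37 * (n * n)
  link-lower n q d e D b h₁ h₂ h₃ h₄ = lin (h₁ ⊕ (9 * q) ⊙ h₂ ⊕ 18 ⊙ h₃ ⊕ (18 * n) ⊙ h₄) 0
    (solve (n ∷ q ∷ d ∷ e ∷ D ∷ b ∷ []))

  module PartSizes (n q k x r z e : ℕ) (n₀ : 1 ≤ n)
    (h₁ : 2 * q * (n * n) ≤ 9 * q * e + 37 * (n * n))
    (h₂ : q * e ≤ q * (r * x + x * z) + n * n)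
    (h₃ : e ≤ (r + x) * x)
    (x≤k : x ≤ k) (z≤r : z ≤ r) (kxr≤n : k + x + r ≤ n) where

    xxr≤n : 2 * x + r ≤ n
    xxr≤n = lin (x≤k ⊕ kxr≤n) 0 (solve (k ∷ x ∷ r ∷ n ∷ []))

    cancel-n : ∀ a c → a * n ≤ c * n * n → a ≤ c * n
    cancel-n a c h = *-cancelʳ-≤ a (c * n) n {{>-nonZero n₀}} h

    -- Here e ≤ (n - x) x, which falls short of 2n²/9 by s (n + s) / 9, while `h₁` permits a
    -- shortfall of 37n²/(9q) only.
    second-deficit : ∀ s → n ≡ 3 * x + s → q * s ≤ 37 * n
    second-deficit s eq = cancel-n (q * s) 37 (arith n eq h₁ xxr≤n)
      where
      arith : ∀ n → n ≡ 3 * x + s → 2 * q * (n * n) ≤ 9 * q * e + 37 * (n * n) → 2 * x + r ≤ n → q * s * n ≤ 37 * n * n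
      arith .(3 * x + s) refl h₁ h₄ = lin (h₁ ⊕ (9 * q) ⊙ h₃ ⊕ (9 * q * x) ⊙ h₄) (q * s * s)
        (solve (q ∷ x ∷ s ∷ r ∷ e ∷ []))

    -- With z ≤ r ≤ n - 2x and s = 3x - n, the main term 2x (n - 2x) of `h₂` falls short of 2n²/9 by
    -- 2s (n + 2s) / 9. The permitted error is 46 = 37 + 9, and 23 is its half.
    second-excess : ∀ v s → x ≡ v + s → n ≡ 2 * x + v → q * s ≤ 23 * n
    second-excess v s eq eq′ = cancel-n (q * s) 23 (*-cancelˡ-≤ 2 (arith x n eq eq′ h₁ h₂ z≤r xxr≤n))
      where
      arith : ∀ x n → x ≡ v + s → n ≡ 2 * x + v → 2 * q * (n * n) ≤ 9 * q * e + 37 * (n * n) →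
        q * e ≤ q * (r * x + x * z) + n * n → z ≤ r → 2 * x + r ≤ n → 2 * (q * s * n) ≤ 2 * (23 * n * n)
      arith _ _ refl refl h₁ h₂ h₃ h₄ =
        lin (h₁ ⊕ 9 ⊙ h₂ ⊕ (9 * q * (v + s)) ⊙ h₃ ⊕ (18 * q * (v + s)) ⊙ h₄) (4 * q * s * s)
          (solve (q ∷ v ∷ s ∷ r ∷ z ∷ e ∷ []))

    second-lower : q * n ≤ 3 * q * x + 37 * n
    second-lower with ≤-total n (3 * x)
    ... | inj₁ p = lin (q ⊙ p) (37 * n) (solve (q ∷ n ∷ x ∷ []))
    ... | inj₂ p with m≤n⇒∃[o]m+o≡n p
    ...   | s , eq = arith n (sym eq) (second-deficit s (sym eq))
      where
      arith : ∀ n → n ≡ 3 * x + s → q * s ≤ 37 * n → q * n ≤ 3 * q * x + 37 * n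
      arith _ refl h = lin h 0 (solve (q ∷ x ∷ s ∷ []))

    first-lower : q * n ≤ 3 * q * k + 37 * n
    first-lower = lin (second-lower ⊕ (3 * q) ⊙ x≤k) 0 (solve (q ∷ n ∷ x ∷ k ∷ []))

    -- For x at least n/3 the product r x is at most n²/9, and 46 = 37 + 9 would do. For smaller x
    -- it may exceed n²/9 in proportion to the deficit s, at the price of another 37. The 152 of
    -- `third-lower` is 83 + 3 · 23.
    third-product : q * n * n ≤ 9 * q * x * z + 83 * n * n × 3 * q * x ≤ q * n + 23 * n
    third-product with m≤n⇒∃[o]m+o≡n (≤-trans (m≤m+n (2 * x) r) xxr≤n)
    ... | v , eq with ≤-total v x
    ...   | inj₁ p with m≤n⇒∃[o]m+o≡n p
    ...     | s , eq′ = arith x n (sym eq′) (sym eq) h₁ h₂ xxr≤n ,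
                        arith′ x n (sym eq′) (sym eq) (second-excess v s (sym eq′) (sym eq))
      where
      arith : ∀ x n → x ≡ v + s → n ≡ 2 * x + v → 2 * q * (n * n) ≤ 9 * q * e + 37 * (n * n) →
        q * e ≤ q * (r * x + x * z) + n * n → 2 * x + r ≤ n → q * n * n ≤ 9 * q * x * z + 83 * n * n
      arith _ _ refl refl h₁ h₂ h₄ =
        lin (h₁ ⊕ 9 ⊙ h₂ ⊕ (9 * q * (v + s)) ⊙ h₄)
          (4 * q * s * s + 3 * q * s * v + 148 * s * s + 444 * s * v + 333 * v * v)
          (solve (q ∷ v ∷ s ∷ r ∷ z ∷ e ∷ []))
      arith′ : ∀ x n → x ≡ v + s → n ≡ 2 * x + v → q * s ≤ 23 * n → 3 * q * x ≤ q * n + 23 * n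
      arith′ _ _ refl refl h = lin h 0 (solve (q ∷ v ∷ s ∷ []))
    third-product | v , eq | inj₂ p with m≤n⇒∃[o]m+o≡n p
    ...     | s , eq′ = arith v n (sym eq′) (sym eq) h₁ h₂ xxr≤n (second-deficit s (n≡ v n (sym eq′) (sym eq))) ,
                        arith′ v n (sym eq′) (sym eq)
      where
      n≡ : ∀ v n → v ≡ x + s → n ≡ 2 * x + v → n ≡ 3 * x + s
      n≡ _ _ refl refl = solve (x ∷ s ∷ [])
      arith : ∀ v n → v ≡ x + s → n ≡ 2 * x + v → 2 * q * (n * n) ≤ 9 * q * e + 37 * (n * n) →
        q * e ≤ q * (r * x + x * z) + n * n → 2 * x + r ≤ n → q * s ≤ 37 * n → q * n * n ≤ 9 * q * x * z + 83 * n * n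
      arith _ _ refl refl h₁ h₂ h₄ h₅ =
        lin (h₁ ⊕ 9 ⊙ h₂ ⊕ (9 * q * x) ⊙ h₄ ⊕ (2 * x + (x + s)) ⊙ h₅) (2 * q * s * s)
          (solve (q ∷ x ∷ s ∷ r ∷ z ∷ e ∷ []))
      arith′ : ∀ v n → v ≡ x + s → n ≡ 2 * x + v → 3 * q * x ≤ q * n + 23 * n
      arith′ _ _ refl refl = lin (z≤n {0}) (q * s + 23 * (2 * x + (x + s))) (solve (q ∷ x ∷ s ∷ []))

    third-lower : q * n ≤ 3 * q * z + 152 * n
    third-lower = *-cancelʳ-≤ (q * n) (3 * q * z + 152 * n) n {{>-nonZero n₀}}
      (lin (proj₁ third-product ⊕ (3 * z) ⊙ proj₂ third-product ⊕ (69 * n) ⊙ z≤n′) 0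
        (solve (q ∷ n ∷ x ∷ z ∷ [])))
      where
      z≤n′ : z ≤ n
      z≤n′ = ≤-trans z≤r (≤-trans (m≤n+m r (k + x)) kxr≤n)

  amgm-sorted : ∀ {a b c} → a ≤ b → b ≤ c → 27 * (a * b * c) ≤ (a + b + c) * (a + b + c) * (a + b + c)
  amgm-sorted {a} p q with m≤n⇒∃[o]m+o≡n p | m≤n⇒∃[o]m+o≡n q
  ... | u , refl | v , refl =
    lin (z≤n {0}) (9 * a * u * u + 9 * a * u * v + 9 * a * v * v + 8 * u * u * u + 12 * u * u * v + 6 * u * v * v + v * v * v)
      (solve (a ∷ u ∷ v ∷ []))

  permuted : ∀ {a b c d e f} → 27 * (d * e * f) ≤ (d + e + f) * (d + e + f) * (d + e + f) →
    d * e * f ≡ a * b * c → d + e + f ≡ a + b + c → 27 * (a * b * c) ≤ (a + b + c) * (a + b + c) * (a + b + c)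
  permuted h p s = ≤-trans (≤-reflexive (cong (27 *_) (sym p)))
    (≤-trans h (≤-reflexive (cong (λ t → t * t * t) s)))

  amgm : ∀ a b c → 27 * (a * b * c) ≤ (a + b + c) * (a + b + c) * (a + b + c)
  amgm a b c with ≤-total a b | ≤-total b c | ≤-total a c
  ... | inj₁ p | inj₁ q | _      = amgm-sorted p q
  ... | inj₁ p | inj₂ q | inj₁ r = permuted {a} {b} {c} {a} {c} {b} (amgm-sorted r q) (solve (a ∷ b ∷ c ∷ [])) (solve (a ∷ b ∷ c ∷ []))
  ... | inj₁ p | inj₂ q | inj₂ r = permuted {a} {b} {c} {c} {a} {b} (amgm-sorted r p) (solve (a ∷ b ∷ c ∷ [])) (solve (a ∷ b ∷ c ∷ []))
  ... | inj₂ p | inj₁ q | inj₁ r = permuted {a} {b} {c} {b} {a} {c} (amgm-sorted p r) (solve (a ∷ b ∷ c ∷ [])) (solve (a ∷ b ∷ c ∷ []))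
  ... | inj₂ p | inj₁ q | inj₂ r = permuted {a} {b} {c} {b} {c} {a} (amgm-sorted q r) (solve (a ∷ b ∷ c ∷ [])) (solve (a ∷ b ∷ c ∷ []))
  ... | inj₂ p | inj₂ q | _      = permuted {a} {b} {c} {c} {b} {a} (amgm-sorted q p) (solve (a ∷ b ∷ c ∷ [])) (solve (a ∷ b ∷ c ∷ []))

  parts-missing : ∀ n q T F m k x z o j → 1 ≤ n → q * n ≤ 3 * q * k + 37 * n → q * n ≤ 3 * q * x + 37 * n →
    q * n ≤ 3 * q * z + 152 * n → k + x + z + o ≡ n → F + m ≡ k * x * z →
    2 * q * (n * n * n) ≤ 9 * q * T + 3 * (n * n * n) → T ≤ 6 * F + 3 * (n * n) * o + 3 * j → q * j ≤ 3 * (n * n * n) →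
    q * o ≤ 76 * n × q * m ≤ 40 * (n * n * n)
  parts-missing n q T F m k x z o j n₀ hk hx hz hn hF h₁ h₂ h₃ = few-left ,
    *-cancelˡ-≤ 54 (arith (≤-trans (≤-reflexive (cong (27 *_) hF)) (≤-trans (amgm k x z)
      (*-mono-≤ (*-mono-≤ kxz≤n kxz≤n) kxz≤n))) few-left)
    where
    few-left : q * o ≤ 76 * n
    few-left = *-cancelˡ-≤ 3 (lin ((3 * q) ⊙ ≤-reflexive hn ⊕ hk ⊕ hx ⊕ hz) (2 * n) (solve (n ∷ q ∷ k ∷ x ∷ z ∷ o ∷ [])))
    kxz≤n : k + x + z ≤ n
    kxz≤n = ≤-trans (m≤m+n _ o) (≤-reflexive hn)
    arith : 27 * (F + m) ≤ n * n * n → q * o ≤ 76 * n → 54 * (q * m) ≤ 54 * (40 * (n * n * n))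
    arith h₄ h₅ = lin ((2 * q) ⊙ h₄ ⊕ h₁ ⊕ (9 * q) ⊙ h₂ ⊕ (27 * n * n) ⊙ h₅ ⊕ 27 ⊙ h₃) (24 * (n * n * n))
      (solve (n ∷ q ∷ T ∷ F ∷ m ∷ o ∷ j ∷ []))

  collect-cover : ∀ {F f₂ f₃ f₄ f₅ f₆ o₁ o₂ o₃ i₁ i₂ i₃ j₁ j₂ j₃ k₁ k₂ k₃} N c →
    f₂ ≡ F → f₃ ≡ F → f₄ ≡ F → f₅ ≡ F → f₆ ≡ F → o₂ ≡ o₁ → o₃ ≡ o₁ → o₁ ≤ c * N →
    i₂ ≡ i₁ → i₃ ≡ i₁ → j₂ ≡ j₁ → j₃ ≡ j₁ → k₂ ≡ k₁ → k₃ ≡ k₁ →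
    F + (f₂ + (f₃ + (f₄ + (f₅ + (f₆ + (o₁ + (o₂ + (o₃ + (i₁ + (i₂ + (i₃ + (j₁ + (j₂ + (j₃ + (k₁ + (k₂ + (k₃ + 0)))))))))))))))))
      ≤ 6 * F + 3 * N * c + 3 * (i₁ + j₁ + k₁)
  collect-cover {F} {o₁ = o} {i₁ = i} {j₁ = j} {k₁ = k} N c refl refl refl refl refl refl refl h refl refl refl refl refl refl =
    lin (3 ⊙ h) 0 (solve (F ∷ o ∷ i ∷ j ∷ k ∷ N ∷ c ∷ []))

  bad-arith : ∀ n q a b j k → n * n * n * a ≤ q * q * j → n * n * b ≤ q * k →
    n * n * n * (a + b) ≤ q * q * j + q * n * k
  bad-arith n q a b j k h₁ h₂ = lin (h₁ ⊕ n ⊙ h₂) 0 (solve (n ∷ q ∷ a ∷ b ∷ j ∷ k ∷ []))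

  typical-arith : ∀ n q t s a b d β → n * n * a ≤ q * d → n * b ≤ q * β →
    n * n * (t + s * a + b) ≤ n * n * t + q * (s * d) + n * q * β
  typical-arith n q t s a b d β h₁ h₂ = lin (s ⊙ h₁ ⊕ n ⊙ h₂) 0
    (solve (n ∷ q ∷ t ∷ s ∷ a ∷ b ∷ d ∷ β ∷ []))

  link-upper : ∀ n q l s t r p k → l ≤ s + (t + k) → s ≤ r → t ≤ p → q * k ≤ n * n → q * l ≤ q * (r + p) + n * n
  link-upper n q l s t r p k h h₁ h₂ h₃ = lin (q ⊙ h ⊕ q ⊙ h₁ ⊕ q ⊙ h₂ ⊕ h₃) 0
    (solve (n ∷ q ∷ l ∷ s ∷ t ∷ r ∷ p ∷ k ∷ []))

  three-few : ∀ q N a b c → q * a ≤ N → q * b ≤ N → q * c ≤ N → q * (a + b + c) ≤ 3 * N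
  three-few q N a b c h₁ h₂ h₃ = lin (h₁ ⊕ h₂ ⊕ h₃) 0 (solve (q ∷ N ∷ a ∷ b ∷ c ∷ []))

  four-product : ∀ a b → 4 * (a * b) ≤ (a + b) * (a + b)
  four-product a b with ≤-total a b
  ... | inj₁ p with m≤n⇒∃[o]m+o≡n p
  ...   | u , refl = lin (z≤n {0}) (u * u) (solve (a ∷ u ∷ []))
  four-product a b | inj₂ p with m≤n⇒∃[o]m+o≡n p
  ...   | u , refl = lin (z≤n {0}) (u * u) (solve (b ∷ u ∷ []))

  -- The bound n/3 - 152n/(3q) reaches n/4 at q = 608 = 4 · 152.
  quarter : ∀ n q y → 608 ≤ q → q * n ≤ 3 * q * y + 152 * n → n ≤ 4 * y
  quarter n q y q₀ h = *-cancelˡ-≤ (3 * q) {{>-nonZero (*-mono-≤ {1} {3} (s≤s z≤n) (≤-trans (s≤s z≤n) q₀))}}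
    (lin (4 ⊙ h ⊕ n ⊙ q₀) 0 (solve (n ∷ q ∷ y ∷ [])))

  -- 1296 = 16 · 81: both classes have at least n/4 vertices, and 81 = 1 + 2 · 40 collects the
  -- patterns and twice the missing triples.
  inside-arith : ∀ n q l y z p m → 1 ≤ n → 608 ≤ q → y * z * l ≤ p + (n * m + n * m) → q * p ≤ n * (n * (n * (n * 1))) →
    q * m ≤ 40 * (n * n * n) → n ≤ 4 * y → n ≤ 4 * z → q * l ≤ 1296 * (n * n)
  inside-arith n q l y z p m n₀ q₀ h hp hm hy hz = *-cancelʳ-≤ (q * l) (1296 * (n * n)) (n * n)
    {{>-nonZero (*-mono-≤ n₀ n₀)}} (lin ((16 * q) ⊙ h ⊕ 16 ⊙ hp ⊕ (32 * n) ⊙ hm ⊕ (q * l) ⊙ *-mono-≤ hy hz) 0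
      (solve (n ∷ q ∷ l ∷ y ∷ z ∷ p ∷ m ∷ [])))

  scale-down : ∀ h c q a N → c * h ≤ q → q * a ≤ c * N → 1 ≤ c → h * a ≤ N
  scale-down h (suc c) q a N hq ha _ = *-cancelˡ-≤ (suc c) (≤-trans (≤-reflexive (sym (*-assoc (suc c) h a)))
    (≤-trans (*-monoˡ-≤ a hq) ha))

  -- If both counts exceeded n²/400, their product would exceed n⁴/400², against a bound of 41 n⁴/q
  -- with 41 = 1 + 40. This is what drives q into the millions.
  dichotomy : ∀ n q l k p m → 41 * (400 * 400) ≤ q → l * k ≤ p + n * m → q * p ≤ n * (n * (n * (n * 1))) →
    q * m ≤ 40 * (n * n * n) → 400 * l ≤ n * n ⊎ 400 * k ≤ n * n
  dichotomy n q l k p m q₀ h hp hm with 400 * l ≤? n * n | 400 * k ≤? n * n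
  ... | yes a | _ = inj₁ a
  ... | no _ | yes b = inj₂ b
  ... | no a | no b = ⊥-elim (<-irrefl refl (≤-trans (*-mono-< (≰⇒> a) (≰⇒> b)) (≤-trans (≤-reflexive ([m*n]*[o*p]≡[m*o]*[n*p] 400 l 400 k)) small)))
    where
    total≤ : q * (l * k) ≤ 41 * (n * n * (n * n))
    total≤ = lin (q ⊙ h ⊕ hp ⊕ n ⊙ hm) 0 (solve (n ∷ q ∷ l ∷ k ∷ p ∷ m ∷ []))
    small : 400 * 400 * (l * k) ≤ n * n * (n * n)
    small = scale-down (400 * 400) 41 q (l * k) (n * n * (n * n)) q₀ total≤ (s≤s z≤n)

  -- The negligible terms, counted with multiplicity, amount to 8n²/400. The thresholds 400 and 50
  -- are explained by 1/9 - 1/100 - 1/900 = 1/10.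
  type-large : ∀ n q d l a b c e f o → 50 ≤ q → 1 ≤ q → 2 * q * (n * n) ≤ 9 * q * d + n * n →
    d ≤ 2 * l + 2 * (a + b) + (c + e + f) + 2 * (o * n) →
    400 * a ≤ n * n → 400 * b ≤ n * n → 400 * c ≤ n * n → 400 * e ≤ n * n → 400 * f ≤ n * n → 800 * o ≤ n →
    n * n ≤ 10 * l
  type-large n q d l a b c e f o q₀ q₁ h₁ h₂ ha hb hc he hf ho = *-cancelˡ-≤ (720 * q)
    {{>-nonZero (*-mono-≤ {1} {720} (s≤s z≤n) q₁)}}
    (lin (400 ⊙ h₁ ⊕ (9 * q) ⊙ scaled ⊕ (8 * n * n) ⊙ q₀) 0 (solve (n ∷ q ∷ d ∷ l ∷ [])))
    where
    scaled : 400 * d ≤ 800 * l + 8 * (n * n)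
    scaled = lin (400 ⊙ h₂ ⊕ 2 ⊙ ha ⊕ 2 ⊙ hb ⊕ hc ⊕ he ⊕ hf ⊕ n ⊙ ho) 0
      (solve (n ∷ d ∷ l ∷ a ∷ b ∷ c ∷ e ∷ f ∷ o ∷ []))

  -- Two sets of at least n²/10 pairs inside a product of size at most (3n/8)² = 9n²/64 share a
  -- positive proportion of n² pairs. But a shared pair forms, with each of at least n/4 vertices d,
  -- a forbidden pattern or a missing triple, and both are rare.
  common-contra : ∀ n q l k a b d C p m → 1 ≤ n → 16400 ≤ q → n * n ≤ 10 * l → n * n ≤ 10 * k → l + k ≤ a * b + C →
    C * d ≤ p + m → q * p ≤ n * (n * (n * 1)) → q * m ≤ 40 * (n * n * n) → n ≤ 4 * d → a + b + d ≤ n → ⊥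
  common-contra n q l k a b d C p m n₀ q₀ hl hk h hC hp hm hd hs = square-contra n 128 97 n₀ (≤ᵇ⇒≤ 98 128 _)
    (lin (64 ⊙ hl ⊕ 64 ⊙ hk ⊕ 640 ⊙ h ⊕ 10 ⊙ product ⊕ 7 ⊙ C-small) (60 * C) (solve (n ∷ l ∷ k ∷ a ∷ b ∷ C ∷ [])))
    where
    C-large : q * C * n ≤ 164 * (n * n) * n
    C-large = lin ((4 * q) ⊙ hC ⊕ 4 ⊙ hp ⊕ 4 ⊙ hm ⊕ (q * C) ⊙ hd) 0 (solve (n ∷ q ∷ C ∷ d ∷ p ∷ m ∷ []))
    C-small : 100 * C ≤ n * n
    C-small = scale-down 100 164 q C (n * n) q₀ (*-cancelʳ-≤ (q * C) (164 * (n * n)) n {{>-nonZero n₀}} C-large) (s≤s z≤n)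
    ab : 4 * (a + b) ≤ 3 * n
    ab = lin (4 ⊙ hs ⊕ hd) 0 (solve (n ∷ a ∷ b ∷ d ∷ []))
    product : 64 * (a * b) ≤ 9 * (n * n)
    product = lin (16 ⊙ four-product a b ⊕ *-mono-≤ ab ab) 0 (solve (n ∷ a ∷ b ∷ []))

  collect-pairs : ∀ {l l′ a a′ b b′ c d e o o′} N → l′ ≡ l → a′ ≡ a → b′ ≡ b → o′ ≡ o → o ≤ N →
    l + (l′ + (a + (a′ + (b + (b′ + (c + (d + (e + (o + (o′ + 0)))))))))) ≤ 2 * l + 2 * (a + b) + (c + d + e) + 2 * N
  collect-pairs {l} {a = a} {b = b} {c = c} {d} {e} {o} N refl refl refl refl h =
    lin (2 ⊙ h) 0 (solve (l ∷ a ∷ b ∷ c ∷ d ∷ e ∷ o ∷ N ∷ []))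

  collect-six : ∀ e {b c d f g} → b ≡ e → c ≡ e → d ≡ e → f ≡ e → g ≡ e → e + b + c + d + f + g ≡ 6 * e
  collect-six e refl refl refl refl refl = solve (e ∷ [])

  regroup : ∀ d a b → d + (a + a + b) ≡ d + 2 * a + b
  regroup d a b = solve (d ∷ a ∷ b ∷ [])

  -- Four times the product is at most (a + b)² = 4ab + (a - b)², and the last square is 0 or 1; in
  -- the odd case integrality removes the 1.
  product-by-sum : ∀ y z a b → y + z ≤ a + b → b ≤ a → a ≤ suc b → y * z ≤ a * b
  product-by-sum y z a b h p q with m≤n⇒∃[o]m+o≡n p
  ... | zero , refl = *-cancelˡ-≤ 4 (≤-trans (≤-trans (four-product y z) (*-mono-≤ h h)) (≤-reflexive (solve (b ∷ []))))
  ... | suc zero , refl = odd (≤-trans (≤-trans (four-product y z) (*-mono-≤ h h)) (≤-reflexive (solve (b ∷ []))))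
    where
    odd : 4 * (y * z) ≤ 4 * ((b + 1) * b) + 1 → y * z ≤ (b + 1) * b
    odd h with y * z ≤? (b + 1) * b
    ... | yes r = r
    ... | no ¬r = ⊥-elim (<-irrefl refl (≤-trans (≤-trans (≤-reflexive (+-comm 2 _)) (+-monoʳ-≤ (4 * ((b + 1) * b)) (s≤s (s≤s (z≤n {2})))))
      (≤-trans (≤-reflexive (trans (+-comm _ 4) (sym (*-suc 4 ((b + 1) * b))))) (≤-trans (*-monoʳ-≤ 4 (≰⇒> ¬r)) h′))))
      where
      h′ : 4 * (y * z) ≤ suc (4 * ((b + 1) * b))
      h′ = ≤-trans h (≤-reflexive (+-comm _ 1))
  ... | suc (suc u) , refl = ⊥-elim (<-irrefl refl (≤-trans (s≤s (s≤s (m≤m+n b u))) (≤-trans (≤-reflexive eq) q)))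
    where
    eq : suc (suc (b + u)) ≡ b + suc (suc u)
    eq = solve (b ∷ u ∷ [])

  balanced-increment : ∀ n a b c → a + b + c ≡ n → b ≤ a → c ≤ b → a ≤ suc c → n ≤ 3 * a × n ≤ 3 * b + 1 × n ≤ 3 * c + 2
  balanced-increment n a b c refl p q r =
    lin (p ⊕ ≤-trans q p) 0 (solve (a ∷ b ∷ c ∷ [])) ,
    lin (r ⊕ q ⊕ q) 0 (solve (a ∷ b ∷ c ∷ [])) ,
    lin (r ⊕ ≤-trans p r) 0 (solve (a ∷ b ∷ c ∷ []))

  P-arith : ∀ a b c → suc c * a * b ≡ a * b * c + a * b
  P-arith a b c = solve (a ∷ b ∷ c ∷ [])

  peel : ∀ x y z → suc x * y * z ≡ x * y * z + y * z
  peel x y z = solve (x ∷ y ∷ z ∷ [])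

  largest-arith : ∀ s c x y z → x + y + z ≤ s + c → s < y + z → suc x ≤ c
  largest-arith s c x y z h p = lin (h ⊕ p) 0 (solve (s ∷ c ∷ x ∷ y ∷ z ∷ []))

  increment-arith : ∀ p a b d → d ≤ 3 * a → d ≤ 3 * b → 9 * (6 * p) + 6 * (d * d) ≤ 9 * (6 * (p + a * b))
  increment-arith p a b d ha hb = lin (6 ⊙ *-mono-≤ ha hb) 0 (solve (p ∷ a ∷ b ∷ d ∷ []))

  step-arith : ∀ g h i a b → 9 * g + 6 * i ≤ 9 * h → a ≤ b → 9 * (g + 3 * a) + 6 * i ≤ 9 * (h + 3 * b)
  step-arith g h i a b p q = lin (p ⊕ 27 ⊙ q) 0 (solve (g ∷ h ∷ i ∷ a ∷ b ∷ []))

  cube-arith : ∀ a b c → 6 * (3 * a * (3 * b) * (3 * c)) ≡ 27 * (6 * (a * b * c))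
  cube-arith a b c = solve (a ∷ b ∷ c ∷ [])

  cubes-arith : ∀ n → 6 * (suc n * suc n * suc n) ≤ 6 * (n * n * n) + 27 * (3 * (suc (suc n) * suc n))
  cubes-arith n = lin (z≤n {0}) (63 * n * n + 225 * n + 156) (solve (n ∷ []))

  delete-arith : ∀ d t → d + (d + (d + t)) ≡ t + 3 * d
  delete-arith d t = solve (d ∷ t ∷ [])

  -- The extremal count grows by about 2n²/3 per vertex, and three times a low degree stays n²/(6q)
  -- below that. For n ≥ 8q (s + 1) this margin absorbs the shift from n to r = n - s and still
  -- leaves at least one.
  low-increment : ∀ q d n r s gp gs → 1 ≤ q → 1 ≤ n → n ≡ r + s → 8 * q * (s + 1) ≤ n → 18 * q * d + n * n ≤ 4 * q * (n * n) →
    9 * gp + 6 * (r * r) ≤ 9 * gs → gp + 3 * d + 1 ≤ gs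
  low-increment q d n r s gp gs q₀ n₀ eq hn h hg = *-cancelˡ-≤ 9 (lin (hg ⊕ small) 0 (solve (d ∷ r ∷ gp ∷ gs ∷ [])))
    where
    scaled : ∀ n → n ≡ r + s → 1 ≤ n → 8 * q * (s + 1) ≤ n → 18 * q * d + n * n ≤ 4 * q * (n * n) →
      2 * q * (27 * d + 9) ≤ 2 * q * (6 * (r * r))
    scaled _ refl n₀ hn h = lin (3 ⊙ h ⊕ (3 * (r + s)) ⊙ hn ⊕ (24 * q) ⊙ n₀) (6 * q + 12 * q * s * s)
      (solve (q ∷ d ∷ r ∷ s ∷ []))
    small : 27 * d + 9 ≤ 6 * (r * r)
    small = *-cancelˡ-≤ (2 * q) {{>-nonZero (*-mono-≤ {1} {2} (s≤s z≤n) q₀)}} (scaled n eq n₀ hn h)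

  -- A product i y of nearly 2n²/9 with i + y ≤ n forces y ≤ (2/3 + 1/(3q)) n, and d is at most
  -- y²/2. The 5 comes from (2q + 1)² ≤ 4q² + 5q.
  max-degree-arith : ∀ n q i y d → 1 ≤ n → 1 ≤ q → i + y ≤ n → 2 * q * (n * n) ≤ 9 * q * (i * y) + n * n → 2 * d ≤ y * y →
    18 * q * d ≤ (4 * q + 5) * (n * n)
  max-degree-arith n q i y d n₀ q₀ hi h hd = *-cancelˡ-≤ q {{>-nonZero q₀}}
    (lin ((9 * q * q) ⊙ hd ⊕ *-mono-≤ y-small y-small ⊕ (n * n) ⊙ q₀) 0 (solve (n ∷ q ∷ y ∷ d ∷ [])))
    where
    excess : ∀ v s n y → n ≡ 3 * v + s → y ≡ 2 * v + s → 1 ≤ n → i + y ≤ n → 2 * q * (n * n) ≤ 9 * q * (i * y) + n * n → q * s ≤ n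
    excess v s n y refl refl n₀ hi h = *-cancelʳ-≤ (q * s) n n {{>-nonZero n₀}}
      (lin (h ⊕ (9 * q * y) ⊙ hi) (q * s * s) (solve (q ∷ v ∷ s ∷ i ∷ [])))
    y-small : 3 * q * y ≤ (2 * q + 1) * n
    y-small with m≤n⇒∃[o]m+o≡n (≤-trans (m≤n+m y i) hi)
    ... | v , eq with ≤-total (2 * v) y
    ...   | inj₁ p with m≤n⇒∃[o]m+o≡n p
    ...     | s , eq′ = finish n y (n≡ n y (sym eq) (sym eq′)) (sym eq′) (excess v s n y (n≡ n y (sym eq) (sym eq′)) (sym eq′) n₀ hi h)
      where
      n≡ : ∀ n y → n ≡ y + v → y ≡ 2 * v + s → n ≡ 3 * v + s
      n≡ _ _ refl refl = solve (v ∷ s ∷ [])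
      finish : ∀ n y → n ≡ 3 * v + s → y ≡ 2 * v + s → q * s ≤ n → 3 * q * y ≤ (2 * q + 1) * n
      finish _ _ refl refl h = lin h 0 (solve (q ∷ v ∷ s ∷ []))
    y-small | v , eq | inj₂ p = finish n (sym eq)
      where
      finish : ∀ n → n ≡ y + v → 3 * q * y ≤ (2 * q + 1) * n
      finish _ refl = lin (q ⊙ p) (y + v) (solve (q ∷ v ∷ y ∷ []))

  two-degrees : ∀ n q du dw i y → 2 * q * (n * n) ≤ 9 * q * du + n * n → 2 * q * (n * n) ≤ 9 * q * dw + n * n → du + dw ≤ 2 * (i * y) →
    2 * q * (n * n) ≤ 9 * q * (i * y) + n * n
  two-degrees n q du dw i y h₁ h₂ h = *-cancelˡ-≤ 2 (lin (h₁ ⊕ h₂ ⊕ (9 * q) ⊙ h) 0 (solve (n ∷ q ∷ du ∷ dw ∷ i ∷ y ∷ [])))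

  double-product : ∀ d a b → d ≤ 2 * (a * b) → 2 * d ≤ (a + b) * (a + b)
  double-product d a b h = lin (2 ⊙ h ⊕ four-product a b) 0 (solve (d ∷ a ∷ b ∷ []))

  -- The first-order loss 2x n²/3 in 2r³/9 cancels against the main term of 3D, so T is at most
  -- 2n³/9 + x n²/q + O(x² n). The lower bound for g′ is about 2n³/9 + n²: one vertex of T brings
  -- 3n², and 2n² go with the passage to u = n - 3. Since x + 1 ≤ q a margin n²/q remains, and n ≥
  -- 40q³ makes it dominate the lower-order terms.
  final-arith : ∀ q T D a n r x u g′ → r + x ≡ n → n ≡ u + 3 → 3 ≤ r → T ≤ 6 * a + 3 * D → 27 * a ≤ r * r * r →
    18 * q * D ≤ x * ((4 * q + 6) * (n * n)) → 6 * (u * u * u) + 81 * ((u + 2) * (u + 1)) ≤ 27 * g′ →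
    40 * (q * q * q) ≤ n → x + 1 ≤ q → 4 * q ≤ n → T ≤ g′
  final-arith q T D a n r x u g′ eq eq′ r₀ h₁ h₂ h₃ h₄ hn hx hq with m≤n⇒∃[o]m+o≡n r₀
  ... | w , refl = *-cancelˡ-≤ (486 * q) {{>-nonZero (*-mono-≤ {1} {486} (s≤s z≤n) (≤-trans (m≤n+m 1 x) hx))}}
    (scaled n u (trans (sym eq) rearranged) (u≡ (trans eq eq′)) h₃ h₄ hn hq)
    where
    rearranged : 3 + w + x ≡ w + x + 3
    rearranged = solve (w ∷ x ∷ [])
    u≡ : 3 + w + x ≡ u + 3 → u ≡ w + x
    u≡ e = sym (+-cancelʳ-≡ 3 (w + x) u (trans (sym rearranged) e))
    xx : x * x ≤ q * q
    xx = *-mono-≤ (≤-trans (m≤m+n x 1) hx) (≤-trans (m≤m+n x 1) hx)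
    scaled : ∀ n u → n ≡ w + x + 3 → u ≡ w + x → 18 * q * D ≤ x * ((4 * q + 6) * (n * n)) →
      6 * (u * u * u) + 81 * ((u + 2) * (u + 1)) ≤ 27 * g′ → 40 * (q * q * q) ≤ n → 4 * q ≤ n → 486 * q * T ≤ 486 * q * g′
    scaled _ _ refl refl h₃ h₄ hn hq = lin
      ((486 * q) ⊙ h₁ ⊕ (108 * q) ⊙ h₂ ⊕ 81 ⊙ h₃ ⊕ (18 * q) ⊙ h₄ ⊕ (9 * (w + x + 3)) ⊙ hn ⊕ (324 * q * (w + x + 3)) ⊙ xx
        ⊕ (486 * (w + x + 3) * (w + x + 3)) ⊙ hx ⊕ (400 * (w + x + 3)) ⊙ hq)
      (693 + 426 * q + 108 * q * q * q + 36 * q * q * q * (w + x) + 142 * q * (w + x) + 108 * q * x * x * x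
        + 462 * (w + x) + 77 * (w + x) * (w + x))
      (solve (q ∷ T ∷ D ∷ a ∷ w ∷ x ∷ g′ ∷ []))

  isolated-degree : ∀ n q d e x c → c ≤ 2 * (n * x) → d ≤ e + c → 36 * q * x ≤ n → 4 * q * (n * n) ≤ 18 * q * d + n * n →
    2 * q * (n * n) ≤ 9 * q * e + n * n
  isolated-degree n q d e x c hc h hx h₁ = *-cancelˡ-≤ 2 (lin (h₁ ⊕ (18 * q) ⊙ h ⊕ (18 * q) ⊙ hc ⊕ n ⊙ hx) 0
    (solve (n ∷ q ∷ d ∷ e ∷ x ∷ c ∷ [])))

  degree-back : ∀ n q d e x c → c ≤ 2 * (n * x) → d ≤ e + c → 36 * q * x ≤ n → 18 * q * e ≤ (4 * q + 5) * (n * n) →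
    18 * q * d ≤ (4 * q + 6) * (n * n)
  degree-back n q d e x c hc h hx h₁ = lin (h₁ ⊕ (18 * q) ⊙ h ⊕ (18 * q) ⊙ hc ⊕ n ⊙ hx) 0
    (solve (n ∷ q ∷ d ∷ e ∷ x ∷ c ∷ []))

  six-boxes : ∀ a b c → a * (b * c) + (a * (c * b) + (b * (a * c) + (b * (c * a) + (c * (a * b) + c * (b * a))))) ≡ 6 * (a * b * c)
  six-boxes a b c = solve (a ∷ b ∷ c ∷ [])

  collect-six′ : ∀ e {b c d f g} → b ≡ e → c ≡ e → d ≡ e → f ≡ e → g ≡ e → e + (b + (c + (d + (f + (g + 0))))) ≡ 6 * e
  collect-six′ e refl refl refl refl refl = solve (e ∷ [])

  double : ∀ a b → a * b + b * a ≡ 2 * (a * b)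
  double a b = solve (a ∷ b ∷ [])

  pair-arith₁ : ∀ a b c → 2 * (c * a) + 2 * (a * b) ≤ 2 * (a * (b + c))
  pair-arith₁ a b c = ≤-reflexive (solve (a ∷ b ∷ c ∷ []))

  pair-arith₂ : ∀ a b c → 2 * (a * b) + 2 * (c * a) ≤ 2 * (a * (b + c))
  pair-arith₂ a b c = ≤-reflexive (solve (a ∷ b ∷ c ∷ []))

  few-arith : ∀ q x t → x ≤ q → 1 ≤ q → 36 * q * x ≤ 40 * (q * q * q) * (t + 3)
  few-arith q x t h q₀ = lin ((36 * q) ⊙ h ⊕ (36 * q * q) ⊙ q₀) (4 * (q * q * q) + 40 * (q * q * q) * (t + 2))
    (solve (q ∷ x ∷ t ∷ []))

  cubes-arith′ : ∀ c t → 40 * c ≤ 40 * c * (t + 3)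
  cubes-arith′ c t = lin (z≤n {0}) (40 * c * (t + 2)) (solve (c ∷ t ∷ []))

  linear-arith : ∀ q → 1 ≤ q → 4 * q + 4 ≤ 40 * (q * q * q)
  linear-arith q h = lin ((8 * q * q) ⊙ h ⊕ (8 * q) ⊙ h ⊕ 4 ⊙ h) (32 * (q * q * q)) (solve (q ∷ []))

  weighted-arith : ∀ c a d k → c * d ≤ k → c * (a * d) ≤ a * k
  weighted-arith c a d k h = lin (a ⊙ h) 0 (solve (c ∷ a ∷ d ∷ k ∷ []))

  shift-arith : ∀ u → suc (2 + u) ≡ u + 3
  shift-arith u = solve (u ∷ [])

  three-arith : ∀ x q → x + 1 ≤ q → 3 + x ≤ 4 * q + 4
  three-arith x q h = lin h (3 * q + 2) (solve (x ∷ q ∷ []))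

  bound-arith : ∀ u h → 6 * (u * u * u) ≤ 27 * h → 6 * (u * u * u) + 81 * ((u + 2) * (u + 1)) ≤ 27 * (h + 3 * (suc (suc u) * suc u))
  bound-arith u h p = lin p 0 (solve (u ∷ h ∷ []))

  -- The surplus 1 in the second hypothesis pays for the drop of the truncated gap by one; once the
  -- gap is zero there is nothing to pay.
  gap-arith : ∀ τ a c d δ b → τ ≤ a + (c ∸ d) → a + 3 * δ + 1 ≤ b → τ + 3 * δ ≤ b + (c ∸ suc d)
  gap-arith τ a c d δ b h₁ h₂ = ≤-trans step (+-monoʳ-≤ b (≤-reflexive (sym pred≡)))
    where
    e : ℕ
    e = c ∸ d
    pred≡ : c ∸ suc d ≡ e ∸ 1
    pred≡ = trans (cong (c ∸_) (+-comm 1 d)) (sym (∸-+-assoc c d 1))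
    step : τ + 3 * δ ≤ b + (e ∸ 1)
    step = close e h₁
      where
      close : ∀ e → τ ≤ a + e → τ + 3 * δ ≤ b + (e ∸ 1)
      close zero h₁ = none h₁
        where
        none : τ ≤ a + 0 → τ + 3 * δ ≤ b + 0
        none h₁ = lin (h₁ ⊕ h₂) 1 (solve (τ ∷ a ∷ δ ∷ b ∷ []))
      close (suc e) h₁ = some h₁
        where
        some : τ ≤ a + suc e → τ + 3 * δ ≤ b + e
        some h₁ = lin (h₁ ⊕ h₂) 0 (solve (τ ∷ a ∷ δ ∷ b ∷ e ∷ []))

  big-arith : ∀ q t → 1 ≤ q → 8 * q * (t + 2 + 1) ≤ 40 * (q * q * q) * (t + 3)
  big-arith q t h = lin ((8 * (t + 3) * q * q) ⊙ h ⊕ (8 * (t + 3) * q) ⊙ h) (32 * (q * q * q) * (t + 3)) (solve (q ∷ t ∷ []))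

  t-arith : ∀ q t → 1 ≤ q → t + 2 ≤ 40 * (q * q * q) * (t + 3)
  t-arith q t h = lin (((t + 3) * q * q) ⊙ h ⊕ ((t + 3) * q) ⊙ h ⊕ (t + 3) ⊙ h) (39 * (q * q * q) * (t + 3) + 1) (solve (q ∷ t ∷ []))

-- Supersaturation: a dense relation contains large complete boxes.

module Blowups where
  open import Data.Nat using (NonZero; >-nonZero)
  open import Data.Nat.Properties
  open import Data.List using (List; []; _∷_; _++_; map; length; filter; take; tabulate; allFin)
  open import Data.List.Properties using (length-++; length-map; length-take)
  open import Data.List.Membership.Propositional using (_∈_)
  open import Data.List.Membership.Propositional.Properties using (∈-++⁻; ∈-map⁻)
  open import Data.List.Relation.Unary.Any using (here; there)
  open import Data.List.Relation.Unary.All as LAll using ([]; _∷_)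
  open import Data.List.Relation.Unary.All.Properties using (all-filter) renaming (take⁺ to All-take⁺)
  open import Data.List.Relation.Unary.AllPairs using ([]; _∷_)
  import Data.List.Relation.Unary.Unique.Propositional as LUnique
  open import Data.List.Relation.Unary.Unique.Propositional.Properties using (take⁺; allFin⁺; filter⁺)
  open import Data.Vec using (Vec; []; _∷_; lookup)
  open import Data.Vec.Relation.Unary.All as VAll using ([]; _∷_)
  open import Data.Vec.Relation.Unary.AllPairs as VPairs using ([]; _∷_)
  import Data.Vec.Relation.Unary.Unique.Propositional as VUnique
  open import Data.Vec.Relation.Unary.Unique.Propositional.Properties using (lookup-injective)
  open import Function.Definitions using (Injective)
  open import Relation.Unary using (Decidable)
  open Certificates
  open Estimates
  open Sums

  lsum : ∀ {A : Set} → (A → ℕ) → List A → ℕ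
  lsum f [] = 0
  lsum f (x ∷ xs) = f x + lsum f xs

  lsum-++ : ∀ {A : Set} (f : A → ℕ) xs ys → lsum f (xs ++ ys) ≡ lsum f xs + lsum f ys
  lsum-++ f [] ys = refl
  lsum-++ f (x ∷ xs) ys = trans (cong (f x +_) (lsum-++ f xs ys)) (sym (+-assoc (f x) _ _))

  lsum-map : ∀ {A B : Set} (f : B → ℕ) (g : A → B) xs → lsum f (map g xs) ≡ lsum (f ∘ g) xs
  lsum-map f g [] = refl
  lsum-map f g (x ∷ xs) = cong (f (g x) +_) (lsum-map f g xs)

  lsum-largest : ∀ {A : Set} (f : A → ℕ) x xs →
                 ∃[ y ] (y ∈ x ∷ xs × lsum f (x ∷ xs) ≤ length (x ∷ xs) * f y)
  lsum-largest f x [] = x , here refl , ≤-refl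
  lsum-largest f x (z ∷ zs) = compare (lsum-largest f z zs)
    where
    compare : (∃[ y ] (y ∈ z ∷ zs × lsum f (z ∷ zs) ≤ length (z ∷ zs) * f y)) → _
    compare (y , y∈ , q) with f x ≤? f y
    ... | yes r = y , there y∈ , (r ⊕ q)
    ... | no ¬r = x , here refl , +-monoʳ-≤ (f x) (≤-trans q (*-monoʳ-≤ (length (z ∷ zs)) (<⇒≤ (≰⇒> ¬r))))

  lsum-pigeonhole : ∀ {A : Set} (f : A → ℕ) xs → 1 ≤ lsum f xs →
                    ∃[ x ] (x ∈ xs × lsum f xs ≤ length xs * f x)
  lsum-pigeonhole f (x ∷ xs) h = lsum-largest f x xs

  choose : ∀ {A : Set} M → List A → List (Vec A M)
  choose zero xs = [] ∷ []
  choose (suc M) [] = []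
  choose (suc M) (x ∷ xs) = map (x ∷_) (choose M xs) ++ choose (suc M) xs

  length-choose : ∀ {A : Set} M (xs : List A) → length (choose M xs) ≤ 2 ^ length xs
  length-choose zero xs = >-nonZero⁻¹ (2 ^ length xs)
    where
    open import Data.Nat using (>-nonZero⁻¹)
    instance _ = m^n≢0 2 (length xs)
  length-choose (suc M) [] = z≤n
  length-choose (suc M) (x ∷ xs) = ≤-trans
    (≤-reflexive (trans (length-++ (map (x ∷_) (choose M xs)))
                        (cong (_+ length (choose (suc M) xs)) (length-map (x ∷_) (choose M xs)))))
    (≤-trans (length-choose M xs ⊕ length-choose (suc M) xs)
             (≤-reflexive (cong (2 ^ length xs +_) (sym (+-identityʳ (2 ^ length xs))))))

  choose-All : ∀ {A : Set} {P : A → Set} M {xs} → LAll.All P xs → ∀ {s} → s ∈ choose M xs → VAll.All P s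
  choose-All zero ps (here refl) = []
  choose-All (suc M) {x ∷ xs} (p ∷ ps) s∈ with ∈-++⁻ (map (x ∷_) (choose M xs)) s∈
  ... | inj₂ s∈′ = choose-All (suc M) ps s∈′
  ... | inj₁ s∈′ with ∈-map⁻ (x ∷_) s∈′
  ...   | t , t∈ , refl = p ∷ choose-All M ps t∈

  choose-Unique : ∀ {A : Set} M {xs : List A} → LUnique.Unique xs → ∀ {s} → s ∈ choose M xs → VUnique.Unique s
  choose-Unique zero us (here refl) = []
  choose-Unique (suc M) {x ∷ xs} (u ∷ us) s∈ with ∈-++⁻ (map (x ∷_) (choose M xs)) s∈
  ... | inj₂ s∈′ = choose-Unique (suc M) us s∈′
  ... | inj₁ s∈′ with ∈-map⁻ (x ∷_) s∈′
  ...   | t , t∈ , refl = choose-All M u t∈ ∷ choose-Unique M us t∈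

  allV : ∀ {A : Set} {M} → (A → Bool) → Vec A M → Bool
  allV P [] = true
  allV P (x ∷ s) = P x ∧ allV P s

  allV-lookup : ∀ {A : Set} {M} (P : A → Bool) (s : Vec A M) → allV P s ≡ true → ∀ i → P (lookup s i) ≡ true
  allV-lookup P (x ∷ s) h zero = ∧-left h
  allV-lookup P (x ∷ s) h (suc i) = allV-lookup P s (∧-right {P x} h) i

  full : ∀ {A : Set} M (P : A → Bool) → List A → ℕ
  full M P xs = lsum (λ s → ⟦ allV P s ⟧) (choose M xs)

  full-positive : ∀ {A : Set} M (P : A → Bool) xs → M ≤ lsum (⟦_⟧ ∘ P) xs → 1 ≤ full M P xs
  full-positive zero P xs h = s≤s z≤n
  full-positive (suc M) P (x ∷ xs) h
    rewrite lsum-++ (λ s → ⟦ allV P s ⟧) (map (x ∷_) (choose M xs)) (choose (suc M) xs)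
          | lsum-map (λ s → ⟦ allV P s ⟧) (x ∷_) (choose M xs)
    with P x
  ... | true = ≤-trans (full-positive M P xs (≤-pred h)) (m≤m+n _ _)
    where open import Data.Nat.Properties using (≤-pred)
  ... | false = ≤-trans (full-positive (suc M) P xs h) (m≤n+m _ _)

  count≤length : ∀ {A : Set} (P : A → Bool) xs → lsum (⟦_⟧ ∘ P) xs ≤ length xs
  count≤length P [] = z≤n
  count≤length P (x ∷ xs) = ⟦⟧≤1 (P x) ⊕ count≤length P xs

  -- A crude substitute for a binomial coefficient: as soon as M entries satisfy P there is a full
  -- M-subset, and the length of the list bounds the count anyway.
  count≤full : ∀ {A : Set} M (P : A → Bool) xs → lsum (⟦_⟧ ∘ P) xs ≤ M + length xs * full M P xs
  count≤full M P xs with M ≤? lsum (⟦_⟧ ∘ P) xs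
  ... | no ¬p = ≤-trans (<⇒≤ (≰⇒> ¬p)) (m≤m+n M _)
  ... | yes p = ≤-trans (count≤length P xs) (≤-trans
    (≤-trans (≤-reflexive (sym (*-identityʳ (length xs)))) (*-monoʳ-≤ (length xs) (full-positive M P xs p)))
    (m≤n+m _ M))

  length-filter-tabulate : ∀ {A : Set} {P : A → Set} (P? : Decidable P) {n} (f : Fin n → A) →
                           length (filter P? (tabulate f)) ≡ ∑[ i ] ⟦ does (P? (f i)) ⟧
  length-filter-tabulate P? {zero} f = sym (∑-zero _)
  length-filter-tabulate P? {suc n} f = trans head (sym (∑-suc (λ i → ⟦ does (P? (f i)) ⟧)))
    where
    head : length (filter P? (tabulate f)) ≡ ⟦ does (P? (f zero)) ⟧ + ∑[ i ] ⟦ does (P? (f (suc i))) ⟧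
    head with P? (f zero)
    ... | yes p = cong suc (length-filter-tabulate P? (f ∘ suc))
    ... | no ¬p = length-filter-tabulate P? (f ∘ suc)

  Cnt : ∀ {n} k → (Vec (Fin n) k → ℕ) → ℕ
  Cnt zero f = f []
  Cnt (suc k) f = ∑[ x ] Cnt k (λ v → f (x ∷ v))

  Cnt-mono : ∀ {n} k {f g : Vec (Fin n) k → ℕ} → (∀ v → f v ≤ g v) → Cnt k f ≤ Cnt k g
  Cnt-mono zero h = h []
  Cnt-mono (suc k) h = ∑-mono (λ x → Cnt-mono k (λ v → h (x ∷ v)))

  Cnt-+ : ∀ {n} k (f g : Vec (Fin n) k → ℕ) → Cnt k (λ v → f v + g v) ≡ Cnt k f + Cnt k g
  Cnt-+ zero f g = refl
  Cnt-+ (suc k) f g = trans (∑-cong (λ x → Cnt-+ k (λ v → f (x ∷ v)) (λ v → g (x ∷ v))))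
                            (∑-+ (λ x → Cnt k (λ v → f (x ∷ v))) (λ x → Cnt k (λ v → g (x ∷ v))))

  Cnt-*ˡ : ∀ {n} k c (f : Vec (Fin n) k → ℕ) → Cnt k (λ v → c * f v) ≡ c * Cnt k f
  Cnt-*ˡ zero c f = refl
  Cnt-*ˡ (suc k) c f = trans (∑-cong (λ x → Cnt-*ˡ k c (λ v → f (x ∷ v))))
                             (∑-*ˡ c (λ x → Cnt k (λ v → f (x ∷ v))))

  Cnt-const : ∀ n k c → Cnt {n} k (λ _ → c) ≡ n ^ k * c
  Cnt-const n zero c = sym (+-identityʳ c)
  Cnt-const n (suc k) c = trans (∑-cong {n} (λ _ → Cnt-const n k c))
                                (trans (∑-const n (n ^ k * c)) (sym (*-assoc n (n ^ k) c)))

  Cnt-lsum : ∀ {A : Set} {n} k (f : A → Vec (Fin n) k → ℕ) xs →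
             Cnt k (λ v → lsum (λ a → f a v) xs) ≡ lsum (λ a → Cnt k (f a)) xs
  Cnt-lsum {n = n} k f [] = trans (Cnt-const n k 0) (*-zeroʳ (n ^ k))
  Cnt-lsum k f (x ∷ xs) = trans (Cnt-+ k (f x) (λ v → lsum (λ a → f a v) xs))
                                (cong (Cnt k (f x) +_) (Cnt-lsum k f xs))

  -- The complete k-partite pattern with M vertices in each part. Each family is injective, but
  -- families of different coordinates may overlap.
  Box : ∀ {n} k → ℕ → (Vec (Fin n) k → Set) → Set
  Box zero M P = P []
  Box {n} (suc k) M P = Σ (Fin M → Fin n) λ s → Injective _≡_ _≡_ s × Box k M (λ v → ∀ i → P (s i ∷ v))

  Box-map : ∀ {n} k {M} {P Q : Vec (Fin n) k → Set} → (∀ v → P v → Q v) → Box k M P → Box k M Q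
  Box-map zero h p = h [] p
  Box-map (suc k) h (s , inj , b) = s , inj , Box-map k (λ v p i → h (s i ∷ v) (p i)) b

  -- Sampled vertices have relative degree at least 1/(2q), so 4qM of them hit an average tuple at
  -- least 2M times, twice what `count≤full` writes off.
  sample : ℕ → ℕ → ℕ
  sample M q = 4 * q * M

  -- Erdős' argument: a constant number `sample M q` of vertices of large degree
  -- is kept, and the pigeonhole principle over its M-element subsets leaves a
  -- dense relation of smaller arity.
  blowupBound : ℕ → ℕ → ℕ → ℕ
  blowupBound zero M q = 0
  blowupBound (suc k) M q = suc (2 * q * sample M q + blowupBound k M (4 * q * 2 ^ sample M q))

  private
    factor-positive : ∀ c {a b} → 1 ≤ a → a ≤ c * b → 1 ≤ b
    factor-positive c {b = suc b} _ _ = s≤s z≤n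
    factor-positive c {b = zero} p h = ⊥-elim (<-irrefl refl (≤-trans p (≤-trans h (≤-reflexive (*-zeroʳ c)))))

  module _ {n k : ℕ} (M q : ℕ) (R : Vec (Fin n) (suc k) → Bool) where
    private
      deg : Fin n → ℕ
      deg x = Cnt k (λ v → ⟦ R (x ∷ v) ⟧)

      dense? : Decidable (λ x → n ^ k ≤ 2 * q * deg x)
      dense? x = n ^ k ≤? 2 * q * deg x

      denseList : List (Fin n)
      denseList = filter dense? (allFin n)

    deg≤ : ∀ x → deg x ≤ n ^ k
    deg≤ x = ≤-trans (Cnt-mono k (λ v → ⟦⟧≤1 (R (x ∷ v))))
                     (≤-reflexive (trans (Cnt-const n k 1) (*-identityʳ (n ^ k))))

    -- Vertices of relative degree below 1/(2q) account for at most half of the tuples.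
    many-dense : 1 ≤ n → n ^ suc k ≤ q * Cnt (suc k) (⟦_⟧ ∘ R) → n ≤ 2 * q * length denseList
    many-dense n₀ h = *-cancelʳ-≤ n (2 * q * length denseList) (n ^ k) bound
      where
      instance
        _ : NonZero (n ^ k)
        _ = m^n≢0 n k {{>-nonZero n₀}}
      pointwise : ∀ x (d : Dec (n ^ k ≤ 2 * q * deg x)) → 2 * q * deg x ≤ 2 * q * n ^ k * ⟦ does d ⟧ + n ^ k
      pointwise x (yes _) = ≤-trans (*-monoʳ-≤ (2 * q) (deg≤ x))
                            (≤-trans (≤-reflexive (sym (*-identityʳ _))) (m≤m+n _ _))
      pointwise x (no ¬d) = ≤-trans (<⇒≤ (≰⇒> ¬d)) (m≤n+m _ _)
      total : 2 * q * ∑ deg ≤ 2 * q * n ^ k * length denseList + n * n ^ k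
      total = ≤-trans (≤-reflexive (sym (∑-*ˡ (2 * q) deg))) (≤-trans (∑-+-mono (λ x → pointwise x (dense? x)))
        (≤-reflexive (cong₂ _+_
          (trans (∑-*ˡ (2 * q * n ^ k) (λ x → ⟦ does (dense? x) ⟧))
                 (cong (2 * q * n ^ k *_) (sym (length-filter-tabulate dense? (λ i → i)))))
          (∑-const n (n ^ k)))))
      bound : n * n ^ k ≤ 2 * q * length denseList * n ^ k
      bound = many-arith q n (n ^ k) (∑ deg) (length denseList) h total

    blowup-step : 1 ≤ M → 1 ≤ q → 1 ≤ n → 2 * q * sample M q ≤ n → n ^ suc k ≤ q * Cnt (suc k) (⟦_⟧ ∘ R) →
      ∃[ s ] (VUnique.Unique {_} {Fin n} {M} s ×
        n ^ k ≤ 4 * q * 2 ^ sample M q * Cnt k (λ v → ⟦ allV (λ x → R (x ∷ v)) s ⟧))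
    blowup-step M₀ q₀ n₀ nL h = s , choose-Unique M xs-unique s∈ , final
      where
      instance
        _ : NonZero (2 * q)
        _ = >-nonZero {2 * q} (*-mono-≤ {1} {2} (s≤s z≤n) q₀)
        _ : NonZero (2 * q * M)
        _ = >-nonZero {2 * q * M} (*-mono-≤ {1} {2 * q} (*-mono-≤ {1} {2} (s≤s z≤n) q₀) M₀)
      L = sample M q
      xs = take L denseList
      xs-unique : LUnique.Unique xs
      xs-unique = take⁺ L (filter⁺ dense? (allFin⁺ n))
      xs-dense : LAll.All (λ x → n ^ k ≤ 2 * q * deg x) xs
      xs-dense = All-take⁺ L (all-filter dense? (allFin n))
      length-xs : length xs ≡ L
      length-xs = trans (length-take L denseList)
        (m≤n⇒m⊓n≡m (*-cancelˡ-≤ (2 * q) (≤-trans nL (many-dense n₀ h))))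
      incidences : ∀ {ys} → LAll.All (λ x → n ^ k ≤ 2 * q * deg x) ys → length ys * n ^ k ≤ 2 * q * lsum deg ys
      incidences [] = z≤n
      incidences {y ∷ ys} (p ∷ ps) = ≤-trans (p ⊕ incidences ps) (≤-reflexive (sym (*-distribˡ-+ (2 * q) (deg y) (lsum deg ys))))
      S = lsum (λ s → Cnt k (λ v → ⟦ allV (λ x → R (x ∷ v)) s ⟧)) (choose M xs)
      -- Double counting by tuples: M hits are written off for each tuple, and any larger number is
      -- charged to a full M-subset of the sample.
      lsum-deg : lsum deg xs ≤ n ^ k * M + L * S
      lsum-deg = ≤-trans (≤-reflexive (sym (Cnt-lsum k (λ x v → ⟦ R (x ∷ v) ⟧) xs)))
        (≤-trans (Cnt-mono k (λ v → count≤full M (λ x → R (x ∷ v)) xs))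
        (≤-reflexive (trans (Cnt-+ k (λ _ → M) _) (cong₂ _+_ (Cnt-const n k M)
          (trans (Cnt-*ˡ k (length xs) _) (cong₂ _*_ length-xs
            (Cnt-lsum k (λ s v → ⟦ allV (λ x → R (x ∷ v)) s ⟧) (choose M xs))))))))
      dense-sum : n ^ k ≤ 4 * q * S
      dense-sum = *-cancelˡ-≤ (2 * q * M) (dense-arith q M (n ^ k) (lsum deg xs) S
        (≤-trans (≤-reflexive (cong (_* n ^ k) (sym length-xs))) (incidences xs-dense)) lsum-deg)
      S≥1 : 1 ≤ S
      S≥1 = factor-positive (4 * q) (m^n>0 n {{>-nonZero n₀}} k) dense-sum
      pigeon = lsum-pigeonhole (λ s → Cnt k (λ v → ⟦ allV (λ x → R (x ∷ v)) s ⟧)) (choose M xs) S≥1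
      s = proj₁ pigeon
      s∈ = proj₁ (proj₂ pigeon)
      number : length (choose M xs) ≤ 2 ^ L
      number = subst (λ l → length (choose M xs) ≤ 2 ^ l) length-xs (length-choose M xs)
      final : n ^ k ≤ 4 * q * 2 ^ L * Cnt k (λ v → ⟦ allV (λ x → R (x ∷ v)) s ⟧)
      final = ≤-trans dense-sum (≤-trans (*-monoʳ-≤ (4 * q)
        (≤-trans (proj₂ (proj₂ pigeon)) (*-monoˡ-≤ _ number))) (≤-reflexive (sym (*-assoc (4 * q) (2 ^ L) _))))

  blowup : ∀ k {n} M q → 1 ≤ M → 1 ≤ q → blowupBound k M q ≤ n → (R : Vec (Fin n) k → Bool) →
           n ^ k ≤ q * Cnt k (⟦_⟧ ∘ R) → Box k M (λ v → R v ≡ true)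
  blowup zero M q M₀ q₀ N R h = ⟦⟧-true (positive (R []) h)
    where
    positive : ∀ b → 1 ≤ q * ⟦ b ⟧ → 1 ≤ ⟦ b ⟧
    positive true _ = s≤s z≤n
    positive false p = ≤-trans p (≤-reflexive (*-zeroʳ q))
  blowup (suc k) {n} M q M₀ q₀ N R h =
    lookup s , (λ {i} {j} → lookup-injective uniq i j) ,
    Box-map k (λ v p i → allV-lookup (λ x → R (x ∷ v)) s p i)
      (blowup k M (4 * q * 2 ^ sample M q) M₀ q′₀ (≤-trans (m≤n+m _ _) (≤-trans (n≤1+n _) N)) _ h′)
    where
    step = blowup-step M q R M₀ q₀ (≤-trans (s≤s z≤n) N) (≤-trans (m≤m+n _ _) (≤-trans (n≤1+n _) N)) h
    s = proj₁ step
    uniq = proj₁ (proj₂ step)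
    h′ = proj₂ (proj₂ step)
    q′₀ : 1 ≤ 4 * q * 2 ^ sample M q
    q′₀ = *-mono-≤ (*-mono-≤ {1} {4} (s≤s z≤n) q₀) (m^n>0 2 (sample M q))

-- Counting ordered triples by the classes of their vertices.

module TripleCounts where
  open import Data.Nat.Properties
  open import Data.Bool.Properties using (∧-comm; ∧-assoc)
  open import Data.List using (List; []; _∷_)
  open Certificates
  open Estimates using (collect-cover)
  open Sums
  open Blowups using (lsum)

  ∑-lin₂ : ∀ {n} {f g h : Fin n → ℕ} c a b → (∀ i → c * f i ≤ a * g i + b * h i) → c * ∑ f ≤ a * ∑ g + b * ∑ h
  ∑-lin₂ {f = f} {g} {h} c a b p = ≤-trans (≤-reflexive (sym (∑-*ˡ c f)))
    (≤-trans (∑-+-mono p) (≤-reflexive (cong₂ _+_ (∑-*ˡ a g) (∑-*ˡ b h))))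

  ∑-lin₃ : ∀ {n} {f g h k : Fin n → ℕ} c a b d → (∀ i → c * f i ≤ a * g i + b * h i + d * k i) →
           c * ∑ f ≤ a * ∑ g + b * ∑ h + d * ∑ k
  ∑-lin₃ {f = f} {g} {h} {k} c a b d p = ≤-trans (≤-reflexive (sym (∑-*ˡ c f)))
    (≤-trans (∑-+-mono {h = λ i → d * k i} p) (≤-reflexive (cong₂ _+_
      (trans (∑-+ (λ i → a * g i) (λ i → b * h i)) (cong₂ _+_ (∑-*ˡ a g) (∑-*ˡ b h))) (∑-*ˡ d k))))

  ∑-lsum : ∀ {A : Set} {n} (f : A → Fin n → ℕ) xs → ∑[ i ] lsum (λ a → f a i) xs ≡ lsum (λ a → ∑ (f a)) xs
  ∑-lsum {n = n} f [] = trans (∑-const n 0) (*-zeroʳ n)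
  ∑-lsum f (x ∷ xs) = trans (∑-+ (f x) (λ i → lsum (λ a → f a i) xs)) (cong (∑ (f x) +_) (∑-lsum f xs))

  ∑-∧ : ∀ {n} b (f : Fin n → Bool) → ∑[ i ] ⟦ b ∧ f i ⟧ ≡ ⟦ b ⟧ * ∑[ i ] ⟦ f i ⟧
  ∑-∧ b f = trans (∑-cong (λ i → ⟦⟧-∧ b (f i))) (∑-*ˡ ⟦ b ⟧ (λ i → ⟦ f i ⟧))

  ∑²-∧ : ∀ {m n} b (f : Fin m → Fin n → Bool) → ∑[ i ] ∑[ j ] ⟦ b ∧ f i j ⟧ ≡ ⟦ b ⟧ * ∑[ i ] ∑[ j ] ⟦ f i j ⟧
  ∑²-∧ b f = trans (∑-cong (λ i → ∑-∧ b (f i))) (∑-*ˡ ⟦ b ⟧ (λ i → ∑[ j ] ⟦ f i j ⟧))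

  all : ∀ {n} → Fin n → Bool
  all _ = true

  module Tri {n} (E : Fin n → Fin n → Fin n → Bool)
    (swap₁₂ : ∀ x y z → E x y z ≡ E y x z) (swap₂₃ : ∀ x y z → E x y z ≡ E x z y) where

    Φ : (P Q R : Fin n → Bool) → ℕ
    Φ P Q R = ∑[ x ] ∑[ y ] ∑[ z ] ⟦ P x ∧ Q y ∧ R z ∧ E x y z ⟧

    Φ-swap₁₂ : ∀ P Q R → Φ P Q R ≡ Φ Q P R
    Φ-swap₁₂ P Q R = trans (∑-swap (λ x y → ∑[ z ] ⟦ P x ∧ Q y ∧ R z ∧ E x y z ⟧))
      (∑-cong (λ y → ∑-cong (λ x → ∑-cong (λ z → cong ⟦_⟧
        (trans (cong (λ e → P x ∧ Q y ∧ R z ∧ e) (swap₁₂ x y z)) (reorder (P x) (Q y) (R z) (E y x z)))))))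
      where
      reorder : ∀ a b c d → a ∧ b ∧ c ∧ d ≡ b ∧ a ∧ c ∧ d
      reorder a b c d = trans (sym (∧-assoc a b _)) (trans (cong (_∧ _) (∧-comm a b)) (∧-assoc b a _))

    Φ-swap₂₃ : ∀ P Q R → Φ P Q R ≡ Φ P R Q
    Φ-swap₂₃ P Q R = ∑-cong (λ x → trans (∑-swap (λ y z → ⟦ P x ∧ Q y ∧ R z ∧ E x y z ⟧))
      (∑-cong (λ z → ∑-cong (λ y → cong ⟦_⟧
        (trans (cong (λ e → P x ∧ Q y ∧ R z ∧ e) (swap₂₃ x y z)) (reorder (P x) (Q y) (R z) (E x z y)))))))
      where
      reorder : ∀ a b c d → a ∧ b ∧ c ∧ d ≡ a ∧ c ∧ b ∧ d
      reorder a b c d = cong (a ∧_) (trans (sym (∧-assoc b c _)) (trans (cong (_∧ _) (∧-comm b c)) (∧-assoc c b _)))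

    Φ-rot : ∀ P Q R → Φ P Q R ≡ Φ Q R P
    Φ-rot P Q R = trans (Φ-swap₁₂ P Q R) (Φ-swap₂₃ Q P R)

    Φ-cover : ∀ (ts : List ((Fin n → Bool) × (Fin n → Bool) × (Fin n → Bool))) →
      (∀ x y z → ⟦ E x y z ⟧ ≤ lsum (λ { (P , Q , R) → ⟦ P x ∧ Q y ∧ R z ∧ E x y z ⟧ }) ts) →
      Φ all all all ≤ lsum (λ { (P , Q , R) → Φ P Q R }) ts
    Φ-cover ts h = ≤-trans
      (∑-mono (λ x → ≤-trans
        (∑-mono (λ y → ≤-trans (∑-mono (h x y)) (≤-reflexive (∑-lsum (λ t z → term t x y z) ts))))
        (≤-reflexive (∑-lsum (λ t y → ∑[ z ] term t x y z) ts))))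
      (≤-reflexive (∑-lsum (λ t x → ∑[ y ] ∑[ z ] term t x y z) ts))
      where
      term : (Fin n → Bool) × (Fin n → Bool) × (Fin n → Bool) → Fin n → Fin n → Fin n → ℕ
      term = λ { (P , Q , R) x y z → ⟦ P x ∧ Q y ∧ R z ∧ E x y z ⟧ }

    Φ-bound₁ : ∀ P Q R → Φ P Q R ≤ card P * (n * n)
    Φ-bound₁ P Q R = ≤-trans (∑-mono (λ x → ≤-trans (≤-reflexive (∑²-∧ (P x) (λ y z → Q y ∧ R z ∧ E x y z)))
        (*-monoʳ-≤ ⟦ P x ⟧ (∑-bound (λ y → card≤ (λ z → Q y ∧ R z ∧ E x y z))))))
      (≤-reflexive (∑-*ʳ (n * n) (λ x → ⟦ P x ⟧)))

  module Partition {n} (E : Fin n → Fin n → Fin n → Bool)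
    (swap₁₂ : ∀ x y z → E x y z ≡ E y x z) (swap₂₃ : ∀ x y z → E x y z ≡ E x z y)
    (V₁ V₂ V₃ : Fin n → Bool) where
    open Tri E swap₁₂ swap₂₃

    V₀ : Fin n → Bool
    V₀ x = not (V₁ x ∨ V₂ x ∨ V₃ x)

    private
      triples : List ((Fin n → Bool) × (Fin n → Bool) × (Fin n → Bool))
      triples = (V₁ , V₂ , V₃) ∷ (V₁ , V₃ , V₂) ∷ (V₂ , V₁ , V₃) ∷ (V₂ , V₃ , V₁) ∷ (V₃ , V₁ , V₂) ∷ (V₃ , V₂ , V₁)
        ∷ (V₀ , all , all) ∷ (all , V₀ , all) ∷ (all , all , V₀)
        ∷ (V₁ , V₁ , all) ∷ (V₁ , all , V₁) ∷ (all , V₁ , V₁)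
        ∷ (V₂ , V₂ , all) ∷ (V₂ , all , V₂) ∷ (all , V₂ , V₂)
        ∷ (V₃ , V₃ , all) ∷ (V₃ , all , V₃) ∷ (all , V₃ , V₃) ∷ []

    -- An edge that avoids `V₀` and has no two vertices in one class meets the three classes in one
    -- of six orders; each exceptional kind of edge has three coordinate patterns.
    total-cover : Φ all all all ≤ 6 * Φ V₁ V₂ V₃ + 3 * (n * n) * card V₀ + 3 * (Φ V₁ V₁ all + Φ V₂ V₂ all + Φ V₃ V₃ all)
    total-cover = ≤-trans (Φ-cover triples pointwise) 
      (collect-cover (n * n) (card V₀)
        (Φ-swap₂₃ V₁ V₃ V₂) (Φ-swap₁₂ V₂ V₁ V₃) (sym (Φ-rot V₁ V₂ V₃)) (Φ-rot V₃ V₁ V₂) (trans (Φ-swap₁₂ V₃ V₂ V₁) (sym (Φ-rot V₁ V₂ V₃)))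
        (Φ-swap₁₂ all V₀ all) (sym (Φ-rot V₀ all all)) (Φ-bound₁ V₀ all all)
        (Φ-swap₂₃ V₁ all V₁) (Φ-rot all V₁ V₁) (Φ-swap₂₃ V₂ all V₂) (Φ-rot all V₂ V₂) (Φ-swap₂₃ V₃ all V₃) (Φ-rot all V₃ V₃))
      where
      pointwise : ∀ x y z → _
      pointwise x y z = byTable 10
        (λ a₁ a₂ a₃ b₁ b₂ b₃ c₁ c₂ c₃ e → ⟦ e ⟧)
        (λ a₁ a₂ a₃ b₁ b₂ b₃ c₁ c₂ c₃ e →
          ⟦ a₁ ∧ b₂ ∧ c₃ ∧ e ⟧ + (⟦ a₁ ∧ b₃ ∧ c₂ ∧ e ⟧ + (⟦ a₂ ∧ b₁ ∧ c₃ ∧ e ⟧ +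
          (⟦ a₂ ∧ b₃ ∧ c₁ ∧ e ⟧ + (⟦ a₃ ∧ b₁ ∧ c₂ ∧ e ⟧ + (⟦ a₃ ∧ b₂ ∧ c₁ ∧ e ⟧ +
          (⟦ not (a₁ ∨ a₂ ∨ a₃) ∧ e ⟧ + (⟦ not (b₁ ∨ b₂ ∨ b₃) ∧ e ⟧ + (⟦ not (c₁ ∨ c₂ ∨ c₃) ∧ e ⟧ +
          (⟦ a₁ ∧ b₁ ∧ e ⟧ + (⟦ a₁ ∧ c₁ ∧ e ⟧ + (⟦ b₁ ∧ c₁ ∧ e ⟧ +
          (⟦ a₂ ∧ b₂ ∧ e ⟧ + (⟦ a₂ ∧ c₂ ∧ e ⟧ + (⟦ b₂ ∧ c₂ ∧ e ⟧ +
          (⟦ a₃ ∧ b₃ ∧ e ⟧ + (⟦ a₃ ∧ c₃ ∧ e ⟧ + (⟦ b₃ ∧ c₃ ∧ e ⟧ + 0))))))))))))))))))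
        (V₁ x) (V₂ x) (V₃ x) (V₁ y) (V₂ y) (V₃ y) (V₁ z) (V₂ z) (V₃ z) (E x y z)

  complement-count : ∀ {n} (E : Fin n → Fin n → Fin n → Bool) (P Q R : Fin n → Bool) →
    ∑[ x ] ∑[ y ] ∑[ z ] ⟦ P x ∧ Q y ∧ R z ∧ E x y z ⟧ + ∑[ x ] ∑[ y ] ∑[ z ] ⟦ P x ∧ Q y ∧ R z ∧ not (E x y z) ⟧
      ≡ card P * card Q * card R
  complement-count E P Q R =
    trans (sym (∑-+ (λ x → ∑[ y ] ∑[ z ] ⟦ P x ∧ Q y ∧ R z ∧ E x y z ⟧) (λ x → ∑[ y ] ∑[ z ] ⟦ P x ∧ Q y ∧ R z ∧ not (E x y z) ⟧)))
    (trans (∑-cong (λ x →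
      trans (sym (∑-+ (λ y → ∑[ z ] ⟦ P x ∧ Q y ∧ R z ∧ E x y z ⟧) (λ y → ∑[ z ] ⟦ P x ∧ Q y ∧ R z ∧ not (E x y z) ⟧)))
      (trans (∑-cong (λ y →
        trans (sym (∑-+ (λ z → ⟦ P x ∧ Q y ∧ R z ∧ E x y z ⟧) (λ z → ⟦ P x ∧ Q y ∧ R z ∧ not (E x y z) ⟧)))
        (trans (∑-cong (λ z → split (P x) (Q y) (R z) (E x y z))) (∑-*ˡ (⟦ P x ⟧ * ⟦ Q y ⟧) (λ z → ⟦ R z ⟧)))))
        (trans (∑-*ʳ (card R) (λ y → ⟦ P x ⟧ * ⟦ Q y ⟧)) (cong (_* card R) (∑-*ˡ ⟦ P x ⟧ (λ y → ⟦ Q y ⟧)))))))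
    (trans (∑-*ʳ (card R) (λ x → ⟦ P x ⟧ * card Q)) (cong (_* card R) (∑-*ʳ (card Q) (λ x → ⟦ P x ⟧)))))
    where
    split : ∀ p q r e → ⟦ p ∧ q ∧ r ∧ e ⟧ + ⟦ p ∧ q ∧ r ∧ not e ⟧ ≡ ⟦ p ⟧ * ⟦ q ⟧ * ⟦ r ⟧
    split true true true true = refl
    split true true true false = refl
    split true true false e = refl
    split true false r e = refl
    split false q r e = refl

-- Symmetric triple systems and the scarcity of forbidden patterns.

module Systems where
  open import Data.Nat.Properties
  open import Data.Vec using (Vec; []; _∷_)
  open import Function.Definitions using (Injective)
  open Certificates
  open Sums
  open Blowups

  record System (n : ℕ) : Set where
    field
      E : Fin n → Fin n → Fin n → Bool
      swap₁₂ : ∀ x y z → E x y z ≡ E y x z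
      swap₂₃ : ∀ x y z → E x y z ≡ E x z y
      irrefl : ∀ x z → E x x z ≡ false

    rot : ∀ x y z → E x y z ≡ E y z x
    rot x y z = trans (swap₁₂ x y z) (swap₂₃ y x z)

    rot′ : ∀ x y z → E x y z ≡ E z x y
    rot′ x y z = sym (rot z x y)

    codeg : Fin n → Fin n → ℕ
    codeg x y = ∑[ z ] ⟦ E x y z ⟧

    deg : Fin n → ℕ
    deg x = ∑[ y ] codeg x y

    total : ℕ
    total = ∑[ x ] deg x

    -- For S = `E a b` these are the copies {abu, abw, uwz} of F₅ over the pair ab, degenerate ones
    -- included.
    edgesWithin : (Fin n → Bool) → ℕ
    edgesWithin S = ∑[ u ] ∑[ w ] ∑[ z ] ⟦ S u ∧ S w ∧ E u w z ⟧

    -- The copies {xyu, xyw, xuw} of K₄⁻ over the pair xy.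
    apexes : Fin n → Fin n → ℕ
    apexes x y = ∑[ u ] ∑[ w ] ⟦ E x y u ∧ E x y w ∧ E x u w ⟧

    codeg≤ : ∀ x y → codeg x y ≤ n
    codeg≤ x y = card≤ (E x y)

    deg-positive : ∀ x {y z} → E x y z ≡ true → 1 ≤ deg x
    deg-positive x {y} {z} e = ≤-trans (≤-reflexive (sym (cong ⟦_⟧ e)))
      (≤-trans (∑-term (λ z → ⟦ E x y z ⟧) z) (∑-term (codeg x) y))

  -- A host of the blow-up of F₅: after removing at most three vertices from each
  -- family, A and B are two parts of the tripartite graph, {x , y} ∪ D the third
  -- one and x y z the additional edge.
  record Config {n} (H : System n) (M : ℕ) : Set where
    open System H
    field
      A B D : Fin M → Fin n
      A-inj : Injective _≡_ _≡_ A
      B-inj : Injective _≡_ _≡_ B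
      D-inj : Injective _≡_ _≡_ D
      x y z : Fin n
      xyz : E x y z ≡ true
      ABx : ∀ i j → E (A i) (B j) x ≡ true
      ABy : ∀ i j → E (A i) (B j) y ≡ true
      ABD : ∀ i j k → E (A i) (B j) (D k) ≡ true

  ∧³ : ∀ {a b c} → a ∧ b ∧ c ≡ true → (a ≡ true) × (b ≡ true) × (c ≡ true)
  ∧³ {true} {true} {true} refl = refl , refl , refl

  module Sparse {n} (H : System n) (M Q : ℕ) (Q₀ : 1 ≤ Q)
    (N₃ : blowupBound 3 (suc M) Q ≤ n) (N₄ : blowupBound 4 (suc M) Q ≤ n) (N₅ : blowupBound 5 (suc M) Q ≤ n)
    (noConfig : ¬ Config H (suc M)) where
    open System H

    -- The contrapositive of `blowup`: a pattern of density above 1/Q would occur with every vertex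
    -- replaced by a family, and for each pattern below such a box contains a host.
    sparse : ∀ k → blowupBound k (suc M) Q ≤ n → (R₁ R₂ R₃ : Vec (Fin n) k → Bool) →
             ¬ Box k (suc M) (λ v → R₁ v ≡ true × R₂ v ≡ true × R₃ v ≡ true) →
             Q * Cnt k (λ v → ⟦ R₁ v ∧ R₂ v ∧ R₃ v ⟧) ≤ n ^ k
    sparse k N R₁ R₂ R₃ ¬box with Q * Cnt k (λ v → ⟦ R₁ v ∧ R₂ v ∧ R₃ v ⟧) ≤? n ^ k
    ... | yes p = p
    ... | no ¬p = ⊥-elim (¬box (Box-map k (λ v → ∧³)
      (blowup k (suc M) Q (s≤s z≤n) Q₀ N (λ v → R₁ v ∧ R₂ v ∧ R₃ v) (<⇒≤ (≰⇒> ¬p)))))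

    few-F₅ : Q * ∑[ a ] ∑[ b ] edgesWithin (E a b) ≤ n ^ 5
    few-F₅ = sparse 5 N₅
      (λ { (a ∷ b ∷ c ∷ d ∷ e ∷ []) → E a b c })
      (λ { (a ∷ b ∷ c ∷ d ∷ e ∷ []) → E a b d })
      (λ { (a ∷ b ∷ c ∷ d ∷ e ∷ []) → E c d e })
      λ { (A , Ai , B , Bi , C , Ci , D , Di , Z , Zi , h) → noConfig record
        { A = A ; B = B ; D = D ; A-inj = Ai ; B-inj = Bi ; D-inj = Di
        ; x = C zero ; y = D zero ; z = Z zero
        ; xyz = proj₂ (proj₂ (h zero zero zero zero zero))
        ; ABx = λ i j → proj₁ (h zero zero zero j i)
        ; ABy = λ i j → proj₁ (proj₂ (h zero zero zero j i))
        ; ABD = λ i j k → proj₁ (proj₂ (h zero k zero j i)) } }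

    -- The additional edge may end in the family A itself: `A zero` is then among the vertices
    -- discarded when the host is turned into a copy.
    few-K₄⁻ : Q * ∑[ a ] ∑[ b ] apexes a b ≤ n ^ 4
    few-K₄⁻ = sparse 4 N₄
      (λ { (a ∷ b ∷ u ∷ w ∷ []) → E a b u })
      (λ { (a ∷ b ∷ u ∷ w ∷ []) → E a b w })
      (λ { (a ∷ b ∷ u ∷ w ∷ []) → E a u w })
      λ { (A , Ai , B , Bi , C , Ci , D , Di , h) → noConfig record
        { A = A ; B = B ; D = D ; A-inj = Ai ; B-inj = Bi ; D-inj = Di
        ; x = C zero ; y = D zero ; z = A zero
        ; xyz = trans (rot′ _ _ _) (proj₂ (proj₂ (h zero zero zero zero)))
        ; ABx = λ i j → proj₁ (h zero zero j i)
        ; ABy = λ i j → proj₁ (proj₂ (h zero zero j i))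
        ; ABD = λ i j k → proj₁ (proj₂ (h k zero j i)) } }

    -- The vertex v takes the place of the new vertex: an edge vcd joins it to two vertices of the
    -- third class.
    few-pendant : ∀ v →
      Q * ∑[ a ] ∑[ b ] ∑[ c ] ∑[ d ] ⟦ E a b c ∧ E a b d ∧ E v c d ⟧ ≤ n ^ 4
    few-pendant v = sparse 4 N₄
      (λ { (a ∷ b ∷ c ∷ d ∷ []) → E a b c })
      (λ { (a ∷ b ∷ c ∷ d ∷ []) → E a b d })
      (λ { (a ∷ b ∷ c ∷ d ∷ []) → E v c d })
      λ { (A , Ai , B , Bi , C , Ci , D , Di , h) → noConfig record
        { A = A ; B = B ; D = D ; A-inj = Ai ; B-inj = Bi ; D-inj = Di
        ; x = C zero ; y = D zero ; z = v
        ; xyz = trans (rot′ _ _ _) (proj₂ (proj₂ (h zero zero zero zero)))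
        ; ABx = λ i j → proj₁ (h zero zero j i)
        ; ABy = λ i j → proj₁ (proj₂ (h zero zero j i))
        ; ABD = λ i j k → proj₁ (proj₂ (h k zero j i)) } }

    -- Here v itself enters the class of d, being joined to the pairs ab, and vdu is the additional
    -- edge inside that class.
    few-shared : ∀ v → Q * ∑[ a ] ∑[ b ] ∑[ d ] ∑[ u ] ⟦ E v a b ∧ E a b d ∧ E v d u ⟧ ≤ n ^ 4
    few-shared v = sparse 4 N₄
      (λ { (a ∷ b ∷ d ∷ u ∷ []) → E v a b })
      (λ { (a ∷ b ∷ d ∷ u ∷ []) → E a b d })
      (λ { (a ∷ b ∷ d ∷ u ∷ []) → E v d u })
      λ { (A , Ai , B , Bi , D , Di , U , Ui , h) → noConfig record
        { A = A ; B = B ; D = D ; A-inj = Ai ; B-inj = Bi ; D-inj = Di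
        ; x = v ; y = D zero ; z = U zero
        ; xyz = proj₂ (proj₂ (h zero zero zero zero))
        ; ABx = λ i j → trans (rot′ _ _ _) (proj₁ (h zero zero j i))
        ; ABy = λ i j → proj₁ (proj₂ (h zero zero j i))
        ; ABD = λ i j k → proj₁ (proj₂ (h zero k j i)) } }

    -- Pairs common to the links of x and y put both of them into the class of d, so xyz becomes the
    -- additional edge.
    few-common : ∀ x y z → E x y z ≡ true → Q * ∑[ a ] ∑[ b ] ∑[ d ] ⟦ E x a b ∧ E y a b ∧ E a b d ⟧ ≤ n ^ 3
    few-common x y z e = sparse 3 N₃
      (λ { (a ∷ b ∷ d ∷ []) → E x a b })
      (λ { (a ∷ b ∷ d ∷ []) → E y a b })
      (λ { (a ∷ b ∷ d ∷ []) → E a b d })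
      λ { (A , Ai , B , Bi , D , Di , h) → noConfig record
        { A = A ; B = B ; D = D ; A-inj = Ai ; B-inj = Bi ; D-inj = Di
        ; x = x ; y = y ; z = z
        ; xyz = e
        ; ABx = λ i j → trans (rot′ _ _ _) (proj₁ (h zero j i))
        ; ABy = λ i j → trans (rot′ _ _ _) (proj₁ (proj₂ (h zero j i)))
        ; ABD = λ i j k → proj₂ (proj₂ (h k j i)) } }

-- An approximate tripartition from large degrees.

module Cores where
  open import Data.Nat using (_<_)
  open import Data.Nat.Properties
  open Certificates
  open Sums
  open Estimates
  open Blowups
  open TripleCounts
  open Systems

  ≤ᵇ-true : ∀ a b → (a ≤ᵇ b) ≡ true → a ≤ b
  ≤ᵇ-true a b eq = ≤ᵇ⇒≤ a b (subst T (sym eq) tt)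

  ≤ᵇ-not : ∀ a b → b * ⟦ not (a ≤ᵇ b) ⟧ ≤ a
  ≤ᵇ-not a b with a ≤ᵇ b in eq
  ... | true = ≤-trans (≤-reflexive (*-zeroʳ b)) z≤n
  ... | false = ≤-trans (≤-reflexive (*-identityʳ b)) (<⇒≤ (≰⇒> λ p → subst T eq (≤⇒≤ᵇ p)))

  record NearTripartite {n} (H : System n) (q : ℕ) (V₁ V₂ V₃ : Fin n → Bool) : Set where
    open System H
    field
      disjoint : ∀ x → ⟦ V₁ x ⟧ + ⟦ V₂ x ⟧ + ⟦ V₃ x ⟧ ≤ 1
      size₁ : q * n ≤ 3 * q * card V₁ + 152 * n
      size₂ : q * n ≤ 3 * q * card V₂ + 152 * n
      size₃ : q * n ≤ 3 * q * card V₃ + 152 * n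
      outside : q * card (λ x → not (V₁ x ∨ V₂ x ∨ V₃ x)) ≤ 76 * n
      missing : q * ∑[ x ] ∑[ y ] ∑[ z ] ⟦ V₁ x ∧ V₂ y ∧ V₃ z ∧ not (E x y z) ⟧ ≤ 40 * (n * n * n)

  module Core {n′ : ℕ} (H : System (suc n′)) (q : ℕ) (q₀ : 1000 ≤ q) (X : Fin (suc n′) → Bool)
    (X-few : q * card X ≤ suc n′)
    (degrees : ∀ v → (X v ≡ true × System.deg H v ≡ 0)
                   ⊎ (2 * q * (suc n′ * suc n′) ≤ 9 * q * System.deg H v + suc n′ * suc n′))
    (few-F₅ : 2 * (q * q * q * q) * ∑[ a ] ∑[ b ] System.edgesWithin H (System.E H a b) ≤ suc n′ ^ 5)
    (few-K₄⁻ : 2 * (q * q * q * q) * ∑[ a ] ∑[ b ] System.apexes H a b ≤ suc n′ ^ 4) where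
    open System H

    private
      n : ℕ
      n = suc n′

      n₀ : 1 ≤ n
      n₀ = s≤s z≤n

      q₁ : 1 ≤ q
      q₁ = ≤-trans (s≤s z≤n) q₀

      -- The first threshold has the factor q² because one q is spent in the choice of b: a good
      -- neighbourhood then has at most n/q vertices with large `inner`.
      good : Fin n → Fin n → Bool
      good x y = (q * q * edgesWithin (E x y) ≤ᵇ n * n * n) ∧ (q * apexes x y ≤ᵇ n * n)

      bad : Fin n → Fin n → ℕ
      bad x y = ⟦ not (good x y) ⟧

      #bad : ℕ
      #bad = ∑[ x ] ∑[ y ] bad x y

      good-edges : ∀ x y → good x y ≡ true → q * q * edgesWithin (E x y) ≤ n * n * n
      good-edges x y g = ≤ᵇ-true _ (n * n * n) (∧-left g)

      good-apexes : ∀ x y → good x y ≡ true → q * apexes x y ≤ n * n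
      good-apexes x y g = ≤ᵇ-true _ (n * n) (∧-right {q * q * edgesWithin (E x y) ≤ᵇ n * n * n} g)

      bad-pointwise : ∀ x y → n * n * n * bad x y ≤ q * q * edgesWithin (E x y) + q * n * apexes x y
      bad-pointwise x y = ≤-trans
        (*-monoʳ-≤ (n * n * n) (byTable 2 (λ a b → ⟦ not (a ∧ b) ⟧) (λ a b → ⟦ not a ⟧ + ⟦ not b ⟧) g₁ g₂))
        (bad-arith n q _ _ _ _ (≤ᵇ-not (q * q * edgesWithin (E x y)) (n * n * n)) (≤ᵇ-not (q * apexes x y) (n * n)))
        where
        g₁ = q * q * edgesWithin (E x y) ≤ᵇ n * n * n
        g₂ = q * apexes x y ≤ᵇ n * n

      #bad-few : q * q * #bad ≤ n * n
      #bad-few = bad-pairs n q #bad _ _ n₀ q₁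
        (∑-lin₂ (n * n * n) (q * q) (q * n) (λ x → ∑-lin₂ (n * n * n) (q * q) (q * n) (bad-pointwise x)))
        few-F₅ few-K₄⁻

      total-large : 2 * q * (n * n * n) ≤ 9 * q * total + 3 * (n * n * n)
      total-large = total-lower n q total (card X) (≤-trans (≤-reflexive step₀) (≤-trans
        (∑-lin₃ {f = λ _ → 1} {g = deg} {h = λ _ → 1} {k = λ v → ⟦ X v ⟧} (2 * q * (n * n)) (9 * q) (n * n) (2 * q * (n * n)) pointwise)
        (≤-reflexive (cong (λ s → 9 * q * total + s + 2 * q * (n * n) * card X) step₁)))) X-few
        where
        ∑1 : ∑ {n} (λ _ → 1) ≡ n
        ∑1 = trans (∑-const n 1) (*-identityʳ n)
        step₀ : 2 * q * (n * n) * n ≡ 2 * q * (n * n) * ∑ {n} (λ _ → 1)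
        step₀ = cong (2 * q * (n * n) *_) (sym ∑1)
        step₁ : n * n * ∑ {n} (λ _ → 1) ≡ n * (n * n)
        step₁ = trans (cong (n * n *_) ∑1) (*-comm (n * n) n)
        pointwise : ∀ v → 2 * q * (n * n) * 1 ≤ 9 * q * deg v + n * n * 1 + 2 * q * (n * n) * ⟦ X v ⟧
        pointwise v with degrees v
        ... | inj₁ (eq , _) rewrite eq = m≤n+m (2 * q * (n * n) * 1) (9 * q * deg v + n * n * 1)
        ... | inj₂ h = ≤-trans (≤-reflexive (*-identityʳ _)) (≤-trans h
          (≤-trans (≤-reflexive (cong (9 * q * deg v +_) (sym (*-identityʳ (n * n))))) (m≤m+n _ _)))

      -- It vanishes on bad pairs, so a maximum over all pairs is attained at a good pair once it is
      -- positive.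
      goodCodeg : Fin n → Fin n → ℕ
      goodCodeg x y = ⟦ good x y ⟧ * codeg x y

      split-by-good : ∀ g c k m → ⟦ g ⟧ * c ≤ k → c ≤ m → c ≤ k + m * ⟦ not g ⟧
      split-by-good true c k m h _ = ≤-trans (≤-trans (≤-reflexive (sym (+-identityʳ c))) h) (m≤m+n k _)
      split-by-good false c k m _ h = ≤-trans h (≤-trans (≤-reflexive (sym (*-identityʳ m))) (m≤n+m _ k))

      positive-good : ∀ g c m → m < q * (⟦ g ⟧ * c) → g ≡ true
      positive-good true c m _ = refl
      positive-good false c m h = ⊥-elim (<⇒≱ h (≤-trans (≤-reflexive (*-zeroʳ q)) z≤n))

      inside : (P : Fin n → Bool) (f : Fin n → ℕ) (m : Fin n) → (∀ u → ⟦ P u ⟧ * f u ≤ ⟦ P m ⟧ * f m) →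
               1 ≤ ∑[ u ] (⟦ P u ⟧ * f u) → P m ≡ true
      inside P f m h s = positive (P m) (f m) h
        where
        positive : ∀ t k → (∀ u → ⟦ P u ⟧ * f u ≤ ⟦ t ⟧ * k) → t ≡ true
        positive true k _ = refl
        positive false k h = ⊥-elim (<⇒≱ s (≤-trans (∑-bound h) (≤-reflexive (*-zeroʳ n))))

      weighted≤ : ∀ t (f k : ℕ) → ⟦ t ⟧ * f ≤ k → ⟦ t ⟧ * f ≤ ⟦ t ⟧ * k
      weighted≤ true f k h = ≤-trans h (≤-reflexive (sym (+-identityʳ k)))
      weighted≤ false f k h = z≤n

      sum-weighted≤ : (P : Fin n → Bool) (f : Fin n → ℕ) (k : ℕ) → (∀ u → ⟦ P u ⟧ * f u ≤ k) → ∑[ u ] (⟦ P u ⟧ * f u) ≤ card P * k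
      sum-weighted≤ P f k h = ≤-trans (∑-mono (λ u → weighted≤ (P u) (f u) k (h u))) (≤-reflexive (∑-*ʳ k (λ u → ⟦ P u ⟧)))

    module MaximalPair (x₀ y₀ : Fin n) (maximal : ∀ x y → goodCodeg x y ≤ goodCodeg x₀ y₀) where

      k₁ : ℕ
      k₁ = goodCodeg x₀ y₀

      codeg-split : ∀ x y → codeg x y ≤ k₁ + n * bad x y
      codeg-split x y = split-by-good (good x y) (codeg x y) k₁ n (maximal x y) (codeg≤ x y)

      k₁-large : 2 * n < q * k₁
      k₁-large = max-codegree n q total k₁ #bad n₀ (≤-trans (≤ᵇ⇒≤ 100 1000 tt) q₀) total-large
        (≤-trans (∑-mono (λ x → ≤-trans (∑-+-mono (codeg-split x)) (≤-reflexive (cong₂ _+_ (∑-const n k₁) (∑-*ˡ n (bad x))))))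
          (≤-reflexive (trans (∑-+ (λ _ → n * k₁) (λ x → n * ∑ (bad x)))
            (cong₂ _+_ (trans (∑-const n (n * k₁)) (sym (*-assoc n n k₁))) (∑-*ˡ n (λ x → ∑ (bad x)))))))
        #bad-few

      good₀ : good x₀ y₀ ≡ true
      good₀ = positive-good (good x₀ y₀) (codeg x₀ y₀) (2 * n) k₁-large

      S₁ : Fin n → Bool
      S₁ = E x₀ y₀

      k₁≡ : k₁ ≡ card S₁
      k₁≡ = trans (cong (λ b → ⟦ b ⟧ * codeg x₀ y₀) good₀) (+-identityʳ _)

      inner : Fin n → ℕ
      inner b = ∑[ w ] ∑[ z ] ⟦ S₁ w ∧ E b w z ⟧

      badDeg : Fin n → ℕ
      badDeg b = ∑ (bad b)

      typical : Fin n → Bool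
      typical b = (q * inner b ≤ᵇ n * n) ∧ (q * badDeg b ≤ᵇ n)

      typical-pointwise : ∀ b → n * n * ⟦ S₁ b ⟧ ≤ n * n * ⟦ S₁ b ∧ typical b ⟧ + q * (⟦ S₁ b ⟧ * inner b) + n * q * badDeg b
      typical-pointwise b = ≤-trans
        (*-monoʳ-≤ (n * n) (byTable 3 (λ s a b → ⟦ s ⟧) (λ s a b → ⟦ s ∧ a ∧ b ⟧ + ⟦ s ⟧ * ⟦ not a ⟧ + ⟦ not b ⟧) (S₁ b) g₁ g₂))
        (typical-arith n q _ ⟦ S₁ b ⟧ _ _ _ _ (≤ᵇ-not (q * inner b) (n * n)) (≤ᵇ-not (q * badDeg b) n))
        where
        g₁ = q * inner b ≤ᵇ n * n
        g₂ = q * badDeg b ≤ᵇ n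

      inner-sum : ∑[ b ] (⟦ S₁ b ⟧ * inner b) ≡ edgesWithin S₁
      inner-sum = ∑-cong (λ b → sym (∑²-∧ (S₁ b) (λ w z → S₁ w ∧ E b w z)))

      -- `S₁` has more than 2n/q vertices. At most n/q of them have large `inner`, since these
      -- values sum to at most n³/q², and at most n/q vertices lie in more than n/q bad pairs.
      some-typical : ∃[ b ] 1 ≤ ⟦ S₁ b ∧ typical b ⟧
      some-typical = ∑-positive (λ b → ⟦ S₁ b ∧ typical b ⟧)
        (typical-exists n q (card S₁) _ (edgesWithin S₁) #bad n₀ (≤-trans k₁-large (≤-reflexive (cong (q *_) k₁≡)))
          (≤-trans (∑-lin₃ {f = λ b → ⟦ S₁ b ⟧} {h = λ b → ⟦ S₁ b ⟧ * inner b} (n * n) (n * n) q (n * q) typical-pointwise)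
            (≤-reflexive (cong (λ s → n * n * ∑[ b ] ⟦ S₁ b ∧ typical b ⟧ + q * s + n * q * #bad) inner-sum)))
          (good-edges x₀ y₀ good₀) #bad-few)

      module TypicalVertex (b : Fin n) (b∈S₁ : S₁ b ≡ true) (b-typical : typical b ≡ true) where

        -- Discarding the bad partners of b in advance makes the pairs ba and bc good for whatever a
        -- and c are chosen from `U`.
        U : Fin n → Bool
        U u = not (S₁ u) ∧ good b u

        link : ℕ
        link = ∑[ u ] ∑[ w ] ⟦ U u ∧ U w ∧ E b u w ⟧

        outer≤ : ∑[ u ] ∑[ w ] ⟦ not (U u) ∧ E b u w ⟧ ≤ inner b + n * badDeg b
        outer≤ = ≤-trans (∑-+-mono (λ u → ≤-trans (∑-+-mono (λ w →
            byTable 3 (λ s g e → ⟦ not (not s ∧ g) ∧ e ⟧) (λ s g e → ⟦ s ∧ e ⟧ + ⟦ not g ⟧) (S₁ u) (good b u) (E b u w)))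
            (+-monoʳ-≤ _ (≤-reflexive (∑-const n (bad b u))))))
          (+-monoʳ-≤ (inner b) (≤-reflexive (∑-*ˡ n (bad b))))

        deg-b : deg b ≤ link + 2 * (inner b + n * badDeg b)
        deg-b = ≤-trans
          (∑-+-mono {g = λ u → ∑[ w ] ⟦ U u ∧ U w ∧ E b u w ⟧} (λ u → ∑-+-mono (λ w →
            byTable 3 (λ s t e → ⟦ e ⟧) (λ s t e → ⟦ s ∧ t ∧ e ⟧ + (⟦ not s ∧ e ⟧ + ⟦ not t ∧ e ⟧)) (U u) (U w) (E b u w))))
          (+-monoʳ-≤ link (≤-trans (≤-reflexive (trans
            (trans (∑-cong (λ u → ∑-+ (λ w → ⟦ not (U u) ∧ E b u w ⟧) (λ w → ⟦ not (U w) ∧ E b u w ⟧)))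
                   (∑-+ (λ u → ∑[ w ] ⟦ not (U u) ∧ E b u w ⟧) (λ u → ∑[ w ] ⟦ not (U w) ∧ E b u w ⟧)))
            (cong₂ _+_ refl (trans (∑-swap (λ u w → ⟦ not (U w) ∧ E b u w ⟧))
              (∑-cong (λ w → ∑-cong (λ u → cong (λ e → ⟦ not (U w) ∧ e ⟧) (swap₂₃ b u w))))))))
            (≤-trans (outer≤ ⊕ outer≤) (≤-reflexive (cong (inner b + n * badDeg b +_) (sym (+-identityʳ (inner b + n * badDeg b))))))))

        link-large : 2 * q * (n * n) ≤ 9 * q * link + 37 * (n * n)
        link-large with degrees b
        ... | inj₁ (_ , eq) = ⊥-elim (<⇒≱ (deg-positive b (trans (sym (rot′ x₀ y₀ b)) b∈S₁)) (≤-reflexive eq))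
        ... | inj₂ h = link-lower n q (deg b) link (inner b) (badDeg b) h deg-b
          (≤ᵇ-true _ (n * n) (∧-left b-typical)) (≤ᵇ-true _ n (∧-right {q * inner b ≤ᵇ n * n} b-typical))

        codegU : Fin n → ℕ
        codegU u = ∑[ w ] ⟦ U w ∧ E b u w ⟧

        link-sum : link ≡ ∑[ u ] (⟦ U u ⟧ * codegU u)
        link-sum = ∑-cong (λ u → ∑-∧ (U u) (λ w → U w ∧ E b u w))

        link-positive : 1 ≤ link
        link-positive = positive link link-large
          where
          positive : ∀ l → 2 * q * (n * n) ≤ 9 * q * l + 37 * (n * n) → 1 ≤ l
          positive (suc l) _ = s≤s z≤n
          positive zero h = ⊥-elim (square-contra n (2 * q) 37 n₀
            (≤-trans (≤ᵇ⇒≤ 38 2000 tt) (*-monoʳ-≤ 2 q₀)) (≤-trans h (≤-reflexive (cong (_+ 37 * (n * n)) (*-zeroʳ (9 * q))))))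

        module MaximalNeighbour (a : Fin n) (k₂-max : ∀ u → ⟦ U u ⟧ * codegU u ≤ ⟦ U a ⟧ * codegU a) where

          k₂ : ℕ
          k₂ = ⟦ U a ⟧ * codegU a

          a∈U : U a ≡ true
          a∈U = inside U codegU a k₂-max (≤-trans link-positive (≤-reflexive link-sum))

          good-a : good b a ≡ true
          good-a = ∧-right {not (S₁ a)} a∈U

          S₂ : Fin n → Bool
          S₂ w = U w ∧ E b a w

          k₂≡ : k₂ ≡ card S₂
          k₂≡ = trans (cong (λ t → ⟦ t ⟧ * codegU a) a∈U) (+-identityʳ _)

          R : Fin n → Bool
          R u = U u ∧ not (S₂ u)

          codegR : Fin n → ℕ
          codegR u = ∑[ w ] ⟦ R w ∧ E b u w ⟧

          card-U : card U ≡ card R + card S₂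
          card-U = trans (∑-cong (λ u → split (U u) (E b a u))) (∑-+ (λ u → ⟦ R u ⟧) (λ u → ⟦ S₂ u ⟧))
            where
            split : ∀ s t → ⟦ s ⟧ ≡ ⟦ s ∧ not (s ∧ t) ⟧ + ⟦ s ∧ t ⟧
            split true true = refl
            split true false = refl
            split false _ = refl

          link≤₁ : link ≤ (card R + card S₂) * card S₂
          link≤₁ = ≤-trans (≤-reflexive link-sum) (≤-trans (sum-weighted≤ U codegU k₂ k₂-max)
            (≤-reflexive (cong₂ _*_ card-U k₂≡)))

          R-part : ∑[ u ] (⟦ R u ⟧ * codegU u) ≤ card R * card S₂
          R-part = sum-weighted≤ R codegU (card S₂) (λ u → ≤-trans (*-monoˡ-≤ (codegU u) (R≤U u))
            (≤-trans (k₂-max u) (≤-reflexive k₂≡)))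
            where
            R≤U : ∀ u → ⟦ R u ⟧ ≤ ⟦ U u ⟧
            R≤U u = byTable 2 (λ s t → ⟦ s ∧ not t ⟧) (λ s t → ⟦ s ⟧) (U u) (S₂ u)

          -- A pair of the link has its first vertex in `R`, or its first in `S₂` and its second in
          -- `R`, or both in `S₂`; in the last case it completes a K₄⁻ over the good pair ba, and
          -- such pairs are few.
          link-split : link ≤ ∑[ u ] (⟦ R u ⟧ * codegU u) + (∑[ u ] (⟦ S₂ u ⟧ * codegR u) + apexes b a)
          link-split = ∑-+-mono {h = λ u → ⟦ S₂ u ⟧ * codegR u + ∑[ w ] ⟦ E b a u ∧ E b a w ∧ E b u w ⟧} (λ u →
              ≤-trans (∑-+-mono {h = λ w → ⟦ S₂ u ∧ R w ∧ E b u w ⟧ + ⟦ E b a u ∧ E b a w ∧ E b u w ⟧} (λ w → byTable 5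
                (λ s s′ t t′ e → ⟦ s ∧ s′ ∧ e ⟧)
                (λ s s′ t t′ e → ⟦ (s ∧ not (s ∧ t)) ∧ s′ ∧ e ⟧ + (⟦ (s ∧ t) ∧ (s′ ∧ not (s′ ∧ t′)) ∧ e ⟧ + ⟦ t ∧ t′ ∧ e ⟧))
                (U u) (U w) (E b a u) (E b a w) (E b u w)))
              (≤-reflexive (cong₂ _+_ (∑-∧ (R u) (λ w → U w ∧ E b u w))
                (trans (∑-+ (λ w → ⟦ S₂ u ∧ R w ∧ E b u w ⟧) (λ w → ⟦ E b a u ∧ E b a w ∧ E b u w ⟧))
                  (cong (_+ _) (∑-∧ (S₂ u) (λ w → R w ∧ E b u w)))))))
            ∙ ≤-reflexive (cong (∑[ u ] (⟦ R u ⟧ * codegU u) +_)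
                (∑-+ (λ u → ⟦ S₂ u ⟧ * codegR u) (λ u → ∑[ w ] ⟦ E b a u ∧ E b a w ∧ E b u w ⟧)))
            where
            _∙_ : ∀ {i j k} → i ≤ j → j ≤ k → i ≤ k
            _∙_ = ≤-trans

          module Third (c : Fin n) (k₃-max : ∀ u → ⟦ S₂ u ⟧ * codegR u ≤ ⟦ S₂ c ⟧ * codegR c) where

            k₃ : ℕ
            k₃ = ⟦ S₂ c ⟧ * codegR c

            -- The third class is cut down from `R` to the neighbourhood of the good pair bc, so
            -- that, like the other two, it spans few edges with two vertices inside.
            V₃ : Fin n → Bool
            V₃ w = R w ∧ E b c w

            V₃≤R : card V₃ ≤ card R
            V₃≤R = ∑-mono (λ w → byTable 2 (λ r e → ⟦ r ∧ e ⟧) (λ r e → ⟦ r ⟧) (R w) (E b c w))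

            k₃≤ : k₃ ≤ card V₃
            k₃≤ = drop (S₂ c) (codegR c)
              where
              drop : ∀ t f → ⟦ t ⟧ * f ≤ f
              drop true f = ≤-reflexive (+-identityʳ f)
              drop false f = z≤n

            link≤₂ : q * link ≤ q * (card R * card S₂ + card S₂ * k₃) + n * n
            link≤₂ = link-upper n q link _ _ (card R * card S₂) (card S₂ * k₃) (apexes b a) link-split R-part
              (sum-weighted≤ S₂ codegR k₃ k₃-max) (good-apexes b a good-a)

            S₂≤S₁ : card S₂ ≤ card S₁
            S₂≤S₁ = ≤-trans (∑-mono (λ w → byTable 2 (λ s e → ⟦ s ∧ e ⟧) (λ s e → ⟦ e ⟧) (U w) (E b a w)))
              (≤-trans (≤-trans (≤-reflexive (trans (sym (+-identityʳ _)) (cong (λ t → ⟦ t ⟧ * codeg b a) (sym good-a)))) (maximal b a))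
                (≤-reflexive k₁≡))

            parts≤n : card S₁ + card S₂ + card R ≤ n
            parts≤n = ≤-trans (≤-reflexive (sym (trans (∑-+ (λ u → ⟦ S₁ u ⟧ + ⟦ S₂ u ⟧) (λ u → ⟦ R u ⟧))
                (cong (_+ card R) (∑-+ (λ u → ⟦ S₁ u ⟧) (λ u → ⟦ S₂ u ⟧))))))
              (≤-trans (∑-bound (λ u → byTable 3
                (λ s g t → ⟦ s ⟧ + ⟦ (not s ∧ g) ∧ t ⟧ + ⟦ (not s ∧ g) ∧ not ((not s ∧ g) ∧ t) ⟧) (λ _ _ _ → 1) (S₁ u) (good b u) (E b a u)))
                (≤-reflexive (*-identityʳ n)))

            open PartSizes n q (card S₁) (card S₂) (card R) k₃ link n₀ link-large link≤₂ link≤₁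
              S₂≤S₁ (≤-trans k₃≤ V₃≤R) parts≤n

            c∈S₂ : S₂ c ≡ true
            c∈S₂ = positive (S₂ c) (codegR c) third-lower
              where
              positive : ∀ t k → q * n ≤ 3 * q * (⟦ t ⟧ * k) + 152 * n → t ≡ true
              positive true k _ = refl
              positive false k h = ⊥-elim (<⇒≱ (≤-trans (≤ᵇ⇒≤ 153 1000 tt) q₀)
                (*-cancelʳ-≤ q 152 n (≤-trans h (≤-reflexive (cong (_+ 152 * n) (*-zeroʳ (3 * q)))))))

            good-c : good b c ≡ true
            good-c = ∧-right {not (S₁ c)} (∧-left c∈S₂)

            open Partition E swap₁₂ swap₂₃ S₁ S₂ V₃
            open Tri E swap₁₂ swap₂₃

            edgesWithin-mono : ∀ {P Q : Fin n → Bool} → (∀ u → P u ≡ true → Q u ≡ true) → edgesWithin P ≤ edgesWithin Q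
            edgesWithin-mono {P} {Q} h = ∑-mono (λ u → ∑-mono (λ w → ∑-mono (λ z → pointwise (P u) (P w) (h u) (h w))))
              where
              pointwise : ∀ {s t e} s′ t′ → (s′ ≡ true → s ≡ true) → (t′ ≡ true → t ≡ true) → ⟦ s′ ∧ t′ ∧ e ⟧ ≤ ⟦ s ∧ t ∧ e ⟧
              pointwise true true f g rewrite f refl | g refl = ≤-refl
              pointwise true false f g = z≤n
              pointwise false t′ f g = z≤n

            few-within : ∀ x y → good x y ≡ true → (P : Fin n → Bool) → (∀ u → P u ≡ true → E x y u ≡ true) →
                         q * edgesWithin P ≤ n * n * n
            few-within x y g P h = ≤-trans (*-monoʳ-≤ q (edgesWithin-mono h))
              (≤-trans (*-monoˡ-≤ (edgesWithin (E x y)) (≤-trans (≤-reflexive (sym (*-identityʳ q))) (*-monoʳ-≤ q q₁))) (good-edges x y g))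

            few-monochromatic : q * (edgesWithin S₁ + edgesWithin S₂ + edgesWithin V₃) ≤ 3 * (n * n * n)
            few-monochromatic = three-few q (n * n * n) _ _ _
              (few-within x₀ y₀ good₀ S₁ (λ _ p → p))
              (few-within b a good-a S₂ (λ u p → ∧-right {U u} p))
              (few-within b c good-c V₃ (λ u p → ∧-right {R u} p))

            disjoint : ∀ x → ⟦ S₁ x ⟧ + ⟦ S₂ x ⟧ + ⟦ V₃ x ⟧ ≤ 1
            disjoint x = byTable 4
              (λ s g t e → ⟦ s ⟧ + ⟦ (not s ∧ g) ∧ t ⟧ + ⟦ ((not s ∧ g) ∧ not ((not s ∧ g) ∧ t)) ∧ e ⟧) (λ _ _ _ _ → 1)
              (S₁ x) (good b x) (E b a x) (E b c x)

            parts-sum : card S₁ + card S₂ + card V₃ + card V₀ ≡ n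
            parts-sum = trans (sym (trans (∑-+ (λ u → ⟦ S₁ u ⟧ + ⟦ S₂ u ⟧ + ⟦ V₃ u ⟧) (λ u → ⟦ V₀ u ⟧))
                (cong (_+ card V₀) (trans (∑-+ (λ u → ⟦ S₁ u ⟧ + ⟦ S₂ u ⟧) (λ u → ⟦ V₃ u ⟧))
                  (cong (_+ card V₃) (∑-+ (λ u → ⟦ S₁ u ⟧) (λ u → ⟦ S₂ u ⟧)))))))
              (trans (∑-cong (λ u → one (S₁ u) (S₂ u) (V₃ u) (disjoint u))) (trans (∑-const n 1) (*-identityʳ n)))
              where
              one : ∀ r s t → ⟦ r ⟧ + ⟦ s ⟧ + ⟦ t ⟧ ≤ 1 → ⟦ r ⟧ + ⟦ s ⟧ + ⟦ t ⟧ + ⟦ not (r ∨ s ∨ t) ⟧ ≡ 1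
              one true true _ (s≤s ())
              one true false true (s≤s ())
              one false true true (s≤s ())
              one true false false _ = refl
              one false true false _ = refl
              one false false true _ = refl
              one false false false _ = refl

            third-lower′ : q * n ≤ 3 * q * card V₃ + 152 * n
            third-lower′ = ≤-trans third-lower (+-monoˡ-≤ (152 * n) (*-monoʳ-≤ (3 * q) k₃≤))

            deviation : q * card V₀ ≤ 76 * n ×
              q * ∑[ x ] ∑[ y ] ∑[ z ] ⟦ S₁ x ∧ S₂ y ∧ V₃ z ∧ not (E x y z) ⟧ ≤ 40 * (n * n * n)
            deviation = parts-missing n q total (Φ S₁ S₂ V₃) _ (card S₁) (card S₂) (card V₃) (card V₀) _ n₀
              first-lower second-lower third-lower′ parts-sum (complement-count E S₁ S₂ V₃) total-large total-cover few-monochromatic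

            third : NearTripartite H q S₁ S₂ V₃
            third = record
              { disjoint = disjoint
              ; size₁ = ≤-trans first-lower (+-monoʳ-≤ _ (*-monoˡ-≤ n (≤ᵇ⇒≤ 37 152 tt)))
              ; size₂ = ≤-trans second-lower (+-monoʳ-≤ _ (*-monoˡ-≤ n (≤ᵇ⇒≤ 37 152 tt)))
              ; size₃ = third-lower′
              ; outside = proj₁ deviation
              ; missing = proj₂ deviation
              }

          fromNeighbour : ∃[ V₁ ] ∃[ V₂ ] ∃[ V₃ ] NearTripartite H q V₁ V₂ V₃
          fromNeighbour = _ , _ , _ , Third.third (proj₁ best) (proj₂ best)
            where best = argmax (λ u → ⟦ S₂ u ⟧ * codegR u)

        fromTypical : ∃[ V₁ ] ∃[ V₂ ] ∃[ V₃ ] NearTripartite H q V₁ V₂ V₃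
        fromTypical = MaximalNeighbour.fromNeighbour (proj₁ best) (proj₂ best)
          where best = argmax (λ u → ⟦ U u ⟧ * codegU u)

      fromPair : ∃[ V₁ ] ∃[ V₂ ] ∃[ V₃ ] NearTripartite H q V₁ V₂ V₃
      fromPair = start some-typical
        where
        start : ∃[ b ] 1 ≤ ⟦ S₁ b ∧ typical b ⟧ → ∃[ V₁ ] ∃[ V₂ ] ∃[ V₃ ] NearTripartite H q V₁ V₂ V₃
        start (b , h) = TypicalVertex.fromTypical b (∧-left (⟦⟧-true h)) (∧-right {S₁ b} (⟦⟧-true h))

    nearTripartite : ∃[ V₁ ] ∃[ V₂ ] ∃[ V₃ ] NearTripartite H q V₁ V₂ V₃
    nearTripartite = MaximalPair.fromPair (proj₁ best₀) (proj₁ (best (proj₁ best₀)))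
        (λ x y → ≤-trans (proj₂ (best x) y) (proj₂ best₀ x))
      where
      best : ∀ x → ∃[ y ] (∀ y′ → goodCodeg x y′ ≤ goodCodeg x y)
      best x = argmax (goodCodeg x)
      best₀ = argmax (λ x → goodCodeg x (proj₁ (best x)))

-- From an approximate tripartition to a proper 3-colouring.

module Colourings where
  open import Data.Nat.Properties
  open import Data.Fin.Patterns using (0F; 1F; 2F)
  open import Data.List using (List; []; _∷_)
  open import Data.Sum using () renaming (map to map⊎)
  open Certificates
  open Sums
  open Estimates
  open Blowups
  open TripleCounts
  open Systems
  open Cores

  module _ {n} {H : System n} {q : ℕ} where
    open System H
    private
      swapN₁₂ : ∀ x y z → not (E x y z) ≡ not (E y x z)
      swapN₁₂ x y z = cong not (swap₁₂ x y z)
      swapN₂₃ : ∀ x y z → not (E x y z) ≡ not (E x z y)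
      swapN₂₃ x y z = cong not (swap₂₃ x y z)
      open Tri (λ x y z → not (E x y z)) swapN₁₂ swapN₂₃

    NT-rot : ∀ {P Q R} → NearTripartite H q P Q R → NearTripartite H q Q R P
    NT-rot {P} {Q} {R} N = record
      { disjoint = λ x → ≤-trans (byTable 3 (λ p s t → ⟦ s ⟧ + ⟦ t ⟧ + ⟦ p ⟧) (λ p s t → ⟦ p ⟧ + ⟦ s ⟧ + ⟦ t ⟧) (P x) (Q x) (R x)) (disjoint x)
      ; size₁ = size₂ ; size₂ = size₃ ; size₃ = size₁
      ; outside = ≤-trans (*-monoʳ-≤ q (∑-mono (λ x →
          byTable 3 (λ p s t → ⟦ not (s ∨ t ∨ p) ⟧) (λ p s t → ⟦ not (p ∨ s ∨ t) ⟧) (P x) (Q x) (R x)))) outside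
      ; missing = ≤-trans (≤-reflexive (cong (q *_) (sym (Φ-rot P Q R)))) missing
      }
      where open NearTripartite N

    NT-swap : ∀ {P Q R} → NearTripartite H q P Q R → NearTripartite H q Q P R
    NT-swap {P} {Q} {R} N = record
      { disjoint = λ x → ≤-trans (byTable 3 (λ p s t → ⟦ s ⟧ + ⟦ p ⟧ + ⟦ t ⟧) (λ p s t → ⟦ p ⟧ + ⟦ s ⟧ + ⟦ t ⟧) (P x) (Q x) (R x)) (disjoint x)
      ; size₁ = size₂ ; size₂ = size₁ ; size₃ = size₃
      ; outside = ≤-trans (*-monoʳ-≤ q (∑-mono (λ x →
          byTable 3 (λ p s t → ⟦ not (s ∨ p ∨ t) ⟧) (λ p s t → ⟦ not (p ∨ s ∨ t) ⟧) (P x) (Q x) (R x)))) outside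
      ; missing = ≤-trans (≤-reflexive (cong (q *_) (sym (Φ-swap₁₂ P Q R)))) missing
      }
      where open NearTripartite N

  module Colouring {n : ℕ} (n₀ : 1 ≤ n) (H : System n) (q : ℕ) (q₀ : 10000000 ≤ q)
    (few-pendant : ∀ v → q * ∑[ a ] ∑[ b ] ∑[ c ] ∑[ d ] ⟦ System.E H a b c ∧ System.E H a b d ∧ System.E H v c d ⟧ ≤ n ^ 4)
    (few-shared : ∀ v → q * ∑[ a ] ∑[ b ] ∑[ d ] ∑[ u ] ⟦ System.E H v a b ∧ System.E H a b d ∧ System.E H v d u ⟧ ≤ n ^ 4)
    (few-common : ∀ x y z → System.E H x y z ≡ true →
      q * ∑[ a ] ∑[ b ] ∑[ d ] ⟦ System.E H x a b ∧ System.E H y a b ∧ System.E H a b d ⟧ ≤ n ^ 3)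
    (degrees : ∀ v → System.deg H v ≡ 0 ⊎ (2 * q * (n * n) ≤ 9 * q * System.deg H v + n * n)) where
    open System H

    private
      NT : (P Q R : Fin n → Bool) → Set
      NT = NearTripartite H q

      large : ∀ c {_ : (c ≤ᵇ 10000000) ≡ true} → c ≤ q
      large c {eq} = ≤-trans (≤ᵇ-true c 10000000 eq) q₀

    joint : Fin n → (P Q : Fin n → Bool) → ℕ
    joint v P Q = ∑[ u ] ∑[ w ] ⟦ P u ∧ Q w ∧ E v u w ⟧

    joint-sym : ∀ v P Q → joint v P Q ≡ joint v Q P
    joint-sym v P Q = trans (∑-swap (λ u w → ⟦ P u ∧ Q w ∧ E v u w ⟧))
      (∑-cong (λ w → ∑-cong (λ u → cong ⟦_⟧ (trans (cong (λ e → P u ∧ Q w ∧ e) (swap₂₃ v u w)) (reorder (P u) (Q w) _)))))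
      where
      reorder : ∀ a b c → a ∧ b ∧ c ≡ b ∧ a ∧ c
      reorder true true c = refl
      reorder true false c = refl
      reorder false true c = refl
      reorder false false c = refl

    -- The constants (400 here, 10000000 for q) are not optimised.
    record Small (v : Fin n) (P Q : Fin n → Bool) : Set where
      constructor small
      field unwrap : 400 * joint v P Q ≤ n * n

    bound : ∀ v P Q → Small v P Q → 400 * joint v P Q ≤ n * n
    bound v P Q (small h) = h

    private
      m₃ : (P Q R : Fin n → Bool) → ℕ
      m₃ P Q R = ∑[ x ] ∑[ y ] ∑[ z ] ⟦ P x ∧ Q y ∧ R z ∧ not (E x y z) ⟧

    -- For c, d in D with vcd an edge, each pair ab from A and B either forms the pattern of
    -- `few-pendant` with it or has abc or abd missing. Both are rare, while there are at least
    -- n²/16 pairs ab.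
    joint-within : ∀ v {A B D} → NT A B D → Small v D D
    joint-within v {A} {B} {D} N = small (scale-down 400 1296 q (joint v D D) (n * n) (large 518400 {refl})
      (inside-arith n q (joint v D D) (card A) (card B) _ (m₃ A B D) n₀ (large 608 {refl}) sum≤ (few-pendant v) missing
        (quarter n q (card A) (large 608 {refl}) size₁) (quarter n q (card B) (large 608 {refl}) size₂)) (s≤s z≤n))
      where
      open NearTripartite N
      f : Fin n → Fin n → Fin n → Fin n → ℕ
      f a b c d = ⟦ E a b c ∧ E a b d ∧ E v c d ⟧
      g : Fin n → Fin n → Fin n → ℕ
      g a b c = ⟦ A a ∧ B b ∧ D c ∧ not (E a b c) ⟧
      pointwise : ∀ a b c d → ⟦ A a ⟧ * ⟦ B b ⟧ * ⟦ D c ∧ D d ∧ E v c d ⟧ ≤ f a b c d + (g a b c + g a b d)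
      pointwise a b c d = byTable 7
        (λ a b c d e x y → ⟦ a ⟧ * ⟦ b ⟧ * ⟦ c ∧ d ∧ e ⟧)
        (λ a b c d e x y → ⟦ x ∧ y ∧ e ⟧ + (⟦ a ∧ b ∧ c ∧ not x ⟧ + ⟦ a ∧ b ∧ d ∧ not y ⟧))
        (A a) (B b) (D c) (D d) (E v c d) (E a b c) (E a b d)
      inner : ∀ a b → ⟦ A a ⟧ * ⟦ B b ⟧ * joint v D D ≤ ∑[ c ] ∑[ d ] f a b c d + (n * ∑ (g a b) + n * ∑ (g a b))
      inner a b = ≤-trans (≤-reflexive (sym (trans (∑-cong (λ c → ∑-*ˡ (⟦ A a ⟧ * ⟦ B b ⟧) (λ d → ⟦ D c ∧ D d ∧ E v c d ⟧)))
          (∑-*ˡ (⟦ A a ⟧ * ⟦ B b ⟧) (λ c → ∑[ d ] ⟦ D c ∧ D d ∧ E v c d ⟧)))))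
        (≤-trans (∑-+-mono (λ c → ≤-trans (∑-+-mono (pointwise a b c)) (+-monoʳ-≤ _ (≤-reflexive
            (trans (∑-+ (λ _ → g a b c) (g a b)) (cong (_+ ∑ (g a b)) (∑-const n (g a b c))))))))
          (+-monoʳ-≤ _ (≤-reflexive (trans (∑-+ (λ c → n * g a b c) (λ _ → ∑ (g a b)))
            (cong₂ _+_ (∑-*ˡ n (g a b)) (∑-const n (∑ (g a b))))))))
      twice : ∀ {m} (h : Fin m → ℕ) → ∑[ i ] (n * h i + n * h i) ≡ n * ∑ h + n * ∑ h
      twice h = trans (∑-+ (λ i → n * h i) (λ i → n * h i)) (cong₂ _+_ (∑-*ˡ n h) (∑-*ˡ n h))
      sum≤ : card A * card B * joint v D D ≤ ∑[ a ] ∑[ b ] ∑[ c ] ∑[ d ] f a b c d + (n * m₃ A B D + n * m₃ A B D)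
      sum≤ = ≤-trans (≤-reflexive (sym (trans (∑-cong (λ a → ∑-*ʳ (joint v D D) (λ b → ⟦ A a ⟧ * ⟦ B b ⟧)))
          (trans (∑-*ʳ (joint v D D) (λ a → ∑[ b ] (⟦ A a ⟧ * ⟦ B b ⟧)))
            (cong (_* joint v D D) (∑-product (λ a → ⟦ A a ⟧) (λ b → ⟦ B b ⟧)))))))
        (≤-trans (∑-+-mono (λ a → ≤-trans (∑-+-mono (inner a)) (+-monoʳ-≤ _ (≤-reflexive (twice (λ b → ∑ (g a b)))))))
          (+-monoʳ-≤ _ (≤-reflexive (twice (λ a → ∑[ b ] ∑ (g a b))))))

    -- Many AB-pairs in its link make v resemble a vertex of D, and then an edge vdu with d in D is
    -- forbidden. An AB-pair and a DW-pair of the link give the pattern of `few-shared` unless abd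
    -- is missing.
    joint-one : ∀ v {A B D} W → NT A B D → Small v A B ⊎ Small v D W
    joint-one v {A} {B} {D} W N = map⊎ small small (dichotomy n q (joint v A B) (joint v D W) _ (m₃ A B D) (large 6560000 {refl}) sum≤ (few-shared v) missing)
      where
      open NearTripartite N
      f : Fin n → Fin n → Fin n → Fin n → ℕ
      f a b d u = ⟦ E v a b ∧ E a b d ∧ E v d u ⟧
      g : Fin n → Fin n → Fin n → ℕ
      g a b d = ⟦ A a ∧ B b ∧ D d ∧ not (E a b d) ⟧
      pointwise : ∀ a b d u → ⟦ A a ∧ B b ∧ E v a b ⟧ * ⟦ D d ∧ W u ∧ E v d u ⟧ ≤ f a b d u + g a b d
      pointwise a b d u = byTable 7
        (λ a b e d u e′ x → ⟦ a ∧ b ∧ e ⟧ * ⟦ d ∧ u ∧ e′ ⟧)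
        (λ a b e d u e′ x → ⟦ e ∧ x ∧ e′ ⟧ + ⟦ a ∧ b ∧ d ∧ not x ⟧)
        (A a) (B b) (E v a b) (D d) (W u) (E v d u) (E a b d)
      inner : ∀ a b → ⟦ A a ∧ B b ∧ E v a b ⟧ * joint v D W ≤ ∑[ d ] ∑[ u ] f a b d u + n * ∑ (g a b)
      inner a b = ≤-trans (≤-reflexive (sym (trans (∑-cong (λ d → ∑-*ˡ ⟦ A a ∧ B b ∧ E v a b ⟧ (λ u → ⟦ D d ∧ W u ∧ E v d u ⟧)))
          (∑-*ˡ ⟦ A a ∧ B b ∧ E v a b ⟧ (λ d → ∑[ u ] ⟦ D d ∧ W u ∧ E v d u ⟧)))))
        (≤-trans (∑-+-mono (λ d → ≤-trans (∑-+-mono (pointwise a b d)) (+-monoʳ-≤ _ (≤-reflexive (∑-const n (g a b d))))))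
          (+-monoʳ-≤ _ (≤-reflexive (∑-*ˡ n (g a b)))))
      sum≤ : joint v A B * joint v D W ≤ ∑[ a ] ∑[ b ] ∑[ d ] ∑[ u ] f a b d u + n * m₃ A B D
      sum≤ = ≤-trans (≤-reflexive (sym (trans (∑-cong (λ a → ∑-*ʳ (joint v D W) (λ b → ⟦ A a ∧ B b ∧ E v a b ⟧)))
          (∑-*ʳ (joint v D W) (λ a → ∑[ b ] ⟦ A a ∧ B b ∧ E v a b ⟧)))))
        (≤-trans (∑-+-mono (λ a → ≤-trans (∑-+-mono (inner a)) (+-monoʳ-≤ _ (≤-reflexive (∑-*ˡ n (λ b → ∑ (g a b)))))))
          (+-monoʳ-≤ _ (≤-reflexive (∑-*ˡ n (λ a → ∑[ b ] ∑ (g a b))))))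

    joint-bound : ∀ v P → joint v P all ≤ card P * n
    joint-bound v P = ≤-trans (∑-mono (λ u → ≤-trans (≤-reflexive (∑-∧ (P u) (λ w → E v u w)))
      (*-monoʳ-≤ ⟦ P u ⟧ (card≤ (E v u))))) (≤-reflexive (∑-*ʳ n (λ u → ⟦ P u ⟧)))

    joint-cover : ∀ v (ts : List ((Fin n → Bool) × (Fin n → Bool))) →
      (∀ u w → ⟦ E v u w ⟧ ≤ lsum (λ { (S , T) → ⟦ S u ∧ T w ∧ E v u w ⟧ }) ts) →
      deg v ≤ lsum (λ { (S , T) → joint v S T }) ts
    joint-cover v ts h = ≤-trans
      (∑-mono (λ u → ≤-trans (∑-mono (h u)) (≤-reflexive (∑-lsum (λ t w → term t u w) ts))))
      (≤-reflexive (∑-lsum (λ t u → ∑[ w ] term t u w) ts))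
      where
      term : (Fin n → Bool) × (Fin n → Bool) → Fin n → Fin n → ℕ
      term = λ { (S , T) u w → ⟦ S u ∧ T w ∧ E v u w ⟧ }

    -- Pairs inside one class are negligible for every v by `joint-within`, so these two conditions
    -- leave only pairs between Q and R: v behaves like a vertex of P.
    InPart : Fin n → (P Q R : Fin n → Bool) → Set
    InPart v P Q R = Small v P Q × Small v P R

    link-large : ∀ v {P Q R} → NT P Q R → InPart v P Q R → 1 ≤ deg v → n * n ≤ 10 * joint v Q R
    link-large v {P} {Q} {R} N (PQ , PR) v₀ with degrees v
    ... | inj₁ eq = ⊥-elim (<⇒≱ v₀ (≤-reflexive eq))
    ... | inj₂ h = type-large n q (deg v) (joint v Q R) (joint v P Q) (joint v P R) (joint v P P) (joint v Q Q) (joint v R R) (card V₀)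
      (large 50 {refl}) (large 1 {refl}) h cover (bound v P Q PQ) (bound v P R PR)
      (bound v P P PP) (bound v Q Q QQ) (bound v R R RR)
      (scale-down 800 76 q (card V₀) n (large 60800 {refl}) outside (s≤s z≤n))
      where
      open NearTripartite N
      PP : Small v P P
      PP = joint-within v (NT-rot N)
      QQ : Small v Q Q
      QQ = joint-within v (NT-rot (NT-rot N))
      RR : Small v R R
      RR = joint-within v N
      V₀ : Fin n → Bool
      V₀ x = not (P x ∨ Q x ∨ R x)
      pairs : List ((Fin n → Bool) × (Fin n → Bool))
      pairs = (Q , R) ∷ (R , Q) ∷ (P , Q) ∷ (Q , P) ∷ (P , R) ∷ (R , P) ∷ (P , P) ∷ (Q , Q) ∷ (R , R)
        ∷ (V₀ , all) ∷ (all , V₀) ∷ []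
      pointwise : ∀ u w → _
      pointwise u w = byTable 7 (λ p q r p′ q′ r′ e → ⟦ e ⟧)
        (λ p q r p′ q′ r′ e → ⟦ q ∧ r′ ∧ e ⟧ + (⟦ r ∧ q′ ∧ e ⟧ + (⟦ p ∧ q′ ∧ e ⟧ + (⟦ q ∧ p′ ∧ e ⟧ + (⟦ p ∧ r′ ∧ e ⟧ +
          (⟦ r ∧ p′ ∧ e ⟧ + (⟦ p ∧ p′ ∧ e ⟧ + (⟦ q ∧ q′ ∧ e ⟧ + (⟦ r ∧ r′ ∧ e ⟧ +
          (⟦ not (p ∨ q ∨ r) ∧ e ⟧ + (⟦ not (p′ ∨ q′ ∨ r′) ∧ e ⟧ + 0)))))))))))
        (P u) (Q u) (R u) (P w) (Q w) (R w) (E v u w)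
      cover : deg v ≤ 2 * joint v Q R + 2 * (joint v P Q + joint v P R) + (joint v P P + joint v Q Q + joint v R R) + 2 * (card V₀ * n)
      cover = ≤-trans (joint-cover v pairs pointwise)
          (collect-pairs {joint v Q R} {joint v R Q} {joint v P Q} {joint v Q P} {joint v P R} {joint v R P}
            {joint v P P} {joint v Q Q} {joint v R R} {joint v V₀ all} {joint v all V₀} (card V₀ * n)
            (joint-sym v R Q) (joint-sym v Q P) (joint-sym v R P) (joint-sym v all V₀) (joint-bound v V₀))

    no-edge-inside : ∀ {P Q R} → NT P Q R → ∀ x y z → InPart x P Q R → InPart y P Q R → E x y z ≡ true → ⊥
    no-edge-inside {P} {Q} {R} N x y z px py e = common-contra n q (joint x Q R) (joint y Q R) (card Q) (card R) (card P)
      both _ (m₃ Q R P) n₀ (large 16400 {refl})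
      (link-large x {P} {Q} {R} N px (deg-positive x e)) (link-large y {P} {Q} {R} N py (deg-positive y (trans (sym (swap₁₂ x y z)) e)))
      sum₁ sum₂ (few-common x y z e) (NearTripartite.missing (NT-rot N))
      (quarter n q (card P) (large 608 {refl}) size₁) sizes
      where
      open NearTripartite N
      both : ℕ
      both = ∑[ a ] ∑[ b ] ⟦ Q a ∧ R b ∧ E x a b ∧ E y a b ⟧
      sum₁ : joint x Q R + joint y Q R ≤ card Q * card R + both
      sum₁ = ≤-trans (≤-reflexive (sym (trans (∑-cong (λ a → ∑-+ (λ b → ⟦ Q a ∧ R b ∧ E x a b ⟧) (λ b → ⟦ Q a ∧ R b ∧ E y a b ⟧)))
          (∑-+ (λ a → ∑[ b ] ⟦ Q a ∧ R b ∧ E x a b ⟧) (λ a → ∑[ b ] ⟦ Q a ∧ R b ∧ E y a b ⟧)))))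
        (≤-trans (∑-+-mono (λ a → ∑-+-mono (λ b → byTable 4
          (λ s t e e′ → ⟦ s ∧ t ∧ e ⟧ + ⟦ s ∧ t ∧ e′ ⟧) (λ s t e e′ → ⟦ s ⟧ * ⟦ t ⟧ + ⟦ s ∧ t ∧ e ∧ e′ ⟧)
          (Q a) (R b) (E x a b) (E y a b))))
          (≤-reflexive (cong (_+ both) (∑-product (λ a → ⟦ Q a ⟧) (λ b → ⟦ R b ⟧)))))
      sum₂ : both * card P ≤ ∑[ a ] ∑[ b ] ∑[ d ] ⟦ E x a b ∧ E y a b ∧ E a b d ⟧ + m₃ Q R P
      sum₂ = ≤-trans (≤-reflexive (sym (trans (∑-cong (λ a → trans
            (∑-cong (λ b → ∑-*ˡ ⟦ Q a ∧ R b ∧ E x a b ∧ E y a b ⟧ (λ d → ⟦ P d ⟧)))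
            (∑-*ʳ (card P) (λ b → ⟦ Q a ∧ R b ∧ E x a b ∧ E y a b ⟧))))
          (∑-*ʳ (card P) (λ a → ∑[ b ] ⟦ Q a ∧ R b ∧ E x a b ∧ E y a b ⟧)))))
        (∑-+-mono (λ a → ∑-+-mono (λ b → ∑-+-mono (λ d → byTable 6
          (λ s t e e′ p x → ⟦ s ∧ t ∧ e ∧ e′ ⟧ * ⟦ p ⟧) (λ s t e e′ p x → ⟦ e ∧ e′ ∧ x ⟧ + ⟦ s ∧ t ∧ p ∧ not x ⟧)
          (Q a) (R b) (E x a b) (E y a b) (P d) (E a b d)))))
      sizes : card Q + card R + card P ≤ n
      sizes = ≤-trans (≤-reflexive (sym (trans (∑-+ (λ u → ⟦ Q u ⟧ + ⟦ R u ⟧) (λ u → ⟦ P u ⟧))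
          (cong (_+ card P) (∑-+ (λ u → ⟦ Q u ⟧) (λ u → ⟦ R u ⟧))))))
        (≤-trans (∑-bound (NearTripartite.disjoint (NT-rot N))) (≤-reflexive (*-identityʳ n)))

    module _ {V₁ V₂ V₃ : Fin n → Bool} (N : NT V₁ V₂ V₃) where

      private
        flip : ∀ v P Q → Small v P Q → Small v Q P
        flip v P Q (small h) = small (subst (λ l → 400 * l ≤ n * n) (joint-sym v P Q) h)

      part : Fin 3 → Fin n → Set
      part 0F v = InPart v V₁ V₂ V₃
      part 1F v = InPart v V₂ V₃ V₁
      part 2F v = InPart v V₃ V₁ V₂

      -- The three instances of `joint-one` say that of any two crossing types at least one is
      -- negligible. So two of the three types are negligible, and the class they have in common is
      -- the part of v.
      in-some-part : ∀ v → ∃[ i ] part i v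
      in-some-part v = decide (joint-one v V₁ N) (joint-one v V₂ N) (joint-one v V₃ (NT-rot (NT-swap N)))
        where
        decide : Small v V₁ V₂ ⊎ Small v V₃ V₁ → Small v V₁ V₂ ⊎ Small v V₃ V₂ → Small v V₁ V₃ ⊎ Small v V₂ V₃ →
                 ∃[ i ] part i v
        decide (inj₁ s₁₂) _          (inj₁ s₁₃) = 0F , s₁₂ , s₁₃
        decide (inj₁ s₁₂) _          (inj₂ s₂₃) = 1F , s₂₃ , flip v V₁ V₂ s₁₂
        decide (inj₂ s₃₁) (inj₁ s₁₂) _          = 0F , s₁₂ , flip v V₃ V₁ s₃₁
        decide (inj₂ s₃₁) (inj₂ s₃₂) _          = 2F , s₃₁ , s₃₂

      colour : Fin n → Fin 3
      colour v = proj₁ (in-some-part v)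

      no-edge : ∀ i x y z → part i x → part i y → E x y z ≡ true → ⊥
      no-edge 0F = no-edge-inside {V₁} {V₂} {V₃} N
      no-edge 1F = no-edge-inside {V₂} {V₃} {V₁} (NT-rot N)
      no-edge 2F = no-edge-inside {V₃} {V₁} {V₂} (NT-rot (NT-rot N))

      colour-proper : ∀ x y z → E x y z ≡ true → colour x ≢ colour y
      colour-proper x y z e eq = no-edge (colour y) x y z
        (subst (λ i → part i x) eq (proj₂ (in-some-part x))) (proj₂ (in-some-part y)) e

      colouring : Σ (Fin n → Fin 3) λ χ → ∀ x y z → E x y z ≡ true → χ x ≢ χ y
      colouring = colour , colour-proper

-- Stability: host-free systems with large degrees are 3-colourable.

module Stability where
  open import Data.Nat.Properties
  open import Data.Sum using ([_,_]′)
  open Certificates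
  open Sums
  open Blowups
  open Systems
  open Cores using (module Core; NearTripartite)
  open Colourings

  open Core using (nearTripartite)

  stabilityBound : ℕ → ℕ → ℕ
  stabilityBound M q = suc (blowupBound 3 (suc M) Q + blowupBound 4 (suc M) Q + blowupBound 5 (suc M) Q)
    where Q = 2 * (q * q * q * q)

  stability : ∀ M q {n} → 10000000 ≤ q → stabilityBound M q ≤ n → (H : System n) (X : Fin n → Bool) → q * card X ≤ n →
    (∀ v → (X v ≡ true × System.deg H v ≡ 0) ⊎ (2 * q * (n * n) ≤ 9 * q * System.deg H v + n * n)) →
    ¬ Config H (suc M) →
    Σ (Fin n → Fin 3) λ χ → (∀ x y z → System.E H x y z ≡ true → χ x ≢ χ y)
  stability M q {n = suc n′} q₀ large H X X-few degrees noConfig = colours (nearTripartite H q (≤-trans (≤ᵇ⇒≤ 1000 10000000 tt) q₀) X X-few degrees few-F₅ few-K₄⁻)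
    where
    q₁ : 1 ≤ q
    q₁ = ≤-trans (s≤s z≤n) q₀
    Q = 2 * (q * q * q * q)
    b₃ = blowupBound 3 (suc M) Q
    b₄ = blowupBound 4 (suc M) Q
    b₅ = blowupBound 5 (suc M) Q
    sum≤ : b₃ + b₄ + b₅ ≤ suc n′
    sum≤ = ≤-trans (n≤1+n _) large
    open Sparse H M Q (*-mono-≤ {1} {2} (s≤s z≤n) (*-mono-≤ (*-mono-≤ (*-mono-≤ q₁ q₁) q₁) q₁))
      (≤-trans (≤-trans (m≤m+n b₃ b₄) (m≤m+n (b₃ + b₄) b₅)) sum≤)
      (≤-trans (≤-trans (m≤n+m b₄ b₃) (m≤m+n (b₃ + b₄) b₅)) sum≤)
      (≤-trans (m≤n+m b₅ (b₃ + b₄)) sum≤) noConfig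
    q≤Q : q ≤ Q
    q≤Q = ≤-trans (≤-trans (≤-reflexive (sym (*-identityˡ q))) (*-monoˡ-≤ q (*-mono-≤ (*-mono-≤ q₁ q₁) q₁)))
                  (m≤m+n _ _)
    weaken : ∀ {c b} → Q * c ≤ b → q * c ≤ b
    weaken {c} h = ≤-trans (*-monoˡ-≤ c q≤Q) h
    colours : ∃[ V₁ ] ∃[ V₂ ] ∃[ V₃ ] NearTripartite H q V₁ V₂ V₃ →
              Σ (Fin (suc n′) → Fin 3) λ χ → ∀ x y z → System.E H x y z ≡ true → χ x ≢ χ y
    colours (_ , _ , _ , N) = colouring (s≤s z≤n) H q q₀ (weaken ∘ few-pendant) (weaken ∘ few-shared)
      (λ x y z e → weaken (few-common x y z e)) (λ v → [ inj₁ ∘ proj₂ , inj₂ ]′ (degrees v)) N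
      where open Colouring using (colouring)

-- Graphs as symmetric systems, and the isolation of a vertex set.

module Graphs where
  open import Defs
  open import Data.Nat.Properties hiding (_<?_)
  open import Data.Nat.ListAction using () renaming (sum to listSum)
  open import Data.Bool using (if_then_else_)
  open import Data.Fin using (_<?_)
  open import Data.List using (map; tabulate; allFin)
  open import Data.List.Properties using (map-tabulate)
  open import Function using (id)
  open Certificates
  open Estimates
  open Sums
  open TripleCounts
  open Systems

  ∨-elim : ∀ {a b} → a ∨ b ≡ true → a ≡ true ⊎ b ≡ true
  ∨-elim {true} _ = inj₁ refl
  ∨-elim {false} h = inj₂ h

  ∨-inj₁ : ∀ {a b} → a ≡ true → a ∨ b ≡ true
  ∨-inj₁ refl = refl

  ∨-inj₂ : ∀ {a b} → b ≡ true → a ∨ b ≡ true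
  ∨-inj₂ {true} _ = refl
  ∨-inj₂ {false} h = h

  does-true : ∀ {P : Set} (d : Dec P) → does d ≡ true → P
  does-true (yes p) _ = p

  true-does : ∀ {P : Set} (d : Dec P) → P → does d ≡ true
  true-does (yes _) _ = refl
  true-does (no ¬p) p = ⊥-elim (¬p p)

  ⟦⟧-antisym : ∀ {a b} → ⟦ a ⟧ ≤ ⟦ b ⟧ → ⟦ b ⟧ ≤ ⟦ a ⟧ → a ≡ b
  ⟦⟧-antisym {true} {true} _ _ = refl
  ⟦⟧-antisym {false} {false} _ _ = refl

  not-true : ∀ {b} → (b ≡ true → ⊥) → not b ≡ true
  not-true {true} h = ⊥-elim (h refl)
  not-true {false} _ = refl

  module _ {n} (H : Graph3 n) where

    increasing : Fin n → Fin n → Fin n → Bool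
    increasing x y z = does (x <? y) ∧ does (y <? z) ∧ H x y z

    adjacent : Fin n → Fin n → Fin n → Bool
    adjacent x y z = increasing x y z ∨ increasing x z y ∨ increasing y x z ∨ increasing y z x ∨ increasing z x y ∨ increasing z y x

    Inc⇒increasing : ∀ {x y z} → Inc H x y z → increasing x y z ≡ true
    Inc⇒increasing {x} {y} {z} (p , q , h) rewrite true-does (x <? y) p | true-does (y <? z) q = h

    increasing⇒Inc : ∀ {x y z} → increasing x y z ≡ true → Inc H x y z
    increasing⇒Inc {x} {y} {z} h = does-true (x <? y) (∧-left h) ,
      does-true (y <? z) (∧-left (∧-right {does (x <? y)} h)) , ∧-right {does (y <? z)} (∧-right {does (x <? y)} h)

    IsEdge⇒adjacent : ∀ x y z → IsEdge H x y z → adjacent x y z ≡ true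
    IsEdge⇒adjacent x y z (inj₁ i) = ∨-inj₁ (Inc⇒increasing i)
    IsEdge⇒adjacent x y z (inj₂ (inj₁ i)) = ∨-inj₂ {increasing x y z} (∨-inj₁ (Inc⇒increasing i))
    IsEdge⇒adjacent x y z (inj₂ (inj₂ (inj₁ i))) =
      ∨-inj₂ {increasing x y z} (∨-inj₂ {increasing x z y} (∨-inj₁ (Inc⇒increasing i)))
    IsEdge⇒adjacent x y z (inj₂ (inj₂ (inj₂ (inj₁ i)))) =
      ∨-inj₂ {increasing x y z} (∨-inj₂ {increasing x z y} (∨-inj₂ {increasing y x z} (∨-inj₁ (Inc⇒increasing i))))
    IsEdge⇒adjacent x y z (inj₂ (inj₂ (inj₂ (inj₂ (inj₁ i))))) =
      ∨-inj₂ {increasing x y z} (∨-inj₂ {increasing x z y} (∨-inj₂ {increasing y x z} (∨-inj₂ {increasing y z x} (∨-inj₁ (Inc⇒increasing i)))))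
    IsEdge⇒adjacent x y z (inj₂ (inj₂ (inj₂ (inj₂ (inj₂ i))))) =
      ∨-inj₂ {increasing x y z} (∨-inj₂ {increasing x z y} (∨-inj₂ {increasing y x z} (∨-inj₂ {increasing y z x} (∨-inj₂ {increasing z x y} (Inc⇒increasing i)))))

    adjacent⇒IsEdge : ∀ x y z → adjacent x y z ≡ true → IsEdge H x y z
    adjacent⇒IsEdge x y z h with ∨-elim {increasing x y z} h
    ... | inj₁ p = inj₁ (increasing⇒Inc p)
    ... | inj₂ h₁ with ∨-elim {increasing x z y} h₁
    ... | inj₁ p = inj₂ (inj₁ (increasing⇒Inc p))
    ... | inj₂ h₂ with ∨-elim {increasing y x z} h₂
    ... | inj₁ p = inj₂ (inj₂ (inj₁ (increasing⇒Inc p)))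
    ... | inj₂ h₃ with ∨-elim {increasing y z x} h₃
    ... | inj₁ p = inj₂ (inj₂ (inj₂ (inj₁ (increasing⇒Inc p))))
    ... | inj₂ h₄ with ∨-elim {increasing z x y} h₄
    ... | inj₁ p = inj₂ (inj₂ (inj₂ (inj₂ (inj₁ (increasing⇒Inc p)))))
    ... | inj₂ p = inj₂ (inj₂ (inj₂ (inj₂ (inj₂ (increasing⇒Inc p)))))

    adjacent-swap₁₂ : ∀ x y z → adjacent x y z ≡ adjacent y x z
    adjacent-swap₁₂ x y z = ⟦⟧-antisym
      (byTable 6 (λ a b c d e f → ⟦ a ∨ b ∨ c ∨ d ∨ e ∨ f ⟧) (λ a b c d e f → ⟦ c ∨ d ∨ a ∨ b ∨ f ∨ e ⟧) p₁ p₂ p₃ p₄ p₅ p₆)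
      (byTable 6 (λ a b c d e f → ⟦ c ∨ d ∨ a ∨ b ∨ f ∨ e ⟧) (λ a b c d e f → ⟦ a ∨ b ∨ c ∨ d ∨ e ∨ f ⟧) p₁ p₂ p₃ p₄ p₅ p₆)
      where
      p₁ = increasing x y z
      p₂ = increasing x z y
      p₃ = increasing y x z
      p₄ = increasing y z x
      p₅ = increasing z x y
      p₆ = increasing z y x

    adjacent-swap₂₃ : ∀ x y z → adjacent x y z ≡ adjacent x z y
    adjacent-swap₂₃ x y z = ⟦⟧-antisym
      (byTable 6 (λ a b c d e f → ⟦ a ∨ b ∨ c ∨ d ∨ e ∨ f ⟧) (λ a b c d e f → ⟦ b ∨ a ∨ e ∨ f ∨ c ∨ d ⟧) p₁ p₂ p₃ p₄ p₅ p₆)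
      (byTable 6 (λ a b c d e f → ⟦ b ∨ a ∨ e ∨ f ∨ c ∨ d ⟧) (λ a b c d e f → ⟦ a ∨ b ∨ c ∨ d ∨ e ∨ f ⟧) p₁ p₂ p₃ p₄ p₅ p₆)
      where
      p₁ = increasing x y z
      p₂ = increasing x z y
      p₃ = increasing y x z
      p₄ = increasing y z x
      p₅ = increasing z x y
      p₆ = increasing z y x

    IsEdge-irrefl : ∀ x z → ¬ IsEdge H x x z
    IsEdge-irrefl x z (inj₁ (p , _)) = <-irrefl refl p
    IsEdge-irrefl x z (inj₂ (inj₁ (p , q , _))) = <-asym p q
    IsEdge-irrefl x z (inj₂ (inj₂ (inj₁ (p , _)))) = <-irrefl refl p
    IsEdge-irrefl x z (inj₂ (inj₂ (inj₂ (inj₁ (p , q , _))))) = <-asym p q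
    IsEdge-irrefl x z (inj₂ (inj₂ (inj₂ (inj₂ (inj₁ (p , q , _)))))) = <-irrefl refl q
    IsEdge-irrefl x z (inj₂ (inj₂ (inj₂ (inj₂ (inj₂ (p , q , _)))))) = <-irrefl refl q

    system : System n
    system = record
      { E = adjacent
      ; swap₁₂ = adjacent-swap₁₂
      ; swap₂₃ = adjacent-swap₂₃
      ; irrefl = λ x z → irreflexive x z (adjacent x x z) refl
      }
      where
      irreflexive : ∀ x z b → adjacent x x z ≡ b → adjacent x x z ≡ false
      irreflexive x z true eq = ⊥-elim (IsEdge-irrefl x z (adjacent⇒IsEdge x x z eq))
      irreflexive x z false eq = eq

    -- At most one of the six orders of x, y, z is increasing.
    adjacent-sum : ∀ x y z → ⟦ adjacent x y z ⟧ ≡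
      ⟦ increasing x y z ⟧ + ⟦ increasing x z y ⟧ + ⟦ increasing y x z ⟧ + ⟦ increasing y z x ⟧ + ⟦ increasing z x y ⟧ + ⟦ increasing z y x ⟧
    adjacent-sum x y z = ≤-antisym
      (byTable 6 (λ a b c d e f → ⟦ a ∨ b ∨ c ∨ d ∨ e ∨ f ⟧) (λ a b c d e f → ⟦ a ⟧ + ⟦ b ⟧ + ⟦ c ⟧ + ⟦ d ⟧ + ⟦ e ⟧ + ⟦ f ⟧)
        (increasing x y z) (increasing x z y) (increasing y x z) (increasing y z x) (increasing z x y) (increasing z y x))
      (≤-trans (≤-reflexive (sym (trans (cong (λ g → six * ⟦ g ⟧) guarded) (*-identityʳ six))))
        (byTable 12
          (λ a a′ b b′ c c′ h₁ h₂ h₃ h₄ h₅ h₆ →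
            (⟦ a ∧ b ∧ h₁ ⟧ + ⟦ c ∧ b′ ∧ h₂ ⟧ + ⟦ a′ ∧ c ∧ h₃ ⟧ + ⟦ b ∧ c′ ∧ h₄ ⟧ + ⟦ c′ ∧ a ∧ h₅ ⟧ + ⟦ b′ ∧ a′ ∧ h₆ ⟧)
              * ⟦ not (a ∧ a′) ∧ not (b ∧ b′) ∧ not (c ∧ c′) ∧ not (a ∧ b ∧ c′) ∧ not (a′ ∧ b′ ∧ c) ⟧)
          (λ a a′ b b′ c c′ h₁ h₂ h₃ h₄ h₅ h₆ →
            ⟦ (a ∧ b ∧ h₁) ∨ (c ∧ b′ ∧ h₂) ∨ (a′ ∧ c ∧ h₃) ∨ (b ∧ c′ ∧ h₄) ∨ (c′ ∧ a ∧ h₅) ∨ (b′ ∧ a′ ∧ h₆) ⟧)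
          (does (x <? y)) (does (y <? x)) (does (y <? z)) (does (z <? y)) (does (x <? z)) (does (z <? x))
          (H x y z) (H x z y) (H y x z) (H y z x) (H z x y) (H z y x)))
      where
      six : ℕ
      six = ⟦ increasing x y z ⟧ + ⟦ increasing x z y ⟧ + ⟦ increasing y x z ⟧ + ⟦ increasing y z x ⟧ + ⟦ increasing z x y ⟧ + ⟦ increasing z y x ⟧
      asym : ∀ x y → not (does (x <? y) ∧ does (y <? x)) ≡ true
      asym x y = not-true λ h → <-asym (does-true (x <? y) (∧-left h)) (does-true (y <? x) (∧-right {does (x <? y)} h))
      acyclic : ∀ x y z → not (does (x <? y) ∧ does (y <? z) ∧ does (z <? x)) ≡ true
      acyclic x y z = not-true λ h → let (p , q , r) = ∧³ h in
        <-asym (<-trans (does-true (x <? y) p) (does-true (y <? z) q)) (does-true (z <? x) r)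
      acyclic′ : not (does (y <? x) ∧ does (z <? y) ∧ does (x <? z)) ≡ true
      acyclic′ = not-true λ h → let (p , q , r) = ∧³ h in
        <-asym (<-trans (does-true (z <? y) q) (does-true (y <? x) p)) (does-true (x <? z) r)
      guarded : _
      guarded = cong₂ _∧_ (asym x y) (cong₂ _∧_ (asym y z) (cong₂ _∧_ (asym x z) (cong₂ _∧_ (acyclic x y z) acyclic′)))

  listSum-tabulate : ∀ {n} (f : Fin n → ℕ) → listSum (tabulate f) ≡ ∑ f
  listSum-tabulate {zero} f = sym (∑-zero f)
  listSum-tabulate {suc n} f = trans (cong (f zero +_) (listSum-tabulate (f ∘ suc))) (sym (∑-suc f))

  listSum-allFin : ∀ {n} (f : Fin n → ℕ) → listSum (map f (allFin n)) ≡ ∑ f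
  listSum-allFin f = trans (cong listSum (map-tabulate id f)) (listSum-tabulate f)

  edges≡∑ : ∀ {n} (H : Graph3 n) → edges H ≡ ∑[ x ] ∑[ y ] ∑[ z ] ⟦ increasing H x y z ⟧
  edges≡∑ H = trans (listSum-allFin _) (∑-cong (λ x → trans (listSum-allFin _) (∑-cong (λ y → trans (listSum-allFin _)
    (∑-cong (λ z → indicator (increasing H x y z)))))))
    where
    indicator : ∀ b → (if b then 1 else 0) ≡ ⟦ b ⟧
    indicator true = refl
    indicator false = refl

  total≡6edges : ∀ {n} (H : Graph3 n) → System.total (system H) ≡ 6 * edges H
  total≡6edges {n} H = trans (∑-cong (λ x → ∑-cong (λ y → ∑-cong (λ z → adjacent-sum H x y z))))
    (trans split (trans (collect-six e (swap₂₃ I) (swap₁₂ I)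
      (trans (swap₁₂ (λ x y z → I x z y)) (swap₂₃ I)) (trans (swap₂₃ (λ x y z → I y x z)) (swap₁₂ I))
      (trans (swap₁₂ (λ x y z → I z x y)) (trans (swap₂₃ (λ x y z → I y x z)) (swap₁₂ I)))) (cong (6 *_) (sym (edges≡∑ H)))))
    where
    I : Fin n → Fin n → Fin n → ℕ
    I x y z = ⟦ increasing H x y z ⟧
    ∑³ : (Fin n → Fin n → Fin n → ℕ) → ℕ
    ∑³ f = ∑[ x ] ∑[ y ] ∑[ z ] f x y z
    e = ∑³ I
    swap₁₂ : ∀ f → ∑³ (λ x y z → f y x z) ≡ ∑³ f
    swap₁₂ f = ∑-swap (λ x y → ∑[ z ] f y x z)
    swap₂₃ : ∀ f → ∑³ (λ x y z → f x z y) ≡ ∑³ f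
    swap₂₃ f = ∑-cong (λ x → ∑-swap (λ y z → f x z y))
    ∑³-+ : ∀ f g → ∑³ (λ x y z → f x y z + g x y z) ≡ ∑³ f + ∑³ g
    ∑³-+ f g = trans (∑-cong (λ x → trans (∑-cong (λ y → ∑-+ (f x y) (g x y))) (∑-+ (λ y → ∑ (f x y)) (λ y → ∑ (g x y)))))
      (∑-+ (λ x → ∑[ y ] ∑ (f x y)) (λ x → ∑[ y ] ∑ (g x y)))
    split : ∑³ (λ x y z → I x y z + I x z y + I y x z + I y z x + I z x y + I z y x) ≡
      ∑³ I + ∑³ (λ x y z → I x z y) + ∑³ (λ x y z → I y x z) + ∑³ (λ x y z → I y z x) + ∑³ (λ x y z → I z x y) + ∑³ (λ x y z → I z y x)
    split = trans (∑³-+ (λ x y z → I x y z + I x z y + I y x z + I y z x + I z x y) (λ x y z → I z y x)) (cong (_+ ∑³ (λ x y z → I z y x))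
      (trans (∑³-+ (λ x y z → I x y z + I x z y + I y x z + I y z x) (λ x y z → I z x y)) (cong (_+ ∑³ (λ x y z → I z x y))
      (trans (∑³-+ (λ x y z → I x y z + I x z y + I y x z) (λ x y z → I y z x)) (cong (_+ ∑³ (λ x y z → I y z x))
      (trans (∑³-+ (λ x y z → I x y z + I x z y) (λ x y z → I y x z)) (cong (_+ ∑³ (λ x y z → I y x z))
      (∑³-+ I (λ x y z → I x z y)))))))))

  module Isolate {n} (S : System n) (X : Fin n → Bool) where
    open System S

    isolate : System n
    isolate = record
      { E = λ x y z → not (X x) ∧ not (X y) ∧ not (X z) ∧ E x y z
      ; swap₁₂ = λ x y z → trans (cong (λ e → not (X x) ∧ not (X y) ∧ not (X z) ∧ e) (swap₁₂ x y z)) (reorder₁₂ (not (X x)) (not (X y)) _)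
      ; swap₂₃ = λ x y z → trans (cong (λ e → not (X x) ∧ not (X y) ∧ not (X z) ∧ e) (swap₂₃ x y z))
          (cong (not (X x) ∧_) (reorder₁₂ (not (X y)) (not (X z)) _))
      ; irrefl = λ x z → trans (cong (λ e → not (X x) ∧ not (X x) ∧ not (X z) ∧ e) (irrefl x z)) (absorb (not (X x)) (not (X z)))
      }
      where
      reorder₁₂ : ∀ a b c → a ∧ b ∧ c ≡ b ∧ a ∧ c
      reorder₁₂ true true c = refl
      reorder₁₂ true false c = refl
      reorder₁₂ false true c = refl
      reorder₁₂ false false c = refl
      absorb : ∀ a b → a ∧ a ∧ b ∧ false ≡ false
      absorb true true = refl
      absorb true false = refl
      absorb false b = refl

    private
      module I = System isolate

    isolate-E : ∀ x y z → I.E x y z ≡ true → E x y z ≡ true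
    isolate-E x y z h = ∧-right {not (X z)} (∧-right {not (X y)} (∧-right {not (X x)} h))

    isolate-first : ∀ x y z → I.E x y z ≡ true → X x ≡ false
    isolate-first x y z h with X x | h
    ... | false | _ = refl

    isolate-deg : ∀ v → deg v ≤ I.deg v + 2 * (n * card X) + n * n * ⟦ X v ⟧
    isolate-deg v = ≤-trans (∑-+-mono (λ y → ∑-+-mono {h = λ z → ⟦ X y ⟧ + ⟦ X z ⟧ + ⟦ X v ⟧} (λ z → byTable 4
        (λ a b c e → ⟦ e ⟧) (λ a b c e → ⟦ not a ∧ not b ∧ not c ∧ e ⟧ + (⟦ b ⟧ + ⟦ c ⟧ + ⟦ a ⟧)) (X v) (X y) (X z) (E v y z))))
      (≤-reflexive (trans (cong (I.deg v +_) rest) (regroup (I.deg v) (n * card X) (n * n * ⟦ X v ⟧))))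
      where
      rest : ∑[ y ] ∑[ z ] (⟦ X y ⟧ + ⟦ X z ⟧ + ⟦ X v ⟧) ≡ n * card X + n * card X + n * n * ⟦ X v ⟧
      rest = trans (∑-cong (λ y → trans (∑-+ (λ z → ⟦ X y ⟧ + ⟦ X z ⟧) (λ _ → ⟦ X v ⟧)) (cong₂ _+_
          (trans (∑-+ (λ _ → ⟦ X y ⟧) (λ z → ⟦ X z ⟧)) (cong (_+ card X) (∑-const n ⟦ X y ⟧))) (∑-const n ⟦ X v ⟧))))
        (trans (∑-+ (λ y → n * ⟦ X y ⟧ + card X) (λ _ → n * ⟦ X v ⟧)) (cong₂ _+_
          (trans (∑-+ (λ y → n * ⟦ X y ⟧) (λ _ → card X)) (cong₂ _+_ (∑-*ˡ n (λ y → ⟦ X y ⟧)) (∑-const n (card X))))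
          (trans (∑-const n (n * ⟦ X v ⟧)) (sym (*-assoc n n ⟦ X v ⟧)))))

    -- A lost ordered triple has a vertex of X in one of its three positions, and by symmetry the
    -- positions contribute equal sums.
    isolate-total : total ≤ I.total + 3 * ∑[ v ] (⟦ X v ⟧ * deg v)
    isolate-total = ≤-trans (∑-+-mono {g = I.deg} {h = λ x → t₁ x + (t₂ x + t₃ x)} (λ x → ≤-trans (∑-+-mono (λ y → ∑-+-mono
        {h = λ z → ⟦ X x ∧ E x y z ⟧ + (⟦ X y ∧ E x y z ⟧ + ⟦ X z ∧ E x y z ⟧)} (λ z → byTable 4
        (λ a b c e → ⟦ e ⟧) (λ a b c e → ⟦ not a ∧ not b ∧ not c ∧ e ⟧ + (⟦ a ∧ e ⟧ + (⟦ b ∧ e ⟧ + ⟦ c ∧ e ⟧))) (X x) (X y) (X z) (E x y z))))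
        (+-monoʳ-≤ (I.deg x) (≤-reflexive (separate x)))))
      (+-monoʳ-≤ I.total (≤-reflexive (trans (∑-+ t₁ (λ x → t₂ x + t₃ x)) (trans (cong (∑ t₁ +_) (∑-+ t₂ t₃))
        (trans (cong₂ _+_ eq₁ (cong₂ _+_ eq₂ (trans eq₃ eq₂))) (cong (σ +_) (cong (σ +_) (sym (+-identityʳ σ)))))))))
      where
      t₁ t₂ t₃ : Fin n → ℕ
      t₁ x = ∑[ y ] ∑[ z ] ⟦ X x ∧ E x y z ⟧
      t₂ x = ∑[ y ] ∑[ z ] ⟦ X y ∧ E x y z ⟧
      t₃ x = ∑[ y ] ∑[ z ] ⟦ X z ∧ E x y z ⟧
      σ : ℕ
      σ = ∑[ v ] (⟦ X v ⟧ * deg v)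
      separate : ∀ x → ∑[ y ] ∑[ z ] (⟦ X x ∧ E x y z ⟧ + (⟦ X y ∧ E x y z ⟧ + ⟦ X z ∧ E x y z ⟧)) ≡ t₁ x + (t₂ x + t₃ x)
      separate x = trans (∑-cong (λ y → trans (∑-+ (λ z → ⟦ X x ∧ E x y z ⟧) (λ z → ⟦ X y ∧ E x y z ⟧ + ⟦ X z ∧ E x y z ⟧))
          (cong (∑[ z ] ⟦ X x ∧ E x y z ⟧ +_) (∑-+ (λ z → ⟦ X y ∧ E x y z ⟧) (λ z → ⟦ X z ∧ E x y z ⟧)))))
        (trans (∑-+ (λ y → ∑[ z ] ⟦ X x ∧ E x y z ⟧) (λ y → ∑[ z ] ⟦ X y ∧ E x y z ⟧ + ∑[ z ] ⟦ X z ∧ E x y z ⟧))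
          (cong (t₁ x +_) (∑-+ (λ y → ∑[ z ] ⟦ X y ∧ E x y z ⟧) (λ y → ∑[ z ] ⟦ X z ∧ E x y z ⟧))))
      eq₁ : ∑ t₁ ≡ σ
      eq₁ = ∑-cong (λ x → ∑²-∧ (X x) (E x))
      eq₂ : ∑ t₂ ≡ σ
      eq₂ = trans (∑-swap (λ x y → ∑[ z ] ⟦ X y ∧ E x y z ⟧)) (∑-cong (λ y → trans
        (∑-cong (λ x → ∑-cong (λ z → cong (λ e → ⟦ X y ∧ e ⟧) (swap₁₂ x y z)))) (∑²-∧ (X y) (E y))))
      eq₃ : ∑ t₃ ≡ ∑ t₂
      eq₃ = ∑-cong (λ x → trans (∑-swap (λ y z → ⟦ X z ∧ E x y z ⟧))
        (∑-cong (λ z → ∑-cong (λ y → cong (λ e → ⟦ X z ∧ e ⟧) (swap₂₃ x y z)))))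

-- Embedding `F5S m` into a host.

module Embeddings where
  open import Defs
  open import Data.Nat using (_<_; _<?_)
  open import Data.Nat.Properties using (≤-trans; ≤-antisym; ≤-pred; *-comm; ≮⇒≥; <-irrefl; ≡ᵇ⇒≡; <ᵇ⇒<; m≤m+n; ≤ᵇ⇒≤)
  open import Data.Nat.DivMod using (_%_; _/_; _mod_; m%n<n; m≡m%n+[m/n]*n; m<n*o⇒m/o<n)
  open import Data.Fin using (fromℕ<; punchIn)
  open import Data.Fin.Properties using (toℕ-fromℕ<; toℕ-injective; toℕ<n; punchIn-injective; punchInᵢ≢i; any?; _≟_)
  open import Data.Fin.Patterns using (0F; 1F; 2F)
  open import Function.Definitions using (Injective)
  open Sums using (∧-left; ∧-right)
  open Systems
  open Graphs

  avoid : ∀ {n k} (A : Fin (suc k) → Fin n) → Injective _≡_ _≡_ A → ∀ z →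
    Σ (Fin k → Fin (suc k)) λ s → Injective _≡_ _≡_ s × (∀ i → A (s i) ≢ z)
  avoid A A-inj z with any? (λ i → A i ≟ z)
  ... | yes (i , eq) = punchIn i , punchIn-injective i _ _ , λ j eq′ → punchInᵢ≢i i j (A-inj (trans eq′ (sym eq)))
  ... | no none = punchIn zero , punchIn-injective zero _ _ , λ j eq → none (_ , eq)

  avoid₃ : ∀ {n k} (A : Fin (suc (suc (suc k))) → Fin n) → Injective _≡_ _≡_ A → ∀ x y z →
    Σ (Fin k → Fin (suc (suc (suc k)))) λ s → Injective _≡_ _≡_ s ×
      (∀ i → A (s i) ≢ x) × (∀ i → A (s i) ≢ y) × (∀ i → A (s i) ≢ z)
  avoid₃ A A-inj x y z with avoid A A-inj x
  ... | s , s-inj , ≢x with avoid (A ∘ s) (s-inj ∘ A-inj) y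
  ... | t , t-inj , ≢y with avoid (A ∘ s ∘ t) (t-inj ∘ s-inj ∘ A-inj) z
  ... | u , u-inj , ≢z = s ∘ t ∘ u , u-inj ∘ t-inj ∘ s-inj , ≢x ∘ t ∘ u , ≢y ∘ u , ≢z

  record Copy {n a} (H : Graph3 n) (F : Graph3 a) : Set where
    field
      at : Fin a → Fin n
      at-injective : Injective _≡_ _≡_ at
      at-edge : ∀ p q r → IsEdge F p q r → IsEdge H (at p) (at q) (at r)

  -- Two adjacent transpositions generate all orders of a triple, so a symmetric property has to be
  -- checked on increasing triples only.
  symmetric-edge : ∀ {a} (F : Graph3 a) (P : Fin a → Fin a → Fin a → Set) →
    (∀ p q r → P p q r → P q p r) → (∀ p q r → P p q r → P p r q) →
    (∀ p q r → Inc F p q r → P p q r) → ∀ p q r → IsEdge F p q r → P p q r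
  symmetric-edge F P s₁₂ s₂₃ h p q r (inj₁ e) = h p q r e
  symmetric-edge F P s₁₂ s₂₃ h p q r (inj₂ (inj₁ e)) = s₂₃ p r q (h p r q e)
  symmetric-edge F P s₁₂ s₂₃ h p q r (inj₂ (inj₂ (inj₁ e))) = s₁₂ q p r (h q p r e)
  symmetric-edge F P s₁₂ s₂₃ h p q r (inj₂ (inj₂ (inj₂ (inj₁ e)))) = s₁₂ q p r (s₂₃ q r p (h q r p e))
  symmetric-edge F P s₁₂ s₂₃ h p q r (inj₂ (inj₂ (inj₂ (inj₂ (inj₁ e))))) = s₂₃ p r q (s₁₂ r p q (h r p q e))
  symmetric-edge F P s₁₂ s₂₃ h p q r (inj₂ (inj₂ (inj₂ (inj₂ (inj₂ e))))) =
    s₁₂ q p r (s₂₃ q r p (s₁₂ r q p (h r q p e)))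

  module FromConfig {n} (H : Graph3 n) (X : Fin n → Bool) (k : ℕ)
    (C : Config (Isolate.isolate (system H) X) (suc (suc (suc (suc (suc k)))))) where

    private
      m : ℕ
      m = suc (suc k)

    open System (Isolate.isolate (system H) X)
    open Config C

    private
      chosenA = avoid₃ A A-inj x y z
      chosenB = avoid₃ B B-inj x y z
      chosenD = avoid₃ D D-inj x y z
      sA = proj₁ chosenA
      sB = proj₁ chosenB
      sD = proj₁ chosenD

      edge-≢₁₂ : ∀ {u v w} → E u v w ≡ true → u ≢ v
      edge-≢₁₂ {u} {v} {w} e refl with trans (sym e) (irrefl u w)
      ... | ()

      edge-≢₂₃ : ∀ {u v w} → E u v w ≡ true → v ≢ w
      edge-≢₂₃ {u} {v} {w} e = edge-≢₁₂ (trans (sym (rot u v w)) e)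

      edge-≢₁₃ : ∀ {u v w} → E u v w ≡ true → u ≢ w
      edge-≢₁₃ {u} {v} {w} e = edge-≢₁₂ (trans (sym (swap₂₃ u v w)) e)

    -- Row r and position i stand for the vertex 3i + r of `F5S m`. The vertices 0 and 3 of the
    -- extra hyperedge are the first two positions of row 0, hence go to x and y, while 3m goes to
    -- z.
    point : Fin 3 → Fin m → Fin n
    point 0F zero = x
    point 0F (suc zero) = y
    point 0F (suc (suc i)) = D (sD (suc (suc i)))
    point 1F i = A (sA i)
    point 2F i = B (sB i)

    point-edge₁₂₀ : ∀ i j l → E (point 1F j) (point 2F l) (point 0F i) ≡ true
    point-edge₁₂₀ zero j l = ABx (sA j) (sB l)
    point-edge₁₂₀ (suc zero) j l = ABy (sA j) (sB l)
    point-edge₁₂₀ (suc (suc i)) j l = ABD (sA j) (sB l) (sD (suc (suc i)))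

    point-edge : ∀ r s t i j l → distinct3 (toℕ r) (toℕ s) (toℕ t) ≡ true → E (point r i) (point s j) (point t l) ≡ true
    point-edge 0F 1F 2F i j l _ = trans (rot _ _ _) (point-edge₁₂₀ i j l)
    point-edge 0F 2F 1F i j l _ = trans (swap₂₃ _ _ _) (trans (rot _ _ _) (point-edge₁₂₀ i l j))
    point-edge 1F 0F 2F i j l _ = trans (swap₂₃ _ _ _) (point-edge₁₂₀ j i l)
    point-edge 1F 2F 0F i j l _ = point-edge₁₂₀ l i j
    point-edge 2F 0F 1F i j l _ = trans (rot′ _ _ _) (point-edge₁₂₀ j l i)
    point-edge 2F 1F 0F i j l _ = trans (swap₁₂ _ _ _) (point-edge₁₂₀ l j i)
    point-edge 0F 0F 0F i j l ()
    point-edge 0F 0F 1F i j l ()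
    point-edge 0F 0F 2F i j l ()
    point-edge 0F 1F 0F i j l ()
    point-edge 0F 1F 1F i j l ()
    point-edge 0F 2F 0F i j l ()
    point-edge 0F 2F 2F i j l ()
    point-edge 1F 0F 0F i j l ()
    point-edge 1F 0F 1F i j l ()
    point-edge 1F 1F 0F i j l ()
    point-edge 1F 1F 1F i j l ()
    point-edge 1F 1F 2F i j l ()
    point-edge 1F 2F 1F i j l ()
    point-edge 1F 2F 2F i j l ()
    point-edge 2F 0F 0F i j l ()
    point-edge 2F 0F 2F i j l ()
    point-edge 2F 1F 1F i j l ()
    point-edge 2F 1F 2F i j l ()
    point-edge 2F 2F 0F i j l ()
    point-edge 2F 2F 1F i j l ()
    point-edge 2F 2F 2F i j l ()

    point≢z : ∀ r i → point r i ≢ z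
    point≢z 0F zero = edge-≢₁₃ xyz
    point≢z 0F (suc zero) = edge-≢₂₃ xyz
    point≢z 0F (suc (suc i)) = proj₂ (proj₂ (proj₂ (proj₂ chosenD))) (suc (suc i))
    point≢z 1F i = proj₂ (proj₂ (proj₂ (proj₂ chosenA))) i
    point≢z 2F i = proj₂ (proj₂ (proj₂ (proj₂ chosenB))) i

    point-injective : ∀ r s i j → point r i ≡ point s j → r ≡ s × i ≡ j
    point-injective 0F 0F zero zero _ = refl , refl
    point-injective 0F 0F zero (suc zero) eq = ⊥-elim (edge-≢₁₂ xyz eq)
    point-injective 0F 0F zero (suc (suc j)) eq = ⊥-elim (proj₁ (proj₂ (proj₂ chosenD)) (suc (suc j)) (sym eq))
    point-injective 0F 0F (suc zero) zero eq = ⊥-elim (edge-≢₁₂ xyz (sym eq))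
    point-injective 0F 0F (suc zero) (suc zero) _ = refl , refl
    point-injective 0F 0F (suc zero) (suc (suc j)) eq = ⊥-elim (proj₁ (proj₂ (proj₂ (proj₂ chosenD))) (suc (suc j)) (sym eq))
    point-injective 0F 0F (suc (suc i)) zero eq = ⊥-elim (proj₁ (proj₂ (proj₂ chosenD)) (suc (suc i)) eq)
    point-injective 0F 0F (suc (suc i)) (suc zero) eq = ⊥-elim (proj₁ (proj₂ (proj₂ (proj₂ chosenD))) (suc (suc i)) eq)
    point-injective 0F 0F (suc (suc i)) (suc (suc j)) eq = refl , proj₁ (proj₂ chosenD) (D-inj eq)
    point-injective 1F 1F i j eq = refl , proj₁ (proj₂ chosenA) (A-inj eq)
    point-injective 2F 2F i j eq = refl , proj₁ (proj₂ chosenB) (B-inj eq)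
    -- Entries of different rows lie together in an edge, and vertices of an edge are distinct.
    point-injective 0F 1F i j eq = ⊥-elim (edge-≢₁₃ (point-edge₁₂₀ i j zero) (sym eq))
    point-injective 0F 2F i j eq = ⊥-elim (edge-≢₂₃ (point-edge₁₂₀ i zero j) (sym eq))
    point-injective 1F 0F i j eq = ⊥-elim (edge-≢₁₃ (point-edge₁₂₀ j i zero) eq)
    point-injective 1F 2F i j eq = ⊥-elim (edge-≢₁₂ (point-edge₁₂₀ zero i j) eq)
    point-injective 2F 0F i j eq = ⊥-elim (edge-≢₂₃ (point-edge₁₂₀ j zero i) eq)
    point-injective 2F 1F i j eq = ⊥-elim (edge-≢₁₂ (point-edge₁₂₀ zero j i) (sym eq))

    quotient< : ∀ {a} → a < 3 * m → a / 3 < m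
    quotient< {a} p = m<n*o⇒m/o<n {a} {m} {3} (subst (a <_) (*-comm 3 m) p)

    vertex : ∀ a → Dec (a < 3 * m) → Fin n
    vertex a (yes p) = point (a mod 3) (fromℕ< (quotient< p))
    vertex a (no _) = z

    vertex-injective : ∀ a b (d : Dec (a < 3 * m)) (d′ : Dec (b < 3 * m)) → a < suc (3 * m) → b < suc (3 * m) →
                       vertex a d ≡ vertex b d′ → a ≡ b
    vertex-injective a b (yes p) (yes p′) _ _ eq = trans (m≡m%n+[m/n]*n a 3) (trans
        (cong₂ (λ u v → u + v * 3) residues quotients) (sym (m≡m%n+[m/n]*n b 3)))
      where
      both = point-injective (a mod 3) (b mod 3) _ _ eq
      residues : a % 3 ≡ b % 3
      residues = trans (sym (toℕ-fromℕ< (m%n<n a 3))) (trans (cong toℕ (proj₁ both)) (toℕ-fromℕ< (m%n<n b 3)))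
      quotients : a / 3 ≡ b / 3
      quotients = trans (sym (toℕ-fromℕ< (quotient< p))) (trans (cong toℕ (proj₂ both)) (toℕ-fromℕ< (quotient< p′)))
    vertex-injective a b (yes p) (no _) _ _ eq = ⊥-elim (point≢z (a mod 3) (fromℕ< (quotient< p)) eq)
    vertex-injective a b (no _) (yes p) _ _ eq = ⊥-elim (point≢z (b mod 3) (fromℕ< (quotient< p)) (sym eq))
    vertex-injective a b (no ¬p) (no ¬p′) q q′ _ =
      trans (≤-antisym (≤-pred q) (≮⇒≥ ¬p)) (≤-antisym (≮⇒≥ ¬p′) (≤-pred q′))

    vertex-edge : ∀ a b c (d : Dec (a < 3 * m)) (d′ : Dec (b < 3 * m)) (d″ : Dec (c < 3 * m)) →
      a < 3 * m → b < 3 * m → c < 3 * m → distinct3 (a % 3) (b % 3) (c % 3) ≡ true →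
      E (vertex a d) (vertex b d′) (vertex c d″) ≡ true
    vertex-edge a b c (yes p) (yes p′) (yes p″) _ _ _ h = point-edge (a mod 3) (b mod 3) (c mod 3) _ _ _
      (trans (cong₃ (toℕ-fromℕ< (m%n<n a 3)) (toℕ-fromℕ< (m%n<n b 3)) (toℕ-fromℕ< (m%n<n c 3))) h)
      where
      cong₃ : ∀ {u u′ v v′ w w′} → u ≡ u′ → v ≡ v′ → w ≡ w′ → distinct3 u v w ≡ distinct3 u′ v′ w′
      cong₃ refl refl refl = refl
    vertex-edge a b c (no ¬p) _ _ p _ _ _ = ⊥-elim (¬p p)
    vertex-edge a b c (yes _) (no ¬p) _ _ p _ _ = ⊥-elim (¬p p)
    vertex-edge a b c (yes _) (yes _) (no ¬p) _ _ p _ = ⊥-elim (¬p p)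

    vertex-pendant : (d : Dec (0 < 3 * m)) (d′ : Dec (3 < 3 * m)) (d″ : Dec (3 * m < 3 * m)) →
      E (vertex 0 d) (vertex 3 d′) (vertex (3 * m) d″) ≡ true
    vertex-pendant (yes _) (yes _) (no _) = xyz
    vertex-pendant _ _ (yes p) = ⊥-elim (<-irrefl refl p)
    vertex-pendant (no ¬p) _ _ = ⊥-elim (¬p (s≤s z≤n))
    vertex-pendant (yes _) (no ¬p) (no _) = ⊥-elim (¬p (subst (3 <_) (*-comm m 3) (≤-trans (≤ᵇ⇒≤ 4 6 tt) (m≤m+n 6 (k * 3)))))

    place : Fin (suc (3 * m)) → Fin n
    place p = vertex (toℕ p) (toℕ p <? 3 * m)

    place-edge : ∀ p q r → Inc (F5S m) p q r → E (place p) (place q) (place r) ≡ true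
    place-edge p q r (_ , _ , h) with ∨-elim {(toℕ p <ᵇ 3 * m) ∧ (toℕ q <ᵇ 3 * m) ∧ (toℕ r <ᵇ 3 * m) ∧ distinct3 (toℕ p % 3) (toℕ q % 3) (toℕ r % 3)} h
    ... | inj₁ e = vertex-edge (toℕ p) (toℕ q) (toℕ r) (toℕ p <? 3 * m) (toℕ q <? 3 * m) (toℕ r <? 3 * m) (below (toℕ p) (proj₁ parts)) (below (toℕ q) (proj₁ (proj₂ parts)))
          (below (toℕ r) (∧-left (proj₂ (proj₂ parts)))) (∧-right {toℕ r <ᵇ 3 * m} (proj₂ (proj₂ parts)))
      where
      parts = ∧³ e
      below : ∀ a → (a <ᵇ 3 * m) ≡ true → a < 3 * m
      below a eq = <ᵇ⇒< a (3 * m) (subst T (sym eq) tt)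
    ... | inj₂ e = pendant (toℕ p) (toℕ q) (toℕ r) (equal (toℕ p) 0 (proj₁ parts)) (equal (toℕ q) 3 (proj₁ (proj₂ parts)))
          (equal (toℕ r) (3 * m) (proj₂ (proj₂ parts)))
      where
      parts = ∧³ e
      equal : ∀ a b → (a ≡ᵇ b) ≡ true → a ≡ b
      equal a b eq = ≡ᵇ⇒≡ a b (subst T (sym eq) tt)
      pendant : ∀ a b c → a ≡ 0 → b ≡ 3 → c ≡ 3 * m →
        E (vertex a (a <? 3 * m)) (vertex b (b <? 3 * m)) (vertex c (c <? 3 * m)) ≡ true
      pendant _ _ _ refl refl refl = vertex-pendant (0 <? 3 * m) (3 <? 3 * m) (3 * m <? 3 * m)

    -- Every vertex of the copy lies on an edge of the isolated system, and such an edge avoids X.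
    point-outside : ∀ r i → X (point r i) ≡ false
    point-outside 0F i = Isolate.isolate-first (system H) X _ _ _ (point-edge 0F 1F 2F i zero zero refl)
    point-outside 1F i = Isolate.isolate-first (system H) X _ _ _ (point-edge 1F 0F 2F i zero zero refl)
    point-outside 2F i = Isolate.isolate-first (system H) X _ _ _ (point-edge 2F 0F 1F i zero zero refl)

    vertex-outside : ∀ a d → X (vertex a d) ≡ false
    vertex-outside a (yes p) = point-outside (a mod 3) (fromℕ< (quotient< p))
    vertex-outside a (no _) = Isolate.isolate-first (system H) X z x y (trans (rot z x y) xyz)

    copy : Copy H (F5S m)
    copy = record
      { at = place
      ; at-injective = λ {p} {q} eq → toℕ-injective (vertex-injective (toℕ p) (toℕ q) (toℕ p <? 3 * m) (toℕ q <? 3 * m) (toℕ<n p) (toℕ<n q) eq)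
      ; at-edge = λ p q r e → adjacent⇒IsEdge H (place p) (place q) (place r) (Isolate.isolate-E (system H) X (place p) (place q) (place r)
          (symmetric-edge (F5S m) (λ p q r → E (place p) (place q) (place r) ≡ true)
            (λ p q r → trans (swap₁₂ (place q) (place p) (place r))) (λ p q r → trans (swap₂₃ (place p) (place r) (place q))) place-edge p q r e))
      }

    copy-outside : ∀ p → X (Copy.at copy p) ≡ false
    copy-outside p = vertex-outside (toℕ p) (toℕ p <? 3 * m)

-- Vertex-disjoint copies, and their absence from `G t m n`.

module Packings where
  open import Defs
  open import Data.Nat using (_<_; _<?_)
  open import Data.Nat.Properties using (≤-refl; ≤-trans; *-comm; +-comm; ≮⇒≥; <-irrefl; ≡ᵇ⇒≡; ≡⇒≡ᵇ; <ᵇ⇒<; <⇒<ᵇ; m≤m+n; ≤ᵇ⇒≤; +-cancelˡ-<; m≤n⇒m≤1+n; <⇒≱)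
  open import Data.Nat.DivMod using (_%_; _/_; m%n<n; [m+kn]%n≡m%n; m<n⇒m%n≡m; m<n⇒m/n≡0; m*n/n≡m; +-distrib-/-∣ʳ)
  open import Data.Nat.Divisibility using (divides-refl)
  open import Data.Bool.Properties using (T-≡)
  open import Data.Fin using (fromℕ<; combine)
  open import Data.Fin.Properties using (toℕ-fromℕ<; toℕ-injective; toℕ<n; any?; toℕ-combine; combine-surjective; combine-injective; combine-injectiveˡ; pigeonhole)
  open import Function.Bundles using (Equivalence)
  open import Function.Definitions using (Injective)
  open import Relation.Binary.PropositionalEquality using (subst₂)
  open Sums using (∧-left; ∧-right)
  open Systems
  open Graphs
  open Embeddings

  T⇒≡ : ∀ {b} → T b → b ≡ true
  T⇒≡ = Equivalence.to T-≡

  ≡⇒T : ∀ {b} → b ≡ true → T b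
  ≡⇒T = Equivalence.from T-≡

  IsEdge-swap₁₂ : ∀ {n} (H : Graph3 n) x y z → IsEdge H x y z → IsEdge H y x z
  IsEdge-swap₁₂ H x y z e = adjacent⇒IsEdge H y x z (trans (sym (adjacent-swap₁₂ H x y z)) (IsEdge⇒adjacent H x y z e))

  IsEdge-swap₂₃ : ∀ {n} (H : Graph3 n) x y z → IsEdge H x y z → IsEdge H x z y
  IsEdge-swap₂₃ H x y z e = adjacent⇒IsEdge H x z y (trans (sym (adjacent-swap₂₃ H x y z)) (IsEdge⇒adjacent H x y z e))

  record Packing {n a} (H : Graph3 n) (F : Graph3 a) (k : ℕ) : Set where
    field
      member : Fin k → Copy H F
      disjoint : ∀ i j p q → Copy.at (member i) p ≡ Copy.at (member j) q → i ≡ j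

  module _ {k s : ℕ} where

    -- This is the block layout of `copies`: the quotient by the block length is the number of the
    -- copy, the remainder the vertex in it.
    index-combine : (i : Fin k) (p : Fin (suc s)) → toℕ (combine i p) ≡ toℕ p + toℕ i * suc s
    index-combine i p = trans (toℕ-combine {k} {suc s} i p) (trans (+-comm (suc s * toℕ i) (toℕ p)) (cong (toℕ p +_) (*-comm (suc s) (toℕ i))))

    block-combine : (i : Fin k) (p : Fin (suc s)) → toℕ (combine i p) / suc s ≡ toℕ i
    block-combine i p = trans (cong (_/ suc s) (index-combine i p))
      (trans (+-distrib-/-∣ʳ (toℕ p) {toℕ i * suc s} (divides-refl (toℕ i)))
        (cong₂ _+_ (m<n⇒m/n≡0 (toℕ<n p)) (m*n/n≡m (toℕ i) (suc s))))

    local-combine : (i : Fin k) (p : Fin (suc s)) → fromℕ< (m%n<n (toℕ (combine i p)) (suc s)) ≡ p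
    local-combine i p = toℕ-injective (trans (toℕ-fromℕ< (m%n<n (toℕ (combine i p)) (suc s)))
      (trans (cong (_% suc s) (index-combine i p)) (trans ([m+kn]%n≡m%n (toℕ p) (toℕ i) (suc s)) (m<n⇒m%n≡m (toℕ<n p)))))

    module _ (F : Graph3 (suc s)) where

      copies-combine : ∀ (i j l : Fin k) p q r → copies k s F (combine i p) (combine j q) (combine l r) ≡
        (toℕ i ≡ᵇ toℕ j) ∧ (toℕ j ≡ᵇ toℕ l) ∧ F p q r
      copies-combine i j l p q r = substituted
        (block-combine i p) (block-combine j q) (block-combine l r) (local-combine i p) (local-combine j q) (local-combine l r)
        where
        substituted : ∀ {a a′ b b′ c c′ u u′ v v′ w w′} → a ≡ a′ → b ≡ b′ → c ≡ c′ → u ≡ u′ → v ≡ v′ → w ≡ w′ →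
          (a ≡ᵇ b) ∧ (b ≡ᵇ c) ∧ F u v w ≡ (a′ ≡ᵇ b′) ∧ (b′ ≡ᵇ c′) ∧ F u′ v′ w′
        substituted refl refl refl refl refl refl = refl

      combine-< : ∀ (i : Fin k) p q → toℕ p < toℕ q → toℕ (combine i p) < toℕ (combine i q)
      combine-< i p q h = subst₂ _<_ (sym (toℕ-combine {k} {suc s} i p)) (sym (toℕ-combine {k} {suc s} i q)) (+-monoʳ-< (suc s * toℕ i) h)
        where open import Data.Nat.Properties using (+-monoʳ-<)

      combine-<⁻ : ∀ (i : Fin k) p q → toℕ (combine i p) < toℕ (combine i q) → toℕ p < toℕ q
      combine-<⁻ i p q h = +-cancelˡ-< (suc s * toℕ i) (toℕ p) (toℕ q) (subst₂ _<_ (toℕ-combine {k} {suc s} i p) (toℕ-combine {k} {suc s} i q) h)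

      Contains⇒Packing : ∀ {n} {H : Graph3 n} → Contains H (copies k s F) → Packing H F k
      Contains⇒Packing {H = H} (f , f-inj , f-edge) = record
        { member = λ i → record
          { at = λ p → f (combine i p)
          ; at-injective = λ eq → proj₂ (combine-injective {k} {suc s} i _ i _ (f-inj eq))
          ; at-edge = λ p q r → symmetric-edge F (λ p q r → IsEdge H (f (combine i p)) (f (combine i q)) (f (combine i r)))
              (λ p q r → IsEdge-swap₁₂ H _ _ _) (λ p q r → IsEdge-swap₂₃ H _ _ _)
              (λ p q r (p<q , q<r , e) → f-edge _ _ _ (inj₁ (combine-< i p q p<q , combine-< i q r q<r ,
                trans (copies-combine i i i p q r) (trans (cong (λ b → b ∧ b ∧ F p q r) (T⇒≡ (≡⇒≡ᵇ (toℕ i) (toℕ i) refl))) e))))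
              p q r
          }
        ; disjoint = λ i j p q eq → combine-injectiveˡ {k} {suc s} i p j q (f-inj eq)
        }

      Packing⇒Contains : ∀ {n} {H : Graph3 n} → Packing H F k → Contains H (copies k s F)
      Packing⇒Contains {n} {H} P = f , f-inj , λ x y z → symmetric-edge (copies k s F) (λ x y z → IsEdge H (f x) (f y) (f z))
          (λ x y z → IsEdge-swap₁₂ H _ _ _) (λ x y z → IsEdge-swap₂₃ H _ _ _) inc x y z
        where
        open Packing P
        split : (x : Fin (k * suc s)) → ∃[ i ] ∃[ p ] combine {k} {suc s} i p ≡ x
        split = combine-surjective
        f : Fin (k * suc s) → Fin n
        f x = Copy.at (member (proj₁ (split x))) (proj₁ (proj₂ (split x)))
        f-inj : Injective _≡_ _≡_ f
        f-inj {x} {y} = same (split x) (split y)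
          where
          same : (a : ∃[ i ] ∃[ p ] combine {k} {suc s} i p ≡ x) (b : ∃[ i ] ∃[ p ] combine {k} {suc s} i p ≡ y) →
            Copy.at (member (proj₁ a)) (proj₁ (proj₂ a)) ≡ Copy.at (member (proj₁ b)) (proj₁ (proj₂ b)) → x ≡ y
          same (i , p , refl) (j , q , refl) eq with disjoint i j p q eq
          ... | refl = cong (combine i) (Copy.at-injective (member i) eq)
        inc : ∀ x y z → Inc (copies k s F) x y z → IsEdge H (f x) (f y) (f z)
        inc x y z = edge (split x) (split y) (split z)
          where
          edge : (a : ∃[ i ] ∃[ p ] combine {k} {suc s} i p ≡ x) (b : ∃[ i ] ∃[ p ] combine {k} {suc s} i p ≡ y)
            (c : ∃[ i ] ∃[ p ] combine {k} {suc s} i p ≡ z) → Inc (copies k s F) x y z →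
            IsEdge H (Copy.at (member (proj₁ a)) (proj₁ (proj₂ a))) (Copy.at (member (proj₁ b)) (proj₁ (proj₂ b)))
              (Copy.at (member (proj₁ c)) (proj₁ (proj₂ c)))
          edge (i , p , refl) (j , q , refl) (l , r , refl) (x<y , y<z , e)
            with ∧³ (trans (sym (copies-combine i j l p q r)) e)
          ... | i≡j , j≡l , h with toℕ-injective {i = i} {j} (≡ᵇ⇒≡ _ _ (≡⇒T i≡j)) | toℕ-injective {i = j} {l} (≡ᵇ⇒≡ _ _ (≡⇒T j≡l))
          ... | refl | refl = Copy.at-edge (member i) p q r (inj₁ (combine-<⁻ i p q x<y , combine-<⁻ i q r y<z , h))

  module InG (t k n : ℕ) where

    private
      m : ℕ
      m = suc (suc k)

    3m-large : 6 ≤ 3 * m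
    3m-large = subst (6 ≤_) (*-comm m 3) (m≤m+n 6 (k * 3))

    node : ∀ a → a < suc (3 * m) → Fin (suc (3 * m))
    node a p = fromℕ< p

    node-edge : ∀ a b c (p : a < suc (3 * m)) (q : b < suc (3 * m)) (r : c < suc (3 * m)) → a < 3 * m → b < 3 * m → c < 3 * m →
      distinct3 (a % 3) (b % 3) (c % 3) ≡ true → F5S m (node a p) (node b q) (node c r) ≡ true
    node-edge a b c p q r a< b< c< h
      rewrite toℕ-fromℕ< p | toℕ-fromℕ< q | toℕ-fromℕ< r | T⇒≡ (<⇒<ᵇ a<) | T⇒≡ (<⇒<ᵇ b<) | T⇒≡ (<⇒<ᵇ c<) | h = refl

    node-pendant : ∀ p q r → F5S m (node 0 p) (node 3 q) (node (3 * m) r) ≡ true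
    node-pendant p q r = ∨-inj₂ {(toℕ (node 0 p) <ᵇ 3 * m) ∧ (toℕ (node 3 q) <ᵇ 3 * m) ∧ (toℕ (node (3 * m) r) <ᵇ 3 * m)
        ∧ distinct3 (toℕ (node 0 p) % 3) (toℕ (node 3 q) % 3) (toℕ (node (3 * m) r) % 3)} second
      where
      second : (toℕ (node 0 p) ≡ᵇ 0) ∧ (toℕ (node 3 q) ≡ᵇ 3) ∧ (toℕ (node (3 * m) r) ≡ᵇ 3 * m) ≡ true
      second = trans (cong₂ (λ u v → (u ≡ᵇ 3) ∧ (v ≡ᵇ 3 * m)) (toℕ-fromℕ< q) (toℕ-fromℕ< r)) (T⇒≡ (≡⇒≡ᵇ (3 * m) (3 * m) refl))

    node-< : ∀ a b p q → a < b → toℕ (node a p) < toℕ (node b q)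
    node-< a b p q h = subst₂ _<_ (sym (toℕ-fromℕ< p)) (sym (toℕ-fromℕ< q)) h

    colourG : Fin n → ℕ
    colourG u = (toℕ u ∸ t) % 3

    High : Fin n → Set
    High u = t ≤ toℕ u

    AllDifferent : ℕ → ℕ → ℕ → Set
    AllDifferent a b c = a ≢ b × b ≢ c × a ≢ c

    distinct3⇒ : ∀ a b c → distinct3 a b c ≡ true → AllDifferent a b c
    distinct3⇒ a b c h = differ a b (proj₁ parts) , differ b c (proj₁ (proj₂ parts)) , differ a c (proj₂ (proj₂ parts))
      where
      parts = ∧³ h
      differ : ∀ a b → not (a ≡ᵇ b) ≡ true → a ≢ b
      differ a b h refl with a ≡ᵇ a | T⇒≡ (≡⇒≡ᵇ a a refl)
      differ a b () refl | .true | refl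

    G-edge : ∀ x y z → IsEdge (G t m n) x y z → High x → High y → High z → AllDifferent (colourG x) (colourG y) (colourG z)
    G-edge = symmetric-edge (G t m n) (λ x y z → High x → High y → High z → AllDifferent (colourG x) (colourG y) (colourG z))
      (λ x y z h hy hx hz → let (p , q , r) = h hx hy hz in p ∘ sym , r , q)
      (λ x y z h hx hz hy → let (p , q , r) = h hx hy hz in r , q ∘ sym , p)
      (λ { x y z (_ , _ , e) hx hy hz → distinct3⇒ _ _ _ (strip (toℕ x <ᵇ t) (toℕ y <ᵇ t) (toℕ z <ᵇ t) (low x hx) (low y hy) (low z hz) e) })
      where
      low : ∀ x → High x → (toℕ x <ᵇ t) ≡ false
      low x h with toℕ x <ᵇ t in eq
      ... | false = refl
      ... | true = ⊥-elim (<⇒≱ (<ᵇ⇒< (toℕ x) t (≡⇒T eq)) h)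
      strip : ∀ a b c {d} → a ≡ false → b ≡ false → c ≡ false → a ∨ b ∨ c ∨ d ≡ true → d ≡ true
      strip _ _ _ refl refl refl h = h

    distinct-residues : ∀ a b c d → a < 3 → b < 3 → c < 3 → d < 3 → AllDifferent a b c → AllDifferent b c d → a ≡ d
    distinct-residues a b c d p q r s (a≢b , b≢c , a≢c) (_ , c≢d , b≢d) with a Data.Nat.≟ d
      where import Data.Nat
    ... | yes eq = eq
    ... | no a≢d = ⊥-elim (no-four (fromℕ< p) (fromℕ< q) (fromℕ< r) (fromℕ< s)
        (different p q a≢b) (different q r b≢c) (different p r a≢c) (different r s c≢d) (different q s b≢d) (different p s a≢d))
      where
      different : ∀ {a b} (p : a < 3) (q : b < 3) → a ≢ b → fromℕ< p ≢ fromℕ< q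
      different p q ne eq = ne (trans (sym (toℕ-fromℕ< p)) (trans (cong toℕ eq) (toℕ-fromℕ< q)))
      no-four : (a b c d : Fin 3) → a ≢ b → b ≢ c → a ≢ c → c ≢ d → b ≢ d → a ≢ d → ⊥
      no-four a b c d ab bc ac cd bd ad with pigeonhole {3} {4} ≤-refl (λ { zero → a ; (suc zero) → b ; (suc (suc zero)) → c ; (suc (suc (suc zero))) → d })
      ... | zero , suc zero , _ , eq = ab eq
      ... | zero , suc (suc zero) , _ , eq = ac eq
      ... | zero , suc (suc (suc zero)) , _ , eq = ad eq
      ... | suc zero , suc (suc zero) , _ , eq = bc eq
      ... | suc zero , suc (suc (suc zero)) , _ , eq = bd eq
      ... | suc (suc zero) , suc (suc (suc zero)) , _ , eq = cd eq
      ... | zero , zero , () , _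
      ... | suc zero , zero , () , _
      ... | suc zero , suc zero , s≤s () , _
      ... | suc (suc zero) , zero , () , _
      ... | suc (suc zero) , suc zero , s≤s () , _
      ... | suc (suc zero) , suc (suc zero) , s≤s (s≤s ()) , _
      ... | suc (suc (suc zero)) , zero , () , _
      ... | suc (suc (suc zero)) , suc zero , s≤s () , _
      ... | suc (suc (suc zero)) , suc (suc zero) , s≤s (s≤s ()) , _
      ... | suc (suc (suc zero)) , suc (suc (suc zero)) , s≤s (s≤s (s≤s ())) , _

    -- Outside T the graph is properly 3-coloured by residues, but `F5S m` has no such colouring:
    -- the edges 012 and 123 force the vertices 0 and 3 to agree, and the extra hyperedge forces
    -- them to differ.
    copy-meets-T : (c : Copy (G t m n) (F5S m)) → ∃[ p ] toℕ (Copy.at c p) < t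
    copy-meets-T c with any? (λ p → toℕ (Copy.at c p) <? t)
    ... | yes found = found
    ... | no none = ⊥-elim (proj₁ third first≡fourth)
      where
      open Copy c
      high : ∀ p → High (at p)
      high p = ≮⇒≥ (λ h → none (p , h))
      below : ∀ {a} → a ≤ 5 → a < 3 * m
      below h = ≤-trans (s≤s h) 3m-large
      l₀ = below {0} z≤n
      l₁ = below {1} (≤ᵇ⇒≤ 1 5 tt)
      l₂ = below {2} (≤ᵇ⇒≤ 2 5 tt)
      l₃ = below {3} (≤ᵇ⇒≤ 3 5 tt)
      w₀ = m≤n⇒m≤1+n l₀
      w₁ = m≤n⇒m≤1+n l₁
      w₂ = m≤n⇒m≤1+n l₂
      w₃ = m≤n⇒m≤1+n l₃
      wₘ : 3 * m < suc (3 * m)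
      wₘ = ≤-refl
      v0 = node 0 w₀
      v1 = node 1 w₁
      v2 = node 2 w₂
      v3 = node 3 w₃
      vₘ = node (3 * m) wₘ
      first = G-edge (at v0) (at v1) (at v2) (at-edge v0 v1 v2 (inj₁ (node-< 0 1 w₀ w₁ (s≤s z≤n) ,
        node-< 1 2 w₁ w₂ (s≤s (s≤s z≤n)) , node-edge 0 1 2 w₀ w₁ w₂ l₀ l₁ l₂ refl))) (high v0) (high v1) (high v2)
      second = G-edge (at v1) (at v2) (at v3) (at-edge v1 v2 v3 (inj₁ (node-< 1 2 w₁ w₂ (s≤s (s≤s z≤n)) ,
        node-< 2 3 w₂ w₃ (s≤s (s≤s (s≤s z≤n))) , node-edge 1 2 3 w₁ w₂ w₃ l₁ l₂ l₃ refl))) (high v1) (high v2) (high v3)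
      third = G-edge (at v0) (at v3) (at vₘ) (at-edge v0 v3 vₘ (inj₁ (node-< 0 3 w₀ w₃ (s≤s z≤n) ,
        node-< 3 (3 * m) w₃ wₘ l₃ , node-pendant w₀ w₃ wₘ))) (high v0) (high v3) (high vₘ)
      residue : ∀ p → colourG (at p) < 3
      residue p = m%n<n (toℕ (at p) ∸ t) 3
      first≡fourth : colourG (at v0) ≡ colourG (at v3)
      first≡fourth = distinct-residues _ _ _ _ (residue v0) (residue v1) (residue v2) (residue v3) first second

    -- Disjoint copies would meet T in distinct vertices, and T has fewer vertices than there are
    -- copies.
    no-packing : ¬ Packing (G t m n) (F5S m) (suc t)
    no-packing P = clash (pigeonhole ≤-refl (λ i → fromℕ< (proj₂ (hit i))))
      where
      open Packing P
      hit : ∀ i → ∃[ p ] toℕ (Copy.at (member i) p) < t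
      hit i = copy-meets-T (member i)
      clash : ¬ (∃[ i ] ∃[ j ] (toℕ i < toℕ j × fromℕ< (proj₂ (hit i)) ≡ fromℕ< (proj₂ (hit j))))
      clash (i , j , i<j , eq) = <-irrefl (cong toℕ (disjoint i j (proj₁ (hit i)) (proj₁ (hit j)) (toℕ-injective
        (trans (sym (toℕ-fromℕ< (proj₂ (hit i)))) (trans (cong toℕ eq) (toℕ-fromℕ< (proj₂ (hit j)))))))) i<j

    G-free : ¬ Contains (G t m n) (manyF5S t m)
    G-free = no-packing ∘ Contains⇒Packing (F5S m)

-- Balanced products, the extremal count, and vertex deletion.

module TuránNumbers where
  open import Defs
  open import Data.Nat.Properties hiding (_<?_)
  open import Data.Nat.DivMod using (_%_; [m+n]%n≡m%n)
  open import Data.Fin as Fin using (Fin; zero; suc; toℕ; punchIn)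
  open import Data.Fin.Properties using (toℕ-injective)
  open import Relation.Binary using (tri<; tri≈; tri>)
  open Certificates
  open Estimates
  open Sums
  open TripleCounts
  open Systems
  open Graphs
  open Embeddings using (symmetric-edge)
  open Packings using (T⇒≡; ≡⇒T)

  -- part₀ n, part₁ n, part₂ n count the i < n with i mod 3 = 0, 1, 2; shifting
  -- the indices by one rotates the classes.
  part₀ part₁ part₂ : ℕ → ℕ
  part₀ zero = 0
  part₀ (suc n) = suc (part₂ n)
  part₁ zero = 0
  part₁ (suc n) = part₀ n
  part₂ zero = 0
  part₂ (suc n) = part₁ n

  parts-balanced : ∀ n → part₀ n + part₁ n + part₂ n ≡ n × part₁ n ≤ part₀ n × part₂ n ≤ part₁ n × part₀ n ≤ suc (part₂ n)
  parts-balanced zero = refl , z≤n , z≤n , z≤n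
  parts-balanced (suc n) with parts-balanced n
  ... | s , p , q , r = cong suc (trans (rotate (part₂ n) (part₀ n) (part₁ n)) s) , r , p , s≤s q
    where
    rotate : ∀ c a b → c + a + b ≡ a + b + c
    rotate c a b = trans (+-assoc c a b) (+-comm c (a + b))

  P : ℕ → ℕ
  P n = part₀ n * part₁ n * part₂ n

  P-suc : ∀ n → P (suc n) ≡ P n + part₀ n * part₁ n
  P-suc n = P-arith (part₀ n) (part₁ n) (part₂ n)

  -- Induction on n: one element is taken from a largest class, which costs the product of the other
  -- two. `largest-first` is the step after sorting, and both are proved together.
  parts-product : ∀ n x y z → x + y + z ≤ n → x * y * z ≤ P n
  largest-first : ∀ n x y z → y ≤ x → z ≤ x → x + y + z ≤ suc n → x * y * z ≤ P (suc n)

  largest-first n zero y z _ _ _ = z≤n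
  largest-first n (suc x) y z y≤ z≤ h = ≤-trans (≤-reflexive (peel x y z))
    (≤-trans (parts-product n x y z (≤-pred h) ⊕ product-by-sum y z (part₀ n) (part₁ n) sum≤ (proj₁ (proj₂ bal))
      (≤-trans (proj₂ (proj₂ (proj₂ bal))) (s≤s (proj₁ (proj₂ (proj₂ bal))))))
      (≤-reflexive (sym (P-suc n))))
    where
    bal = parts-balanced n
    sum≤ : y + z ≤ part₀ n + part₁ n
    sum≤ with y + z ≤? part₀ n + part₁ n
    ... | yes p = p
    -- Otherwise x + 1 is at most the smallest balanced class `part₂ n`; then so are y and z, and
    -- their sum cannot exceed that of the two larger classes.
    ... | no ¬p = ⊥-elim (¬p (≤-trans (y≤ ⊕ z≤) (≤-trans (x≤c ⊕ x≤c) (≤-trans (proj₁ (proj₂ (proj₂ bal)) ⊕ proj₁ (proj₂ (proj₂ bal))) (+-monoˡ-≤ (part₁ n) (proj₁ (proj₂ bal)))))))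
      where
      x≤c : suc x ≤ part₂ n
      x≤c = largest-arith (part₀ n + part₁ n) (part₂ n) x y z (≤-trans (≤-pred h) (≤-reflexive (sym (proj₁ bal)))) (≰⇒> ¬p)

  parts-product zero zero y z h = z≤n
  parts-product (suc n) x y z h with ≤-total x y | ≤-total y z | ≤-total x z
  ... | inj₂ y≤x | _ | inj₂ z≤x = largest-first n x y z y≤x z≤x h
  ... | inj₁ x≤y | inj₂ z≤y | _ = ≤-trans (≤-reflexive (cong (_* z) (*-comm x y)))
      (largest-first n y x z x≤y z≤y (≤-trans (≤-reflexive (cong (_+ z) (+-comm y x))) h))
  ... | _ | inj₁ y≤z | inj₁ x≤z = ≤-trans (≤-reflexive (trans (*-comm (x * y) z) (sym (*-assoc z x y))))
      (largest-first n z x y x≤z y≤z (≤-trans (≤-reflexive (trans (+-assoc z x y) (+-comm z (x + y)))) h))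
  ... | inj₁ x≤y | inj₁ y≤z | inj₂ z≤x = largest-first n x y z (≤-trans y≤z z≤x) z≤x h
  ... | inj₂ y≤x | inj₂ z≤y | inj₁ x≤z = largest-first n x y z y≤x (≤-trans z≤y y≤x) h

  -- Ordered edge counts (six times the number of edges) of G t m n.
  g : ℕ → ℕ → ℕ
  g zero n = 6 * P n
  g (suc t) zero = 0
  g (suc t) (suc n) = g t n + 3 * (n * (n ∸ 1))

  -- For t = 0 the new vertex enters a smallest class and gains 6 `part₀ n` `part₁ n`, where both
  -- factors are at least (n - 1)/3. Each vertex of T shifts the index by one.
  g-increment : ∀ t n → 9 * g t n + 6 * ((n ∸ t ∸ 1) * (n ∸ t ∸ 1)) ≤ 9 * g t (suc n)
  g-increment zero n with parts-balanced n
  ... | s , p , q , r with balanced-increment n (part₀ n) (part₁ n) (part₂ n) s p q r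
  ... | ha , hb , hc = ≤-trans (increment-arith (P n) (part₀ n) (part₁ n) (n ∸ 1) (≤-trans (m∸n≤m n 1) ha) (m≤n+o⇒m∸n≤o n 1 (≤-trans hb (≤-reflexive (+-comm _ 1)))))
      (≤-reflexive (cong (λ p → 9 * (6 * p)) (sym (P-suc n))))
  g-increment (suc t) zero = z≤n
  g-increment (suc t) (suc n) = step-arith (g t n) (g t (suc n)) ((n ∸ t ∸ 1) * (n ∸ t ∸ 1)) (n * (n ∸ 1)) (suc n * n)
    (g-increment t n) (*-mono-≤ (n≤1+n n) (m∸n≤m n 1))

  -- Rounding leaves classes of at least n/3, (n - 1)/3 and (n - 2)/3, which explains n - 2. A
  -- vertex of T contributes more than the cube grows by.
  g-lower : ∀ t n → 6 * ((n ∸ 2) * (n ∸ 2) * (n ∸ 2)) ≤ 27 * g t n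
  g-lower zero n with parts-balanced n
  ... | s , p , q , r with balanced-increment n (part₀ n) (part₁ n) (part₂ n) s p q r
  ... | ha , hb , hc = ≤-trans (*-monoʳ-≤ 6 (*-mono-≤ (*-mono-≤ {n ∸ 2} {3 * part₀ n} (≤-trans (m∸n≤m n 2) ha)
      (≤-trans (∸-monoʳ-≤ n (s≤s (z≤n {1}))) (m≤n+o⇒m∸n≤o n 1 (≤-trans hb (≤-reflexive (+-comm _ 1))))))
      (m≤n+o⇒m∸n≤o n 2 (≤-trans hc (≤-reflexive (+-comm _ 2)))))) (≤-reflexive (cube-arith (part₀ n) (part₁ n) (part₂ n)))
  g-lower (suc t) zero = z≤n
  g-lower (suc t) (suc n) = ≤-trans (lower-arith n) (≤-trans (+-monoˡ-≤ (27 * (3 * (n * (n ∸ 1)))) (g-lower t n))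
    (≤-reflexive (sym (*-distribˡ-+ 27 (g t n) (3 * (n * (n ∸ 1)))))))
    where
    lower-arith : ∀ n → 6 * ((n ∸ 1) * (n ∸ 1) * (n ∸ 1)) ≤ 6 * ((n ∸ 2) * (n ∸ 2) * (n ∸ 2)) + 27 * (3 * (n * (n ∸ 1)))
    lower-arith zero = z≤n
    lower-arith (suc zero) = z≤n
    lower-arith (suc (suc n)) = cubes-arith n

  module Delete {n} (S : System (suc n)) (v : Fin (suc n)) where
    open System S

    delete : System n
    delete = record
      { E = λ x y z → E (punchIn v x) (punchIn v y) (punchIn v z)
      ; swap₁₂ = λ x y z → swap₁₂ _ _ _
      ; swap₂₃ = λ x y z → swap₂₃ _ _ _
      ; irrefl = λ x z → irrefl _ _
      }

    private
      p : Fin n → Fin (suc n)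
      p = punchIn v
      e : Fin (suc n) → Fin (suc n) → Fin (suc n) → ℕ
      e x y z = ⟦ E x y z ⟧

    deg-delete : deg v ≡ ∑[ y ] ∑[ z ] e v (p y) (p z)
    deg-delete = trans (∑-punchIn (codeg v) v) (trans (cong (_+ ∑[ y ] codeg v (p y)) zero-codeg)
      (∑-cong (λ y → trans (∑-punchIn (e v (p y)) v) (cong (_+ ∑[ z ] e v (p y) (p z))
        (cong ⟦_⟧ (trans (swap₂₃ v (p y) v) (irrefl v (p y))))))))
      where
      zero-codeg : codeg v v ≡ 0
      zero-codeg = trans (∑-cong (λ z → cong ⟦_⟧ (irrefl v z))) (trans (∑-const (suc n) 0) (*-zeroʳ n))

    total-delete : total ≡ System.total delete + 3 * deg v
    total-delete = trans (∑-punchIn deg v) (trans (cong (deg v +_)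
        (trans (∑-cong (λ x → trans (∑-punchIn (codeg (p x)) v) (cong (codeg (p x) v +_)
            (trans (∑-cong (λ y → ∑-punchIn (e (p x) (p y)) v)) (∑-+ (λ y → e (p x) (p y) v) (λ y → ∑[ z ] e (p x) (p y) (p z)))))))
          (trans (∑-+ (λ x → codeg (p x) v) (λ x → ∑[ y ] e (p x) (p y) v + ∑[ y ] ∑[ z ] e (p x) (p y) (p z)))
            (cong₂ _+_ first (trans (∑-+ (λ x → ∑[ y ] e (p x) (p y) v) (λ x → ∑[ y ] ∑[ z ] e (p x) (p y) (p z)))
              (cong (_+ System.total delete) second))))))
        (delete-arith (deg v) (System.total delete)))
      where
      first : ∑[ x ] codeg (p x) v ≡ deg v
      first = trans (∑-cong (λ x → trans (∑-punchIn (e (p x) v) v) (trans (cong (_+ ∑[ z ] e (p x) v (p z))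
          (cong ⟦_⟧ (trans (rot (p x) v v) (irrefl v (p x))))) (∑-cong (λ z → cong ⟦_⟧ (swap₁₂ (p x) v (p z))))))) (sym deg-delete)
      second : ∑[ x ] ∑[ y ] e (p x) (p y) v ≡ deg v
      second = trans (∑-cong (λ x → ∑-cong (λ y → cong ⟦_⟧ (rot′ (p x) (p y) v)))) (sym deg-delete)

    deg≤ : deg v ≤ n * (n ∸ 1)
    deg≤ = ≤-trans (≤-reflexive deg-delete) (∑-bound (λ y → row n (λ y z → E v (p y) (p z)) (λ y → trans (rot v (p y) (p y)) (irrefl (p y) v)) y))
      where
      row : ∀ n (f : Fin n → Fin n → Bool) → (∀ y → f y y ≡ false) → ∀ y → ∑[ z ] ⟦ f y z ⟧ ≤ n ∸ 1
      row (suc n) f h y = ≤-trans (≤-reflexive (trans (∑-punchIn (λ z → ⟦ f y z ⟧) y) (cong (λ b → ⟦ b ⟧ + ∑[ z ] ⟦ f y (punchIn y z) ⟧) (h y))))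
        (card≤ (λ z → f y (punchIn y z)))

  -- Using `adjacent` instead of H makes the value symmetric, so edges can be transferred without
  -- comparing the order of the images under `punchIn`.
  deleteG : ∀ {n} → Fin (suc n) → Graph3 (suc n) → Graph3 n
  deleteG v H x y z = adjacent H (punchIn v x) (punchIn v y) (punchIn v z)

  total-mono : ∀ {n} (S S′ : System n) → (∀ x y z → System.E S x y z ≡ true → System.E S′ x y z ≡ true) → System.total S ≤ System.total S′
  total-mono S S′ h = ∑-mono (λ x → ∑-mono (λ y → ∑-mono (λ z → mono (h x y z))))
    where
    mono : ∀ {a b} → (a ≡ true → b ≡ true) → ⟦ a ⟧ ≤ ⟦ b ⟧
    mono {true} h rewrite h refl = ≤-refl
    mono {false} h = z≤n

  module _ {n} (H : Graph3 (suc n)) (v : Fin (suc n)) where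
    private
      p : Fin n → Fin (suc n)
      p = punchIn v

    deleteG-edge⁻ : ∀ x y z → IsEdge (deleteG v H) x y z → IsEdge H (p x) (p y) (p z)
    deleteG-edge⁻ x y z e = adjacent⇒IsEdge H _ _ _ (symmetric-edge (deleteG v H) (λ x y z → adjacent H (p x) (p y) (p z) ≡ true)
      (λ x y z → trans (adjacent-swap₁₂ H (p y) (p x) (p z))) (λ x y z → trans (adjacent-swap₂₃ H (p x) (p z) (p y))) (λ x y z i → proj₂ (proj₂ i)) x y z e)

    deleteG-edge : ∀ x y z → adjacent H (p x) (p y) (p z) ≡ true → IsEdge (deleteG v H) x y z
    deleteG-edge x y z e with <-cmp (toℕ x) (toℕ y) | <-cmp (toℕ y) (toℕ z) | <-cmp (toℕ x) (toℕ z)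
    ... | tri≈ _ eq _ | _ | _ = ⊥-elim (degenerate (toℕ-injective eq))
      where
      degenerate : x ≡ y → ⊥
      degenerate refl = IsEdge-irrefl H (p x) (p z) (adjacent⇒IsEdge H _ _ _ e)
    ... | _ | tri≈ _ eq _ | _ = ⊥-elim (degenerate (toℕ-injective eq))
      where
      degenerate : y ≡ z → ⊥
      degenerate refl = IsEdge-irrefl H (p y) (p x) (adjacent⇒IsEdge H _ _ _ (trans (sym (System.rot (system H) (p x) (p y) (p y))) e))
    ... | _ | _ | tri≈ _ eq _ = ⊥-elim (degenerate (toℕ-injective eq))
      where
      degenerate : x ≡ z → ⊥
      degenerate refl = IsEdge-irrefl H (p x) (p y) (adjacent⇒IsEdge H _ _ _ (trans (adjacent-swap₂₃ H (p x) (p x) (p y)) e))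
    ... | tri< a _ _ | tri< b _ _ | _ = inj₁ (a , b , e)
    ... | tri< a _ _ | tri> _ _ b | tri< c _ _ = inj₂ (inj₁ (c , b , trans (adjacent-swap₂₃ H (p x) (p z) (p y)) e))
    ... | tri< a _ _ | tri> _ _ b | tri> _ _ c = inj₂ (inj₂ (inj₂ (inj₂ (inj₁ (c , a , trans (System.rot (system H) (p z) (p x) (p y)) e)))))
    ... | tri> _ _ a | tri< b _ _ | tri< c _ _ = inj₂ (inj₂ (inj₁ (a , c , trans (adjacent-swap₁₂ H (p y) (p x) (p z)) e)))
    ... | tri> _ _ a | tri< b _ _ | tri> _ _ c = inj₂ (inj₂ (inj₂ (inj₁ (b , c , trans (System.rot′ (system H) (p y) (p z) (p x)) e))))
    ... | tri> _ _ a | tri> _ _ b | _ = inj₂ (inj₂ (inj₂ (inj₂ (inj₂ (b , a , trans (System.rot′ (system H) (p z) (p y) (p x)) (trans (adjacent-swap₂₃ H (p x) (p z) (p y)) e))))))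

    total-deleteG : System.total (system H) ≤ System.total (system (deleteG v H)) + 3 * System.deg (system H) v
    total-deleteG = ≤-trans (≤-reflexive (Delete.total-delete (system H) v)) (+-monoˡ-≤ (3 * System.deg (system H) v)
      (total-mono (Delete.delete (system H) v) (system (deleteG v H)) (λ x y z e → IsEdge⇒adjacent (deleteG v H) x y z (deleteG-edge x y z e))))

  residue : ∀ {n} → ℕ → Fin n → Bool
  residue r u = toℕ u % 3 ≡ᵇ r

  suc-residues : ∀ k → ((suc k % 3 ≡ᵇ 0) ≡ (k % 3 ≡ᵇ 2)) × ((suc k % 3 ≡ᵇ 1) ≡ (k % 3 ≡ᵇ 0)) × ((suc k % 3 ≡ᵇ 2) ≡ (k % 3 ≡ᵇ 1))
  suc-residues zero = refl , refl , refl
  suc-residues (suc zero) = refl , refl , refl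
  suc-residues (suc (suc zero)) = refl , refl , refl
  suc-residues (suc (suc (suc k))) with suc-residues k
  ... | p , q , r = shift 0 2 p , shift 1 0 q , shift 2 1 r
    where
    period : ∀ k → suc (suc (suc k)) % 3 ≡ k % 3
    period k = trans (cong (_% 3) (+-comm 3 k)) ([m+n]%n≡m%n k 3)
    shift : ∀ i j → (suc k % 3 ≡ᵇ i) ≡ (k % 3 ≡ᵇ j) → (suc (suc (suc (suc k))) % 3 ≡ᵇ i) ≡ (suc (suc (suc k)) % 3 ≡ᵇ j)
    shift i j h = trans (cong (_≡ᵇ i) (period (suc k))) (trans h (cong (_≡ᵇ j) (sym (period k))))

  card-residues : ∀ n → card (residue {n} 0) ≡ part₀ n × card (residue {n} 1) ≡ part₁ n × card (residue {n} 2) ≡ part₂ n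
  card-residues zero = ∑-zero _ , ∑-zero _ , ∑-zero _
  card-residues (suc n) with card-residues n
  ... | p , q , r = trans (∑-suc _) (cong suc (trans (∑-cong (λ u → cong ⟦_⟧ (proj₁ (suc-residues (toℕ u))))) r)) ,
    trans (∑-suc _) (trans (∑-cong (λ u → cong ⟦_⟧ (proj₁ (proj₂ (suc-residues (toℕ u)))))) p) ,
    trans (∑-suc _) (trans (∑-cong (λ u → cong ⟦_⟧ (proj₂ (proj₂ (suc-residues (toℕ u)))))) q)

-- The edge count of `G t m n`, and degrees in 3-coloured systems.

module ColouredSystems where
  open import Defs
  open import Data.Nat using (_<_)
  open import Data.Nat.Properties hiding (_<?_; _≟_)
  open import Data.Nat.DivMod using (_%_; m%n<n)
  open import Data.Fin as Fin using (Fin; zero; suc; toℕ; punchIn)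
  open import Data.Fin.Patterns using (0F; 1F; 2F)
  open import Data.Fin.Properties using (punchInᵢ≢i; toℕ-injective; _≟_)
  open import Data.List using (List; []; _∷_)
  open import Relation.Binary using (tri<; tri≈; tri>)
  open Certificates
  open Estimates
  open Sums
  open Blowups using (lsum)
  open TripleCounts
  open Systems
  open Graphs
  open Embeddings using (symmetric-edge)
  open Packings using (T⇒≡; ≡⇒T)
  open TuránNumbers

  private
    ∑³-+ : ∀ {n} (f h : Fin n → Fin n → Fin n → ℕ) → ∑[ x ] ∑[ y ] ∑[ z ] (f x y z + h x y z) ≡
      ∑[ x ] ∑[ y ] ∑[ z ] f x y z + ∑[ x ] ∑[ y ] ∑[ z ] h x y z
    ∑³-+ f h = trans (∑-cong (λ x → trans (∑-cong (λ y → ∑-+ (f x y) (h x y))) (∑-+ (λ y → ∑ (f x y)) (λ y → ∑ (h x y)))))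
      (∑-+ (λ x → ∑[ y ] ∑ (f x y)) (λ x → ∑[ y ] ∑ (h x y)))

    box : ∀ {n} (A B C : Fin n → Bool) → ∑[ x ] ∑[ y ] ∑[ z ] ⟦ A x ∧ B y ∧ C z ⟧ ≡ card A * (card B * card C)
    box A B C = trans (∑-cong (λ x → trans (∑²-∧ (A x) (λ y z → B y ∧ C z)) (cong (⟦ A x ⟧ *_)
      (trans (∑-cong (λ y → ∑-∧ (B y) C)) (∑-*ʳ (card C) (λ y → ⟦ B y ⟧)))))) (∑-*ʳ (card B * card C) (λ x → ⟦ A x ⟧))

  module G₀ (m n : ℕ) where

    private
      C₀ C₁ C₂ : Fin n → Bool
      C₀ = residue 0
      C₁ = residue 1
      C₂ = residue 2

    transversal : ∀ i j l → distinct3 i j l ≡ true → distinct3 i l j ≡ true → distinct3 j i l ≡ true → distinct3 j l i ≡ true →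
      distinct3 l i j ≡ true → distinct3 l j i ≡ true → i ≢ j → j ≢ l → i ≢ l →
      ∀ (u v w : Fin n) → toℕ u % 3 ≡ i → toℕ v % 3 ≡ j → toℕ w % 3 ≡ l → IsEdge (G 0 m n) u v w
    transversal i j l d₁ d₂ d₃ d₄ d₅ d₆ ij jl il u v w refl refl refl
      with <-cmp (toℕ u) (toℕ v) | <-cmp (toℕ v) (toℕ w) | <-cmp (toℕ u) (toℕ w)
    ... | tri≈ _ eq _ | _ | _ = ⊥-elim (ij (cong (_% 3) eq))
    ... | _ | tri≈ _ eq _ | _ = ⊥-elim (jl (cong (_% 3) eq))
    ... | _ | _ | tri≈ _ eq _ = ⊥-elim (il (cong (_% 3) eq))
    ... | tri< a _ _ | tri< b _ _ | _ = inj₁ (a , b , d₁)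
    ... | tri< a _ _ | tri> _ _ b | tri< c _ _ = inj₂ (inj₁ (c , b , d₂))
    ... | tri< a _ _ | tri> _ _ b | tri> _ _ c = inj₂ (inj₂ (inj₂ (inj₂ (inj₁ (c , a , d₅)))))
    ... | tri> _ _ a | tri< b _ _ | tri< c _ _ = inj₂ (inj₂ (inj₁ (a , c , d₃)))
    ... | tri> _ _ a | tri< b _ _ | tri> _ _ c = inj₂ (inj₂ (inj₂ (inj₁ (b , c , d₄))))
    ... | tri> _ _ a | tri> _ _ b | _ = inj₂ (inj₂ (inj₂ (inj₂ (inj₂ (b , a , d₆)))))

    private
      adj : Fin n → Fin n → Fin n → Bool
      adj = adjacent (G 0 m n)

      B₆ : Fin n → Fin n → Fin n → ℕ
      B₆ u v w = ⟦ C₀ u ∧ C₁ v ∧ C₂ w ⟧ + (⟦ C₀ u ∧ C₂ v ∧ C₁ w ⟧ + (⟦ C₁ u ∧ C₀ v ∧ C₂ w ⟧ + (⟦ C₁ u ∧ C₂ v ∧ C₀ w ⟧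
        + (⟦ C₂ u ∧ C₀ v ∧ C₁ w ⟧ + ⟦ C₂ u ∧ C₁ v ∧ C₀ w ⟧))))

      bits≤ : ∀ a b c → a < 3 → b < 3 → c < 3 → ∀ e →
        (distinct3 a b c ≡ true → e ≡ true) →
        ⟦ (a ≡ᵇ 0) ∧ (b ≡ᵇ 1) ∧ (c ≡ᵇ 2) ⟧ + (⟦ (a ≡ᵇ 0) ∧ (b ≡ᵇ 2) ∧ (c ≡ᵇ 1) ⟧ + (⟦ (a ≡ᵇ 1) ∧ (b ≡ᵇ 0) ∧ (c ≡ᵇ 2) ⟧
          + (⟦ (a ≡ᵇ 1) ∧ (b ≡ᵇ 2) ∧ (c ≡ᵇ 0) ⟧ + (⟦ (a ≡ᵇ 2) ∧ (b ≡ᵇ 0) ∧ (c ≡ᵇ 1) ⟧ + ⟦ (a ≡ᵇ 2) ∧ (b ≡ᵇ 1) ∧ (c ≡ᵇ 0) ⟧)))) ≤ ⟦ e ⟧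
      bits≤ 0 1 2 _ _ _ e h rewrite h refl = ≤-refl
      bits≤ 0 2 1 _ _ _ e h rewrite h refl = ≤-refl
      bits≤ 1 0 2 _ _ _ e h rewrite h refl = ≤-refl
      bits≤ 1 2 0 _ _ _ e h rewrite h refl = ≤-refl
      bits≤ 2 0 1 _ _ _ e h rewrite h refl = ≤-refl
      bits≤ 2 1 0 _ _ _ e h rewrite h refl = ≤-refl
      bits≤ 0 0 c _ _ _ e h = z≤n
      bits≤ 1 1 c _ _ _ e h = z≤n
      bits≤ 2 2 c _ _ _ e h = z≤n
      bits≤ 0 1 0 _ _ _ e h = z≤n
      bits≤ 0 1 1 _ _ _ e h = z≤n
      bits≤ 0 2 0 _ _ _ e h = z≤n
      bits≤ 0 2 2 _ _ _ e h = z≤n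
      bits≤ 1 0 0 _ _ _ e h = z≤n
      bits≤ 1 0 1 _ _ _ e h = z≤n
      bits≤ 1 2 1 _ _ _ e h = z≤n
      bits≤ 1 2 2 _ _ _ e h = z≤n
      bits≤ 2 0 0 _ _ _ e h = z≤n
      bits≤ 2 0 2 _ _ _ e h = z≤n
      bits≤ 2 1 1 _ _ _ e h = z≤n
      bits≤ 2 1 2 _ _ _ e h = z≤n
      bits≤ (suc (suc (suc _))) b c (s≤s (s≤s (s≤s ()))) _ _ e h
      bits≤ 0 (suc (suc (suc _))) c _ (s≤s (s≤s (s≤s ()))) _ e h
      bits≤ 1 (suc (suc (suc _))) c _ (s≤s (s≤s (s≤s ()))) _ e h
      bits≤ 2 (suc (suc (suc _))) c _ (s≤s (s≤s (s≤s ()))) _ e h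
      bits≤ 0 1 (suc (suc (suc _))) _ _ (s≤s (s≤s (s≤s ()))) e h
      bits≤ 0 2 (suc (suc (suc _))) _ _ (s≤s (s≤s (s≤s ()))) e h
      bits≤ 1 0 (suc (suc (suc _))) _ _ (s≤s (s≤s (s≤s ()))) e h
      bits≤ 1 2 (suc (suc (suc _))) _ _ (s≤s (s≤s (s≤s ()))) e h
      bits≤ 2 0 (suc (suc (suc _))) _ _ (s≤s (s≤s (s≤s ()))) e h
      bits≤ 2 1 (suc (suc (suc _))) _ _ (s≤s (s≤s (s≤s ()))) e h

      distinct⇒adj : ∀ u v w → distinct3 (toℕ u % 3) (toℕ v % 3) (toℕ w % 3) ≡ true → adj u v w ≡ true
      distinct⇒adj u v w h = IsEdge⇒adjacent (G 0 m n) u v w (transversal _ _ _ h (p₂₃ a b c h) (p₁₂ a b c h)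
          (p₂₃ b a c (p₁₂ a b c h)) (p₁₂ a c b (p₂₃ a b c h)) (p₂₃ c a b (p₁₂ a c b (p₂₃ a b c h)))
          (differ {a} {b} (proj₁ parts)) (differ {b} {c} (proj₁ (proj₂ parts))) (differ {a} {c} (proj₂ (proj₂ parts))) u v w refl refl refl)
        where
        a = toℕ u % 3
        b = toℕ v % 3
        c = toℕ w % 3
        parts = ∧³ {not (a ≡ᵇ b)} {not (b ≡ᵇ c)} {not (a ≡ᵇ c)} h
        differ : ∀ {a b} → not (a ≡ᵇ b) ≡ true → a ≢ b
        differ {a} h refl with a ≡ᵇ a | T⇒≡ (≡⇒≡ᵇ a a refl)
        differ () refl | .true | refl
        flip : ∀ a b → not (a ≡ᵇ b) ≡ true → not (b ≡ᵇ a) ≡ true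
        flip a b h = not-true (λ e → differ h (sym (≡ᵇ⇒≡ b a (≡⇒T e))))
        join : ∀ {a b c} → a ≡ true → b ≡ true → c ≡ true → a ∧ b ∧ c ≡ true
        join refl refl refl = refl
        p₂₃ : ∀ a b c → distinct3 a b c ≡ true → distinct3 a c b ≡ true
        p₂₃ a b c h = let (ab , bc , ac) = ∧³ {not (a ≡ᵇ b)} {not (b ≡ᵇ c)} {not (a ≡ᵇ c)} h in join ac (flip b c bc) ab
        p₁₂ : ∀ a b c → distinct3 a b c ≡ true → distinct3 b a c ≡ true
        p₁₂ a b c h = let (ab , bc , ac) = ∧³ {not (a ≡ᵇ b)} {not (b ≡ᵇ c)} {not (a ≡ᵇ c)} h in join (flip a b ab) ac bc

    G₀-lower : 6 * P n ≤ System.total (system (G 0 m n))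
    G₀-lower = ≤-trans (≤-reflexive (sym sum≡)) (∑-mono (λ u → ∑-mono (λ v → ∑-mono (λ w →
        bits≤ (toℕ u % 3) (toℕ v % 3) (toℕ w % 3) (m%n<n (toℕ u) 3) (m%n<n (toℕ v) 3) (m%n<n (toℕ w) 3) (adj u v w) (distinct⇒adj u v w)))))
      where
      c₀ = card C₀
      c₁ = card C₁
      c₂ = card C₂
      f : (A B C : Fin n → Bool) → Fin n → Fin n → Fin n → ℕ
      f A B C u v w = ⟦ A u ∧ B v ∧ C w ⟧
      sum≡ : ∑[ u ] ∑[ v ] ∑[ w ] B₆ u v w ≡ 6 * P n
      sum≡ = trans
        (trans (∑³-+ (f C₀ C₁ C₂) (λ u v w → f C₀ C₂ C₁ u v w + (f C₁ C₀ C₂ u v w + (f C₁ C₂ C₀ u v w + (f C₂ C₀ C₁ u v w + f C₂ C₁ C₀ u v w)))))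
          (cong₂ _+_ (box C₀ C₁ C₂)
        (trans (∑³-+ (f C₀ C₂ C₁) (λ u v w → f C₁ C₀ C₂ u v w + (f C₁ C₂ C₀ u v w + (f C₂ C₀ C₁ u v w + f C₂ C₁ C₀ u v w))))
          (cong₂ _+_ (box C₀ C₂ C₁)
        (trans (∑³-+ (f C₁ C₀ C₂) (λ u v w → f C₁ C₂ C₀ u v w + (f C₂ C₀ C₁ u v w + f C₂ C₁ C₀ u v w)))
          (cong₂ _+_ (box C₁ C₀ C₂)
        (trans (∑³-+ (f C₁ C₂ C₀) (λ u v w → f C₂ C₀ C₁ u v w + f C₂ C₁ C₀ u v w))
          (cong₂ _+_ (box C₁ C₂ C₀)
        (trans (∑³-+ (f C₂ C₀ C₁) (f C₂ C₁ C₀)) (cong₂ _+_ (box C₂ C₀ C₁) (box C₂ C₁ C₀)))))))))))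
        (trans (six-boxes c₀ c₁ c₂) (cong (6 *_) (cong₂ _*_ (cong₂ _*_ (proj₁ (card-residues n)) (proj₁ (proj₂ (card-residues n)))) (proj₂ (proj₂ (card-residues n))))))

  -- Vertex 0 of `G (suc t) m (suc n)` belongs to T and has full degree. Deleting it leaves
  -- `G t m n`, because the index and the size of T drop together and residues are unchanged.
  G-lower : ∀ t m n → g t n ≤ System.total (system (G t m n))
  G-lower zero m n = G₀.G₀-lower m n
  G-lower (suc t) m zero = z≤n
  G-lower (suc t) m (suc n) = ≤-trans (G-lower t m n ⊕ 3 ⊙ deg-zero) (≤-trans (+-monoˡ-≤ (3 * deg zero) (total-mono (system (G t m n)) delete
      (λ x y z e → edge x y z (adjacent⇒IsEdge (G t m n) x y z e)))) (≤-reflexive (sym total-delete)))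
    where
    open System (system (G (suc t) m (suc n)))
    open Delete (system (G (suc t) m (suc n))) zero using (delete; total-delete; deg-delete)
    edge : ∀ x y z → IsEdge (G t m n) x y z → adjacent (G (suc t) m (suc n)) (suc x) (suc y) (suc z) ≡ true
    edge = symmetric-edge (G t m n) (λ x y z → adjacent (G (suc t) m (suc n)) (suc x) (suc y) (suc z) ≡ true)
      (λ x y z → trans (swap₁₂ (suc y) (suc x) (suc z))) (λ x y z → trans (swap₂₃ (suc x) (suc z) (suc y)))
      (λ x y z (p , q , e) → IsEdge⇒adjacent (G (suc t) m (suc n)) (suc x) (suc y) (suc z) (inj₁ (s≤s p , s≤s q , e)))
    full : ∀ y z → y ≢ z → E zero (suc y) (suc z) ≡ true
    full y z ne with <-cmp (toℕ y) (toℕ z)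
    ... | tri< p _ _ = IsEdge⇒adjacent (G (suc t) m (suc n)) zero (suc y) (suc z) (inj₁ (s≤s z≤n , s≤s p , refl))
    ... | tri≈ _ eq _ = ⊥-elim (ne (toℕ-injective eq))
    ... | tri> _ _ p = IsEdge⇒adjacent (G (suc t) m (suc n)) zero (suc y) (suc z) (inj₂ (inj₁ (s≤s z≤n , s≤s p , refl)))
    row : ∀ n (f : Fin n → Fin n → Bool) → (∀ y z → y ≢ z → f y z ≡ true) → ∀ y → n ∸ 1 ≤ ∑[ z ] ⟦ f y z ⟧
    row (suc n) f h y = ≤-trans (≤-reflexive (sym (trans (∑-cong (λ z → cong ⟦_⟧ (h y (punchIn y z) (punchInᵢ≢i y z ∘ sym))))
        (trans (∑-const n 1) (*-identityʳ n))))) (≤-trans (m≤n+m _ ⟦ f y y ⟧) (≤-reflexive (sym (∑-punchIn (λ z → ⟦ f y z ⟧) y))))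
    deg-zero : n * (n ∸ 1) ≤ deg zero
    deg-zero = ≤-trans (≤-reflexive (sym (∑-const n (n ∸ 1)))) (≤-trans (∑-mono (row n (λ y z → E zero (suc y) (suc z)) full))
      (≤-reflexive (sym deg-delete)))

  next : Fin 3 → Fin 3
  next 0F = 1F
  next 1F = 2F
  next 2F = 0F

  module Coloured {n} (S : System n) (X : Fin n → Bool) (χ : Fin n → Fin 3)
    (outside : ∀ x y z → System.E S x y z ≡ true → X x ≡ false)
    (proper : ∀ x y z → System.E S x y z ≡ true → χ x ≢ χ y) where
    open System S
    open Tri E swap₁₂ swap₂₃

    class : Fin 3 → Fin n → Bool
    class i v = not (X v) ∧ does (χ v ≟ i)

    size : Fin 3 → ℕ
    size i = card (class i)

    sizes : size 0F + size 1F + size 2F + card X ≤ n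
    sizes = ≤-trans (≤-reflexive (sym (trans (∑-+ (λ v → ⟦ class 0F v ⟧ + ⟦ class 1F v ⟧ + ⟦ class 2F v ⟧) (λ v → ⟦ X v ⟧))
        (cong (_+ card X) (trans (∑-+ (λ v → ⟦ class 0F v ⟧ + ⟦ class 1F v ⟧) (λ v → ⟦ class 2F v ⟧))
          (cong (_+ size 2F) (∑-+ (λ v → ⟦ class 0F v ⟧) (λ v → ⟦ class 1F v ⟧))))))))
      (≤-trans (∑-bound (λ v → one (X v) (χ v))) (≤-reflexive (*-identityʳ n)))
      where
      one : ∀ b (i : Fin 3) → ⟦ not b ∧ does (i ≟ 0F) ⟧ + ⟦ not b ∧ does (i ≟ 1F) ⟧ + ⟦ not b ∧ does (i ≟ 2F) ⟧ + ⟦ b ⟧ ≤ 1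
      one true 0F = ≤-refl
      one true 1F = ≤-refl
      one true 2F = ≤-refl
      one false 0F = ≤-refl
      one false 1F = ≤-refl
      one false 2F = ≤-refl

    private
      proper₂₃ : ∀ x y z → E x y z ≡ true → χ y ≢ χ z
      proper₂₃ x y z e = proper y z x (trans (sym (rot x y z)) e)
      proper₁₃ : ∀ x y z → E x y z ≡ true → χ x ≢ χ z
      proper₁₃ x y z e = proper x z y (trans (sym (swap₂₃ x y z)) e)
      outside₂ : ∀ x y z → E x y z ≡ true → X y ≡ false
      outside₂ x y z e = outside y x z (trans (sym (swap₁₂ x y z)) e)
      outside₃ : ∀ x y z → E x y z ≡ true → X z ≡ false
      outside₃ x y z e = outside z x y (trans (rot z x y) e)

      T₃ : Set
      T₃ = (Fin n → Bool) × (Fin n → Bool) × (Fin n → Bool)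

      triples : List T₃
      triples = (class 0F , class 1F , class 2F) ∷ (class 0F , class 2F , class 1F) ∷ (class 1F , class 0F , class 2F)
        ∷ (class 1F , class 2F , class 0F) ∷ (class 2F , class 0F , class 1F) ∷ (class 2F , class 1F , class 0F) ∷ []

      is : Fin 3 → Fin 3 → Bool
      is i j = does (i ≟ j)

      rainbow : ∀ a b c → a ≢ b → b ≢ c → a ≢ c → 1 ≤
        ⟦ is a 0F ∧ is b 1F ∧ is c 2F ∧ true ⟧ + (⟦ is a 0F ∧ is b 2F ∧ is c 1F ∧ true ⟧ + (⟦ is a 1F ∧ is b 0F ∧ is c 2F ∧ true ⟧ +
        (⟦ is a 1F ∧ is b 2F ∧ is c 0F ∧ true ⟧ + (⟦ is a 2F ∧ is b 0F ∧ is c 1F ∧ true ⟧ + (⟦ is a 2F ∧ is b 1F ∧ is c 0F ∧ true ⟧ + 0)))))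
      rainbow 0F 0F 0F h _ _ = ⊥-elim (h refl)
      rainbow 0F 0F 1F h _ _ = ⊥-elim (h refl)
      rainbow 0F 0F 2F h _ _ = ⊥-elim (h refl)
      rainbow 0F 1F 0F _ _ h = ⊥-elim (h refl)
      rainbow 0F 1F 1F _ h _ = ⊥-elim (h refl)
      rainbow 0F 1F 2F _ _ _ = ≤-refl
      rainbow 0F 2F 0F _ _ h = ⊥-elim (h refl)
      rainbow 0F 2F 1F _ _ _ = ≤-refl
      rainbow 0F 2F 2F _ h _ = ⊥-elim (h refl)
      rainbow 1F 0F 0F _ h _ = ⊥-elim (h refl)
      rainbow 1F 0F 1F _ _ h = ⊥-elim (h refl)
      rainbow 1F 0F 2F _ _ _ = ≤-refl
      rainbow 1F 1F 0F h _ _ = ⊥-elim (h refl)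
      rainbow 1F 1F 1F h _ _ = ⊥-elim (h refl)
      rainbow 1F 1F 2F h _ _ = ⊥-elim (h refl)
      rainbow 1F 2F 0F _ _ _ = ≤-refl
      rainbow 1F 2F 1F _ _ h = ⊥-elim (h refl)
      rainbow 1F 2F 2F _ h _ = ⊥-elim (h refl)
      rainbow 2F 0F 0F _ h _ = ⊥-elim (h refl)
      rainbow 2F 0F 1F _ _ _ = ≤-refl
      rainbow 2F 0F 2F _ _ h = ⊥-elim (h refl)
      rainbow 2F 1F 0F _ _ _ = ≤-refl
      rainbow 2F 1F 1F _ h _ = ⊥-elim (h refl)
      rainbow 2F 1F 2F _ _ h = ⊥-elim (h refl)
      rainbow 2F 2F 0F h _ _ = ⊥-elim (h refl)
      rainbow 2F 2F 1F h _ _ = ⊥-elim (h refl)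
      rainbow 2F 2F 2F h _ _ = ⊥-elim (h refl)
      pointwise : ∀ x y z e → E x y z ≡ e → ⟦ E x y z ⟧ ≤ lsum (λ { (A , B , C) → ⟦ A x ∧ B y ∧ C z ∧ E x y z ⟧ }) triples
      pointwise x y z false e rewrite e = z≤n
      pointwise x y z true e rewrite outside x y z e | outside₂ x y z e | outside₃ x y z e | e =
        rainbow (χ x) (χ y) (χ z) (proper x y z e) (proper₂₃ x y z e) (proper₁₃ x y z e)

    coloured-total : total ≤ 6 * (size 0F * size 1F * size 2F)
    coloured-total = ≤-trans (Φ-cover triples (λ x y z → pointwise x y z (E x y z) refl))
      (≤-trans (≤-reflexive (collect-six′ F (Φ-swap₂₃ V₀ V₂ V₁) (Φ-swap₁₂ V₁ V₀ V₂) (sym (Φ-rot V₀ V₁ V₂)) (Φ-rot V₂ V₀ V₁)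
          (trans (Φ-swap₁₂ V₂ V₁ V₀) (sym (Φ-rot V₀ V₁ V₂)))))
        (*-monoʳ-≤ 6 (≤-trans (m≤m+n F _) (≤-reflexive (complement-count E V₀ V₁ V₂)))))
      where
      V₀ = class 0F
      V₁ = class 1F
      V₂ = class 2F
      F = Φ V₀ V₁ V₂

    coloured-degree : ∀ w → deg w ≤ 2 * (size (next (χ w)) * size (next (next (χ w))))
    coloured-degree w = ≤-trans (∑-+-mono {g = λ y → ∑[ z ] ⟦ A y ∧ B z ⟧} {h = λ y → ∑[ z ] ⟦ B y ∧ A z ⟧} (λ y → ∑-+-mono (λ z → cell y z (E w y z) refl)))
      (≤-reflexive (trans (cong₂ _+_ (grid A B) (grid B A)) (double (card A) (card B))))
      where
      A = class (next (χ w))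
      B = class (next (next (χ w)))
      grid : ∀ (A B : Fin n → Bool) → ∑[ y ] ∑[ z ] ⟦ A y ∧ B z ⟧ ≡ card A * card B
      grid A B = trans (∑-cong (λ y → ∑-∧ (A y) B)) (∑-*ʳ (card B) (λ y → ⟦ A y ⟧))
      others : ∀ i a b → i ≢ a → a ≢ b → i ≢ b → 1 ≤ ⟦ is a (next i) ∧ is b (next (next i)) ⟧ + ⟦ is a (next (next i)) ∧ is b (next i) ⟧
      others 0F 0F 0F h _ _ = ⊥-elim (h refl)
      others 0F 0F 1F h _ _ = ⊥-elim (h refl)
      others 0F 0F 2F h _ _ = ⊥-elim (h refl)
      others 0F 1F 0F _ _ h = ⊥-elim (h refl)
      others 0F 1F 1F _ h _ = ⊥-elim (h refl)
      others 0F 1F 2F _ _ _ = ≤-refl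
      others 0F 2F 0F _ _ h = ⊥-elim (h refl)
      others 0F 2F 1F _ _ _ = ≤-refl
      others 0F 2F 2F _ h _ = ⊥-elim (h refl)
      others 1F 0F 0F _ h _ = ⊥-elim (h refl)
      others 1F 0F 1F _ _ h = ⊥-elim (h refl)
      others 1F 0F 2F _ _ _ = ≤-refl
      others 1F 1F 0F h _ _ = ⊥-elim (h refl)
      others 1F 1F 1F h _ _ = ⊥-elim (h refl)
      others 1F 1F 2F h _ _ = ⊥-elim (h refl)
      others 1F 2F 0F _ _ _ = ≤-refl
      others 1F 2F 1F _ _ h = ⊥-elim (h refl)
      others 1F 2F 2F _ h _ = ⊥-elim (h refl)
      others 2F 0F 0F _ h _ = ⊥-elim (h refl)
      others 2F 0F 1F _ _ _ = ≤-refl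
      others 2F 0F 2F _ _ h = ⊥-elim (h refl)
      others 2F 1F 0F _ _ _ = ≤-refl
      others 2F 1F 1F _ h _ = ⊥-elim (h refl)
      others 2F 1F 2F _ _ h = ⊥-elim (h refl)
      others 2F 2F 0F h _ _ = ⊥-elim (h refl)
      others 2F 2F 1F h _ _ = ⊥-elim (h refl)
      others 2F 2F 2F h _ _ = ⊥-elim (h refl)
      cell : ∀ y z e → E w y z ≡ e → ⟦ E w y z ⟧ ≤ ⟦ A y ∧ B z ⟧ + ⟦ B y ∧ A z ⟧
      cell y z false e rewrite e = z≤n
      cell y z true e rewrite outside₂ w y z e | outside₃ w y z e | e =
        others (χ w) (χ y) (χ z) (proper w y z e) (proper₂₃ w y z e) (proper₁₃ w y z e)

    private
      pair-degrees : ∀ i a b → i ≢ a → a ≢ b → i ≢ b →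
        2 * (size (next a) * size (next (next a))) + 2 * (size (next b) * size (next (next b))) ≤ 2 * (size i * (size (next i) + size (next (next i))))
      pair-degrees 0F 0F 0F h _ _ = ⊥-elim (h refl)
      pair-degrees 0F 0F 1F h _ _ = ⊥-elim (h refl)
      pair-degrees 0F 0F 2F h _ _ = ⊥-elim (h refl)
      pair-degrees 0F 1F 0F _ _ h = ⊥-elim (h refl)
      pair-degrees 0F 1F 1F _ h _ = ⊥-elim (h refl)
      pair-degrees 0F 1F 2F _ _ _ = pair-arith₁ (size 0F) (size 1F) (size 2F)
      pair-degrees 0F 2F 0F _ _ h = ⊥-elim (h refl)
      pair-degrees 0F 2F 1F _ _ _ = pair-arith₂ (size 0F) (size 1F) (size 2F)
      pair-degrees 0F 2F 2F _ h _ = ⊥-elim (h refl)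
      pair-degrees 1F 0F 0F _ h _ = ⊥-elim (h refl)
      pair-degrees 1F 0F 1F _ _ h = ⊥-elim (h refl)
      pair-degrees 1F 0F 2F _ _ _ = pair-arith₂ (size 1F) (size 2F) (size 0F)
      pair-degrees 1F 1F 0F h _ _ = ⊥-elim (h refl)
      pair-degrees 1F 1F 1F h _ _ = ⊥-elim (h refl)
      pair-degrees 1F 1F 2F h _ _ = ⊥-elim (h refl)
      pair-degrees 1F 2F 0F _ _ _ = pair-arith₁ (size 1F) (size 2F) (size 0F)
      pair-degrees 1F 2F 1F _ _ h = ⊥-elim (h refl)
      pair-degrees 1F 2F 2F _ h _ = ⊥-elim (h refl)
      pair-degrees 2F 0F 0F _ h _ = ⊥-elim (h refl)
      pair-degrees 2F 0F 1F _ _ _ = pair-arith₁ (size 2F) (size 0F) (size 1F)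
      pair-degrees 2F 0F 2F _ _ h = ⊥-elim (h refl)
      pair-degrees 2F 1F 0F _ _ _ = pair-arith₂ (size 2F) (size 0F) (size 1F)
      pair-degrees 2F 1F 1F _ h _ = ⊥-elim (h refl)
      pair-degrees 2F 1F 2F _ _ h = ⊥-elim (h refl)
      pair-degrees 2F 2F 0F h _ _ = ⊥-elim (h refl)
      pair-degrees 2F 2F 1F h _ _ = ⊥-elim (h refl)
      pair-degrees 2F 2F 2F h _ _ = ⊥-elim (h refl)

    some-edge : ∀ w → 1 ≤ deg w → ∃[ u ] ∃[ v ] E w u v ≡ true
    some-edge w h with ∑-positive (codeg w) h
    ... | u , h′ with ∑-positive (λ v → ⟦ E w u v ⟧) h′
    ...   | v , h″ = u , v , ⟦⟧-true h″

    -- The other two vertices u, v of an edge at w have large degree, and their degrees together are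
    -- at most twice the class of w times the two other classes. This keeps those two classes from
    -- being much larger than 2n/3 in total, and deg w is at most twice their product.
    max-degree : ∀ q → 1 ≤ n → 1 ≤ q → (∀ v → deg v ≡ 0 ⊎ 2 * q * (n * n) ≤ 9 * q * deg v + n * n) →
      ∀ w → 18 * q * deg w ≤ (4 * q + 5) * (n * n)
    max-degree q n₀ q₀ large w with deg w in eq
    ... | zero = ≤-trans (≤-reflexive (*-zeroʳ (18 * q))) z≤n
    ... | suc d with some-edge w (≤-trans (s≤s z≤n) (≤-reflexive (sym eq)))
    ...   | u , v , e = max-degree-arith n q (size i) (size (next i) + size (next (next i))) (suc d) n₀ q₀ (cycle-sizes i)
        (two-degrees n q (deg u) (deg v) (size i) (size (next i) + size (next (next i))) (bound u (deg-positive u e₁)) (bound v (deg-positive v e₂))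
          (≤-trans (coloured-degree u ⊕ coloured-degree v) (pair-degrees i (χ u) (χ v) (proper w u v e) (proper₂₃ w u v e) (proper₁₃ w u v e))))
        (double-product (suc d) (size (next i)) (size (next (next i))) (≤-trans (≤-reflexive (sym eq)) (coloured-degree w)))
      where
      i = χ w
      e₁ : E u w v ≡ true
      e₁ = trans (sym (swap₁₂ w u v)) e
      e₂ : E v w u ≡ true
      e₂ = trans (rot v w u) e
      bound : ∀ v → 1 ≤ deg v → 2 * q * (n * n) ≤ 9 * q * deg v + n * n
      bound v pos with large v
      ... | inj₁ z = ⊥-elim (<⇒≱ pos (≤-reflexive z))
      ... | inj₂ h = h
      cycle-sizes : ∀ i → size i + (size (next i) + size (next (next i))) ≤ n
      cycle-sizes i = ≤-trans (≤-reflexive (cycle i)) (≤-trans (m≤m+n _ (card X)) sizes)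
        where
        cycle : ∀ i → size i + (size (next i) + size (next (next i))) ≡ size 0F + size 1F + size 2F
        cycle 0F = sym (+-assoc (size 0F) (size 1F) (size 2F))
        cycle 1F = trans (sym (+-assoc (size 1F) (size 2F) (size 0F))) (trans (+-comm (size 1F + size 2F) (size 0F)) (sym (+-assoc (size 0F) (size 1F) (size 2F))))
        cycle 2F = +-comm (size 2F) (size 0F + size 1F)

-- Packings in dense graphs and the induction.

open import Data.Nat.Properties hiding (_<?_; _≟_)
open import Data.Fin using (punchIn)
open import Data.Fin.Patterns using (0F; 1F; 2F)
open import Data.Fin.Properties using (punchInᵢ≢i; punchIn-injective; any?; all?; _≟_; ¬∀⟶∃¬)
open import Relation.Nullary.Decidable using (decidable-stable)
open Certificates
open Estimates
open Sums
open TripleCounts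
open Systems
open Graphs
open Stability
open Embeddings
open Packings
open TuránNumbers hiding (P)
open ColouredSystems

delete-packing : ∀ {n a k} {F : Graph3 a} (H : Graph3 (suc n)) v → Packing (deleteG v H) F k →
  Σ (Packing H F k) λ P → ∀ i p → Copy.at (Packing.member P i) p ≢ v
delete-packing H v P = record
  { member = λ i → record
    { at = punchIn v ∘ Copy.at (member i)
    ; at-injective = Copy.at-injective (member i) ∘ punchIn-injective v _ _
    ; at-edge = λ p q r e → deleteG-edge⁻ H v _ _ _ (Copy.at-edge (member i) p q r e)
    }
  ; disjoint = λ i j p q eq → disjoint i j p q (punchIn-injective v _ _ eq)
  } , λ i p → punchInᵢ≢i v _
  where open Packing P

no-copies : ∀ {n a} {H : Graph3 n} {F : Graph3 a} → Packing H F 0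
no-copies = record { member = λ () ; disjoint = λ () }

add-copy : ∀ {n a k} {H : Graph3 n} {F : Graph3 a} (P : Packing H F k) (c : Copy H F) →
  (∀ i p q → Copy.at (Packing.member P i) p ≢ Copy.at c q) → Packing H F (suc k)
add-copy P c new = record
  { member = λ { zero → c ; (suc i) → member i }
  ; disjoint = λ { zero zero p q eq → refl
                 ; zero (suc j) p q eq → ⊥-elim (new j q p (sym eq))
                 ; (suc i) zero p q eq → ⊥-elim (new i p q eq)
                 ; (suc i) (suc j) p q eq → cong suc (disjoint i j p q eq) }
  }
  where open Packing P

module Image {n a k} {H : Graph3 n} {F : Graph3 a} (P : Packing H F k) where
  open Packing P

  covered? : ∀ v → Dec (∃[ i ] ∃[ p ] Copy.at (member i) p ≡ v)
  covered? v = any? (λ i → any? (λ p → Copy.at (member i) p ≟ v))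

  image : Fin n → Bool
  image v = does (covered? v)

  image-at : ∀ i p → image (Copy.at (member i) p) ≡ true
  image-at i p = true-does (covered? _) (i , p , refl)

  image-avoids : ∀ v → (∀ i p → Copy.at (member i) p ≢ v) → image v ≡ false
  image-avoids v h with covered? v
  ... | yes (i , p , eq) = ⊥-elim (h i p eq)
  ... | no _ = refl

  card-image : card image ≤ k * a
  card-image = ≤-trans (∑-mono pointwise)
    (≤-trans (≤-reflexive (∑-swap (λ v i → ∑[ p ] ⟦ does (Copy.at (member i) p ≟ v) ⟧)))
      (∑-bound (λ i → ≤-trans (≤-reflexive (∑-swap (λ v p → ⟦ does (Copy.at (member i) p ≟ v) ⟧)))
        (≤-trans (∑-bound (λ p → ≤-reflexive (singleton (Copy.at (member i) p)))) (≤-reflexive (*-identityʳ a))))))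
    where
    pointwise : ∀ v → ⟦ image v ⟧ ≤ ∑[ i ] ∑[ p ] ⟦ does (Copy.at (member i) p ≟ v) ⟧
    pointwise v with covered? v
    ... | no _ = z≤n
    ... | yes (i , p , eq) = ≤-trans (≤-reflexive (sym (cong ⟦_⟧ (true-does (Copy.at (member i) p ≟ v) eq))))
      (≤-trans (∑-term (λ p → ⟦ does (Copy.at (member i) p ≟ v) ⟧) p) (∑-term (λ i → ∑[ p ] ⟦ does (Copy.at (member i) p ≟ v) ⟧) i))
    singleton : ∀ {n} (u : Fin n) → ∑[ v ] ⟦ does (u ≟ v) ⟧ ≡ 1
    singleton {suc n} u = trans (∑-punchIn (λ v → ⟦ does (u ≟ v) ⟧) u) (cong₂ _+_ (cong ⟦_⟧ (true-does (u ≟ u) refl))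
      (trans (∑-cong (λ v → cong ⟦_⟧ (false-does (u ≟ punchIn u v) (punchInᵢ≢i u v ∘ sym)))) (trans (∑-const n 0) (*-zeroʳ n))))
      where
      false-does : ∀ {P : Set} (d : Dec P) → ¬ P → does d ≡ false
      false-does (yes p) ¬p = ⊥-elim (¬p p)
      false-does (no _) _ = refl

module Bounds (k : ℕ) where

  m : ℕ
  m = suc (suc k)

  s : ℕ
  s = suc (3 * m)

  Avoiding : ∀ {n} → Graph3 n → (Fin n → Bool) → Set
  Avoiding H X = Σ (Copy H (F5S m)) λ c → ∀ p → X (Copy.at c p) ≡ false

  module Step (q n : ℕ) (q₀ : 10000000 ≤ q) (n₀ : 1 ≤ n) (large : stabilityBound (suc (suc (suc (suc k)))) q ≤ n)
    (H : Graph3 n) (X : Fin n → Bool) (X-few : 36 * q * card X ≤ n)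
    (dense : ∀ v → 4 * q * (n * n) ≤ 18 * q * System.deg (system H) v + n * n) (none : ¬ Avoiding H X) where

    private
      S = system H
      module S = System S
      open Isolate S X
      module I = System isolate

      q₁ : 1 ≤ q
      q₁ = ≤-trans (s≤s z≤n) q₀

      qX : q * card X ≤ n
      qX = ≤-trans (≤-trans (m≤m+n (q * card X) (35 * (q * card X))) (≤-reflexive (sym (*-assoc 36 q (card X))))) X-few

      in-X : ∀ v → X v ≡ true → I.deg v ≡ 0
      in-X v h = trans (∑-cong (λ y → trans (∑-cong (λ z → cong ⟦_⟧ (vanish y z (I.E v y z) refl))) (trans (∑-const n 0) (*-zeroʳ n))))
        (trans (∑-const n 0) (*-zeroʳ n))
        where
        vanish : ∀ y z e → I.E v y z ≡ e → I.E v y z ≡ false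
        vanish y z false eq = eq
        vanish y z true eq with trans (sym h) (isolate-first v y z eq)
        ... | ()

      loss : ∀ v → X v ≡ false → S.deg v ≤ I.deg v + 2 * (n * card X)
      loss v h = ≤-trans (isolate-deg v) (≤-reflexive (trans (cong (λ b → I.deg v + 2 * (n * card X) + n * n * ⟦ b ⟧) h)
        (trans (cong (I.deg v + 2 * (n * card X) +_) (*-zeroʳ (n * n))) (+-identityʳ _))))

      -- Isolating X costs any other vertex at most 2n |X| ≤ n²/(18q), which is where 36 comes from;
      -- the tolerance n²/(18q) of dense graphs becomes the n²/(9q) of stability.
      degrees : ∀ v → (X v ≡ true × I.deg v ≡ 0) ⊎ (2 * q * (n * n) ≤ 9 * q * I.deg v + n * n)
      degrees v = by (X v) refl
        where
        by : ∀ b → X v ≡ b → (X v ≡ true × I.deg v ≡ 0) ⊎ (2 * q * (n * n) ≤ 9 * q * I.deg v + n * n)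
        by true h = inj₁ (h , in-X v h)
        by false h = inj₂ (isolated-degree n q (S.deg v) (I.deg v) (card X) (2 * (n * card X)) ≤-refl (loss v h) X-few (dense v))

      coloured : Σ (Fin n → Fin 3) λ χ → ∀ x y z → I.E x y z ≡ true → χ x ≢ χ y
      coloured = stability (suc (suc (suc (suc k)))) q q₀ large isolate X qX degrees
        (λ C → none (FromConfig.copy H X k C , FromConfig.copy-outside H X k C))

      degrees′ : ∀ v → I.deg v ≡ 0 ⊎ 2 * q * (n * n) ≤ 9 * q * I.deg v + n * n
      degrees′ v with degrees v
      ... | inj₁ (_ , z) = inj₁ z
      ... | inj₂ h = inj₂ h

    -- 6 = 5 + 1: the 5 of `max-degree`, and 1 for the triples lost by isolating X.
    bounded-degree : ∀ v → X v ≡ false → 18 * q * S.deg v ≤ (4 * q + 6) * (n * n)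
    bounded-degree v h = degree-back n q (S.deg v) (I.deg v) (card X) (2 * (n * card X)) ≤-refl (loss v h) X-few
      (Coloured.max-degree isolate X (proj₁ coloured) isolate-first (proj₂ coloured) q n₀ q₁ degrees′ v)

    bounded-total : ∃[ a ] ∃[ b ] ∃[ c ] (a + b + c + card X ≤ n × S.total ≤ 6 * (a * b * c) + 3 * ∑[ v ] (⟦ X v ⟧ * S.deg v))
    bounded-total = size 0F , size 1F , size 2F , Coloured.sizes isolate X (proj₁ coloured) isolate-first (proj₂ coloured) ,
      ≤-trans isolate-total (+-monoˡ-≤ _ (Coloured.coloured-total isolate X (proj₁ coloured) isolate-first (proj₂ coloured)))
      where
      size : Fin 3 → ℕ
      size = Coloured.size isolate X (proj₁ coloured) isolate-first (proj₂ coloured)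

  width : ℕ → ℕ
  width t = t * s

  Free : ∀ {n} → ℕ → Graph3 n → Set
  Free t H = ¬ Packing H (F5S m) (suc t)

  Upper : ℕ → ℕ → Set
  Upper t n₀ = ∀ n → n₀ ≤ n → (H : Graph3 n) → Free t H → System.total (system H) ≤ g t n

  module Induction (t q N n₁ : ℕ) (q₀ : 10000000 ≤ q) (width<q : width t + 1 ≤ q)
    (N-stability : stabilityBound (suc (suc (suc (suc k)))) q ≤ N) (N-cubes : 40 * (q * q * q) * (t + 3) ≤ N)
    (N-previous : suc n₁ ≤ N) where

    q₁ : 1 ≤ q
    q₁ = ≤-trans (s≤s z≤n) q₀

    Dense : ∀ {n} → Graph3 n → Set
    Dense {n} H = ∀ v → 4 * q * (n * n) ≤ 18 * q * System.deg (system H) v + n * n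

    image-few : ∀ {n} (x : ℕ) → x ≤ width t → N ≤ n → 36 * q * x ≤ n
    image-few x h N≤ = ≤-trans (few-arith q x t (≤-trans h (≤-trans (m≤m+n (width t) 1) width<q)) q₁) (≤-trans N-cubes N≤)

    dense-case : (∀ t′ → t ≡ suc t′ → Upper t′ n₁) → ∀ n → N ≤ n → (H : Graph3 n) → Free t H → Dense H →
      System.total (system H) ≤ g t n
    dense-case previous zero N≤ H free dense = ⊥-elim (<⇒≱ (≤-trans (s≤s z≤n) N-previous) N≤)
    dense-case previous (suc p) N≤ H free dense = by t refl
      where
      n : ℕ
      n = suc p
      n₀ : 1 ≤ n
      n₀ = s≤s z≤n
      open System (system H) using (deg; total)
      module Packed {j} (eq : t ≡ j) (P : Packing H (F5S m) j) where
        open Image P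
        X-small : card image ≤ width t
        X-small = ≤-trans card-image (≤-reflexive (cong (_* s) (sym eq)))
        none : ¬ Avoiding H image
        none (c , out) = free (subst (λ j → Packing H (F5S m) (suc j)) (sym eq) (add-copy P c λ i p r e →
          true≢false (trans (sym (image-at i p)) (trans (cong image e) (out r)))))
          where
          true≢false : true ≢ false
          true≢false ()
        bounded-degree : ∀ v → image v ≡ false → 18 * q * deg v ≤ (4 * q + 6) * (n * n)
        bounded-degree = Step.bounded-degree q n q₀ n₀ (≤-trans N-stability N≤) H image (image-few (card image) X-small N≤) dense none
        bounded-total : ∃[ a ] ∃[ b ] ∃[ c ] (a + b + c + card image ≤ n × total ≤ 6 * (a * b * c) + 3 * ∑[ v ] (⟦ image v ⟧ * deg v))
        bounded-total = Step.bounded-total q n q₀ n₀ (≤-trans N-stability N≤) H image (image-few (card image) X-small N≤) dense none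
      by : ∀ j → t ≡ j → total ≤ g t n
      by zero eq = finish (Packed.bounded-total eq no-copies)
        where
        X₀ : Fin n → Bool
        X₀ = Image.image (no-copies {H = H} {F = F5S m})
        nothing : card X₀ ≡ 0
        nothing = n≤0⇒n≡0 (Image.card-image (no-copies {H = H} {F = F5S m}))
        empty : ∑[ v ] (⟦ X₀ v ⟧ * deg v) ≡ 0
        empty = trans (∑-cong (λ v → cong (_* deg v) (n≤0⇒n≡0 (≤-trans (∑-term (λ v → ⟦ X₀ v ⟧) v) (≤-reflexive nothing)))))
          (trans (∑-const n 0) (*-zeroʳ n))
        finish : ∃[ a ] ∃[ b ] ∃[ c ] (a + b + c + card X₀ ≤ n × total ≤ 6 * (a * b * c) + 3 * ∑[ v ] (⟦ X₀ v ⟧ * deg v)) → total ≤ g t n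
        finish (a , b , c , sum≤ , tot) = ≤-trans tot (≤-trans
          (≤-reflexive (trans (cong (λ σ → 6 * (a * b * c) + 3 * σ) empty) (+-identityʳ (6 * (a * b * c)))))
          (≤-trans (*-monoʳ-≤ 6 (parts-product n a b c (≤-trans (m≤m+n (a + b + c) (card X₀)) sum≤)))
            (≤-reflexive (cong (λ t → g t n) (sym eq)))))
      -- Packings are available under double negation only, so the bound is assumed to fail. Vertex
      -- zero serves here just to obtain one packing of t copies.
      by (suc t′) eq = decidable-stable (total ≤? g t n) λ too-many →
          packing-through too-many zero λ P₀ → too-many (conclude (small too-many) P₀)
        where
        -- Without t disjoint copies in H - v, the bound for t - 1 on n - 1 vertices and the trivial
        -- bound on deg v add up to `g t n`, by its very recursion.
        packing-through : ¬ (total ≤ g t n) → ∀ v → ¬ ¬ Packing (deleteG v H) (F5S m) (suc t′)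
        packing-through too-many v ¬P = too-many (≤-trans (total-deleteG H v)
          (≤-trans (previous t′ eq p (≤-pred (≤-trans N-previous N≤)) (deleteG v H) ¬P
            ⊕ 3 ⊙ Delete.deg≤ (system H) v) (≤-reflexive (cong (λ t → g t n) (sym eq)))))
        -- Each v gets its own packing avoiding v, so that v lies outside the isolated set and its
        -- degree is bounded. The bound is the same for all v and thus also holds on the vertices of
        -- the one packing used below.
        small : ¬ (total ≤ g t n) → ∀ v → 18 * q * deg v ≤ (4 * q + 6) * (n * n)
        small too-many v = decidable-stable (18 * q * deg v ≤? (4 * q + 6) * (n * n)) λ big → packing-through too-many v λ P →
          let (P′ , avoids) = delete-packing H v P in
          big (Packed.bounded-degree eq P′ v (Image.image-avoids P′ v avoids))
        conclude : (∀ v → 18 * q * deg v ≤ (4 * q + 6) * (n * n)) → Packing (deleteG zero H) (F5S m) (suc t′) → total ≤ g t n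
        conclude small P₀ = finish (Packed.bounded-total eq P)
          where
          P = proj₁ (delete-packing H zero P₀)
          x = card (Image.image P)
          D = ∑[ v ] (⟦ Image.image P v ⟧ * deg v)
          x≤ : x ≤ width t
          x≤ = Packed.X-small eq P
          x<q : x + 1 ≤ q
          x<q = ≤-trans (+-monoˡ-≤ 1 x≤) width<q
          n-cubes : 40 * (q * q * q) ≤ n
          n-cubes = ≤-trans (cubes-arith′ (q * q * q) t) (≤-trans N-cubes N≤)
          n-q : 4 * q + 4 ≤ n
          n-q = ≤-trans (linear-arith q q₁) n-cubes
          sum-degrees : 18 * q * D ≤ x * ((4 * q + 6) * (n * n))
          sum-degrees = ≤-trans (≤-reflexive (sym (∑-*ˡ (18 * q) (λ v → ⟦ Image.image P v ⟧ * deg v))))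
            (≤-trans (∑-mono (λ v → weighted-arith (18 * q) ⟦ Image.image P v ⟧ (deg v) ((4 * q + 6) * (n * n)) (small v)))
              (≤-reflexive (∑-*ʳ ((4 * q + 6) * (n * n)) (λ v → ⟦ Image.image P v ⟧))))
          x≤n : x ≤ n
          x≤n = card≤ (Image.image P)
          compare : ∀ a b c → a + b + c + x ≤ n → total ≤ 6 * (a * b * c) + 3 * D → total ≤ g (suc t′) (suc p)
          compare a b c sum≤ tot = from-predecessor (m≤n⇒∃[o]m+o≡n (≤-pred (≤-trans (≤-trans (≤ᵇ⇒≤ 3 4 _) (m≤n+m 4 (4 * q))) n-q)))
            where
            abc : a + b + c ≤ n ∸ x
            abc = m+n≤o⇒m≤o∸n (a + b + c) sum≤
            at-p : ∀ p u → 2 + u ≡ p → 6 * (u * u * u) + 81 * ((u + 2) * (u + 1)) ≤ 27 * g (suc t′) (suc p)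
            at-p _ u refl = bound-arith u (g t′ (2 + u)) (g-lower t′ (2 + u))
            from-predecessor : ∃[ u ] 2 + u ≡ p → total ≤ g (suc t′) (suc p)
            from-predecessor (u , eq′) = final-arith q total D (a * b * c) n (n ∸ x) x u (g (suc t′) (suc p)) (m∸n+n≡m x≤n)
              (trans (cong suc (sym eq′)) (shift-arith u))
              (m+n≤o⇒m≤o∸n 3 (≤-trans (three-arith x q x<q) n-q))
              tot (≤-trans (amgm a b c) (*-mono-≤ (*-mono-≤ abc abc) abc)) sum-degrees (at-p p u eq′) n-cubes x<q (≤-trans (m≤m+n (4 * q) 4) n-q)

          finish : ∃[ a ] ∃[ b ] ∃[ c ] (a + b + c + x ≤ n × total ≤ 6 * (a * b * c) + 3 * D) → total ≤ g t n
          finish (a , b , c , sum≤ , tot) = ≤-trans (compare a b c sum≤ tot) (≤-reflexive (cong (λ t → g t n) (sym eq)))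

    -- The excess allowed over `g t n` starts at N³, which covers all ordered triples at n = N, and
    -- drops by one with each further vertex; in the dense case no excess arises.
    progress : (∀ n → N ≤ n → (H : Graph3 n) → Free t H → Dense H → System.total (system H) ≤ g t n) →
      ∀ d n → n ≡ N + d → (H : Graph3 n) → Free t H → System.total (system H) ≤ g t n + (N * (N * N) ∸ d)
    progress dense-case zero n eq H free = trivial n (trans eq (+-identityʳ N)) H
      where
      trivial : ∀ n → n ≡ N → (H : Graph3 n) → System.total (system H) ≤ g t n + N * (N * N)
      trivial _ refl H = ≤-trans (∑-bound (λ x → ∑-bound (λ y → card≤ (System.E (system H) x y)))) (m≤n+m (N * (N * N)) (g t N))
    progress dense-case (suc d) n eq H free = step n (trans eq (+-suc N d)) H free
      where
      p : ℕ
      p = N + d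
      A₂≤ : 40 * (q * q * q) * (t + 3) ≤ suc p
      A₂≤ = ≤-trans N-cubes (≤-trans (m≤m+n N d) (n≤1+n p))
      big : 8 * q * (t + 2 + 1) ≤ suc p
      big = ≤-trans (big-arith q t q₁) A₂≤
      n≡ : suc p ≡ p ∸ t ∸ 1 + (t + 2)
      n≡ = trans (sym (m∸n+n≡m {suc p} {t + 2} (≤-trans (t-arith q t q₁) A₂≤)))
        (cong (_+ (t + 2)) (trans (cong (suc p ∸_) (+-comm t 2)) (trans (cong (p ∸_) (+-comm 1 t)) (sym (∸-+-assoc p t 1)))))
      step : ∀ n → n ≡ suc p → (H : Graph3 n) → Free t H → System.total (system H) ≤ g t n + (N * (N * N) ∸ suc d)
      step _ refl H free = by-density (all? dense?)
        where
        open System (system H) using (deg; total)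
        DenseAt : Fin (suc p) → Set
        DenseAt v = 4 * q * (suc p * suc p) ≤ 18 * q * deg v + suc p * suc p
        dense? : ∀ v → Dec (DenseAt v)
        dense? v = 4 * q * (suc p * suc p) ≤? 18 * q * deg v + suc p * suc p
        delete-low : ∃[ v ] ¬ DenseAt v → total ≤ g t (suc p) + (N * (N * N) ∸ suc d)
        delete-low (v , low) = ≤-trans (total-deleteG H v) (gap-arith (System.total (system (deleteG v H))) (g t p) (N * (N * N)) d (deg v) (g t (suc p))
          (progress dense-case d p refl (deleteG v H) (free ∘ λ P → proj₁ (delete-packing H v P)))
          (low-increment q (deg v) (suc p) (p ∸ t ∸ 1) (t + 2) (g t p) (g t (suc p)) q₁ (s≤s z≤n) n≡ big (<⇒≤ (≰⇒> low)) (g-increment t p)))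
        by-density : Dec (∀ v → DenseAt v) → total ≤ g t (suc p) + (N * (N * N) ∸ suc d)
        by-density (yes dense) = ≤-trans (dense-case (suc p) (≤-trans (m≤m+n N d) (n≤1+n p)) H free dense) (m≤m+n (g t (suc p)) _)
        by-density (no ¬dense) = delete-low (¬∀⟶∃¬ (suc p) DenseAt dense? ¬dense)

  abstract
    -- `width t` bounds the number of vertices of t copies, which q has to exceed in `final-arith`;
    -- the other summand meets the threshold of `stability`.
    precision : ℕ → ℕ
    precision t = width t + 10000001

    precision-large : ∀ t → 10000000 ≤ precision t
    precision-large t = ≤-trans (≤ᵇ⇒≤ 10000000 10000001 _) (m≤n+m 10000001 (width t))

    width<precision : ∀ t → width t + 1 ≤ precision t
    width<precision t = +-monoʳ-≤ (width t) (≤ᵇ⇒≤ 1 10000001 _)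

  -- From N on one of the two steps applies; the remaining gap, at most N³, is
  -- closed by N³ further vertices.
  upper-from : ∀ t n₁ → (∀ t′ → t ≡ suc t′ → Upper t′ n₁) → ∃[ n₀ ] Upper t n₀
  upper-from t n₁ previous = N + N * (N * N) , λ n N≤ H free → ≤-trans (bounded (n ∸ N) n
      (sym (m+[n∸m]≡n (≤-trans (m≤m+n N (N * (N * N))) N≤))) H free)
    (≤-reflexive (trans (cong (g t n +_) (m≤n⇒m∸n≡0 (m+n≤o⇒m≤o∸n (N * (N * N))
      (≤-trans (≤-reflexive (+-comm (N * (N * N)) N)) N≤)))) (+-identityʳ (g t n))))
    where
    q = precision t
    A₁ = stabilityBound (suc (suc (suc (suc k)))) q
    A₂ = 40 * (q * q * q) * (t + 3)
    N = A₁ + A₂ + suc n₁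
    stable : A₁ ≤ N
    stable = ≤-trans (m≤m+n A₁ A₂) (m≤m+n (A₁ + A₂) (suc n₁))
    cubic : A₂ ≤ N
    cubic = ≤-trans (m≤n+m A₂ A₁) (m≤m+n (A₁ + A₂) (suc n₁))
    later : suc n₁ ≤ N
    later = m≤n+m (suc n₁) (A₁ + A₂)
    dense : _
    dense = Induction.dense-case t q N n₁ (precision-large t) (width<precision t) stable cubic later previous
    bounded : ∀ d n → n ≡ N + d → (H : Graph3 n) → Free t H → System.total (system H) ≤ g t n + (N * (N * N) ∸ d)
    bounded = Induction.progress t q N n₁ (precision-large t) (width<precision t) stable cubic later dense

  upper : ∀ t → ∃[ n₀ ] Upper t n₀
  upper zero = upper-from zero 0 λ _ ()
  upper (suc t) = upper-from (suc t) (proj₁ (upper t)) λ { .t refl → proj₂ (upper t) }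

theorem1p5 : (t m : ℕ) → 1 ≤ t → 2 ≤ m →
    ∃[ n₀ ] ((n : ℕ) → n₀ ≤ n →
    (¬ Contains (G t m n) (manyF5S t m))
    × ((H : Graph3 n) → ¬ Contains H (manyF5S t m) → edges H ≤ edges (G t m n)))
theorem1p5 t (suc (suc k)) _ _ = proj₁ (Bounds.upper k t) , λ n n₀≤n →
  InG.G-free t k n ,
  λ H free → *-cancelˡ-≤ 6 (≤-trans (≤-reflexive (sym (total≡6edges H)))
    (≤-trans (proj₂ (Bounds.upper k t) n n₀≤n H (free ∘ Packing⇒Contains (F5S (suc (suc k)))))
      (≤-trans (G-lower t (suc (suc k)) n) (≤-reflexive (total≡6edges (G t (suc (suc k)) n))))))
theorem1p5 t (suc zero) _ (s≤s ())
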